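{- Let $n\geq 36(k+6)$ and let $\mathcal{F}\subset \binom{[n]}{k}$ be an intersecting family. Then $\beta(\mathcal{F})\leq \binom{n-4}{k-3}$.
   Context: $\binom{[n]}{k}$ denotes the family of all $k$-element subsets of $[n]=\{1,\dots,n\}$. A family is intersecting if any two of its members have nonempty intersection. For a family $\mathcal{F}$ of subsets of $[n]$ and distinct $i,j\in[n]$, let $b_{ij}(\mathcal{F})=|\{F\in\mathcal{F}\colon i\in F,\ j\notin F\}|$; the sturdiness is $\beta(\mathcal{F})=\min_{1\leq i\neq j\leq n} b_{ij}(\mathcal{F})$. -}

module Defs where

open import Data.Nat using (ℕ; zero; suc; _∸_; _<ᵇ_; _⊓_)
open import Data.Bool using (Bool; true; false; if_then_else_; _∧_; not)
open import Data.Fin using (Fin; _≟_)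
open import Data.Fin.Subset using (Subset; inside; outside; _∈_; _∩_; Nonempty; ∣_∣)
open import Data.Vec using (lookup)
open import Data.List using (List; []; _∷_; length; filter; concatMap; allFin; foldr)
open import Data.List.Membership.Propositional renaming (_∈_ to _∈ₗ_)
open import Data.List.Relation.Unary.All using (All)
open import Data.List.Relation.Unary.Unique.Propositional using (Unique)
open import Data.Product using (_×_; _,_)
open import Data.Nat.Combinatorics using (_C_)
open import Relation.Nullary using (¬_; does)
open import Relation.Binary.PropositionalEquality using (_≡_)

record Family (n : ℕ) : Set where
  constructor mkFamily
  field
    members : List (Subset n)
    distinct : Unique members
open Family public

Uniform : ∀ {n} → ℕ → Family n → Set
Uniform k 𝓕 = All (λ F → ∣ F ∣ ≡ k) (members 𝓕)

Intersecting : ∀ {n} → Family n → Set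
Intersecting 𝓕 = ∀ {F G} → F ∈ₗ members 𝓕 → G ∈ₗ members 𝓕 → Nonempty (F ∩ G)

isIn : ∀ {n} → Fin n → Subset n → Bool
isIn i F with lookup F i
... | inside = true
... | outside = false

b : ∀ {n} → Family n → Fin n → Fin n → ℕ
b 𝓕 i j = length (filter (λ F → Data.Bool._≟_ (isIn i F ∧ not (isIn j F)) true) (members 𝓕))

distinctPairs : (n : ℕ) → List (Fin n × Fin n)
distinctPairs n =
  concatMap (λ i → Data.List.map (i ,_) (filter (λ j → Relation.Nullary.¬? (i ≟ j)) (allFin n))) (allFin n)

minimumOr : ℕ → List ℕ → ℕ
minimumOr d [] = d
minimumOr d (x ∷ xs) = foldr _⊓_ x xs

-- sturdiness β(𝓕) = min_{i ≠ j} b_ij(𝓕)  (value 0 if n < 2, irrelevant here)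
β : ∀ {n} → Family n → ℕ
β {n} 𝓕 = minimumOr 0 (Data.List.map (λ p → b 𝓕 (Data.Product.proj₁ p) (Data.Product.proj₂ p)) (distinctPairs n))

-- binomial coefficient with integer lower index k - 3: zero when k < 3
binomMinus3 : ℕ → ℕ → ℕ
binomMinus3 m k = if k <ᵇ 3 then 0 else (m C (k ∸ 3))

{-# OPTIONS --safe #-}
module Submission where

{-
Write u = C(n-3, k-3), F(x̄) for the members of F avoiding x, and suppose that every b_ij exceeds
C(n-4, k-3). Double counting gives |F(x̄)| ≥ 35 u for every x. An intersecting family with |F| ≥ 35 u
and |F(x̄)| ≥ 9 u for every x has a heavy triangle: three points such that any two of them lie together
in more than 3 u members. To see this, compress F (replace y by x < y) as long as all |F(x̄)| stay at
least 9 u; a heavy triangle can be pulled back along a compression. When no such compression is left, a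
pair {x, y} is either stable or an edge, that is, fewer than 9 u members avoid x and y. Three disjoint
edges cannot exist, because only 8 u members meet all of them; so F is stable outside at most two edges,
and the triangle is found by comparing the traces of F on these edges and one or two further points.

The tool for comparing traces is a substitute for the Kruskal-Katona theorem. After simultaneous
compression two cross-intersecting families A, B are read as families of ±1 walks; a walk of A and a
walk of B cannot both stay low, and by reflection the k-sets whose walk reaches height l number at most
C(m, k-l). In particular, if |A| is more than 2 C(m-1, a-1), then |B| ≤ C(m, b-3).

Finally let {a, b, c} be a heavy triangle. Each family of members meeting it in at most one point is
small, and forces many more sets to be missing from F(ā, b, c) than it contains itself. Averaging b_xa
over the points x outside the triangle, for a suitable choice of a, gives b_xa ≤ C(n-4, k-3) for some x.
-}

open import Defs
open import Data.Nat using (ℕ; zero; suc; nonZero; >-nonZero; _+_; _*_; _∸_; _≤_; _<_; z≤n; s≤s; s≤s⁻¹; z<s;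
  _⊓_; _≤ᵇ_; _≤?_; _<?_)
open import Data.Nat.Properties hiding (_≟_)
open import Data.Nat.Combinatorics using (_C_; nCk+nC[k+1]≡[n+1]C[k+1]; k>n⇒nCk≡0)
open import Data.Nat.Induction using (<-wellFounded)
open import Data.Nat.Tactic.RingSolver using (solve-∀)
open import Induction.WellFounded using (Acc; acc)
open import Data.Bool using (Bool; T; true; false; _∧_; _∨_; not)
open import Data.Bool.Properties using (∧-zeroʳ; ∧-identityʳ; ∧-comm; ∧-assoc;
  ∧-distribʳ-∨) renaming (_≟_ to _≟ᵇ_)
open import Data.Fin using (Fin; zero; suc; toℕ; _≟_)
open import Data.Fin.Properties using (any?; toℕ-injective)
open import Data.Fin.Subset using (Subset) renaming (∣_∣ to size)
open import Data.Vec using (Vec; []; _∷_; lookup; _[_]≔_; replicate)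
open import Data.Vec.Properties using (lookup∘update; lookup∘update′; []≔-commutes; []≔-idempotent;
  []≔-lookup; lookup-replicate; []=⇒lookup; ≡-dec)
open import Data.List using (List; []; _∷_; length; filter; allFin; foldr)
open import Data.Product using (∃; ∃-syntax; ∃₂; _×_; _,_; proj₁; proj₂)
open import Data.Sum using (_⊎_; inj₁; inj₂)
open import Data.Empty using (⊥; ⊥-elim)
open import Data.Unit using (⊤; tt)
open import Function using (_∘_)
open import Relation.Nullary using (¬_; ¬?; Dec; yes; no; contradiction; does)
open import Relation.Binary.PropositionalEquality using (_≡_; _≢_; refl; sym; trans; cong; cong₂; subst;
  subst₂; _≗_; ≢-sym; module ≡-Reasoning)
open import Relation.Nullary.Decidable using (_×-dec_)
open import Data.List.Membership.Propositional using (lose) renaming (_∈_ to _∈ₗ_)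
open import Data.List.Membership.Propositional.Properties using (∈-filter⁺; ∈-filter⁻; ∈-map⁺; ∈-concatMap⁺;
  ∈-allFin)
open import Data.List.Relation.Unary.Any as Any using (Any)
open import Data.List.Relation.Unary.All as All using (All; []; _∷_)
open import Data.List.Relation.Unary.AllPairs using ([]; _∷_)
open import Data.List.Relation.Unary.Unique.Propositional using (Unique)
open import Data.List.Relation.Unary.Unique.Propositional.Properties using (filter⁺)
import Data.Bool
open import Data.Fin.Subset.Properties using (x∈p∩q⁻)

-- The hypothesis gives 36 k ≤ n - 3, so v = C(n-3, k-4) is at most u / 35. Up to an error of a few
-- v, all sizes then become small multiples of u, and every case distinction is a linear inequality
-- with an explicit certificate. The gap between 36 k and 35 k later absorbs shifts of n by as much
-- as k + 3. The obstacle is that a compression towards x can lower |F(x̄)|. A family compressed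
-- without restraint may end as a star, and a star has no heavy triangle: two of any three points
-- differ from its centre, and at most u members contain both. Hence two thresholds: |F| is
-- invariant and stays at least 35 u, while |F(x̄)| is only guarded at 9 u. This guard is large
-- enough to be used repeatedly: after all traces disjoint from a heavy pair have been discarded,
-- enough of the 9 u remains to make another pair heavy. The price of the guard is that compression
-- can get stuck at an edge, which is why edges have to be studied at all.

infixl 6 _⊕_
infixl 7 _⊗_

-- Linear inequalities over the naturals

data Expr : Set where
  #_ : ℕ → Expr
  lit : ℕ → Expr
  _⊕_ : Expr → Expr → Expr
  _⊗_ : ℕ → Expr → Expr
  sucᴱ : Expr → Expr

valueAt : List ℕ → ℕ → ℕ
valueAt [] _ = 0
valueAt (x ∷ _) zero = x
valueAt (_ ∷ ρ) (suc i) = valueAt ρ i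

⟦_⟧ : Expr → List ℕ → ℕ
⟦ # i ⟧ ρ = valueAt ρ i
⟦ lit c ⟧ ρ = c
⟦ e ⊕ e′ ⟧ ρ = ⟦ e ⟧ ρ + ⟦ e′ ⟧ ρ
⟦ c ⊗ e ⟧ ρ = c * ⟦ e ⟧ ρ
⟦ sucᴱ e ⟧ ρ = suc (⟦ e ⟧ ρ)

-- The lists may differ in length: a missing entry counts as zero, in agreement with the default of
-- `valueAt`.
dot : List ℕ → List ℕ → ℕ
dot [] _ = 0
dot (_ ∷ _) [] = 0
dot (c ∷ cs) (x ∷ ρ) = c * x + dot cs ρ

addᶜ : List ℕ → List ℕ → List ℕ
addᶜ [] ds = ds
addᶜ (c ∷ cs) [] = c ∷ cs
addᶜ (c ∷ cs) (d ∷ ds) = (c + d) ∷ addᶜ cs ds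

scaleᶜ : ℕ → List ℕ → List ℕ
scaleᶜ a [] = []
scaleᶜ a (c ∷ cs) = a * c ∷ scaleᶜ a cs

unitᶜ : ℕ → List ℕ
unitᶜ zero = 1 ∷ []
unitᶜ (suc i) = 0 ∷ unitᶜ i

-- The coefficient list is read against 1 ∷ ρ, so its head is the constant term.
coeffs : Expr → List ℕ
coeffs (# i) = 0 ∷ unitᶜ i
coeffs (lit c) = c ∷ []
coeffs (e ⊕ e′) = addᶜ (coeffs e) (coeffs e′)
coeffs (c ⊗ e) = scaleᶜ c (coeffs e)
coeffs (sucᴱ e) = addᶜ (1 ∷ []) (coeffs e)

dot-addᶜ : ∀ cs ds ρ → dot (addᶜ cs ds) ρ ≡ dot cs ρ + dot ds ρ
dot-addᶜ [] ds ρ = refl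
dot-addᶜ (c ∷ cs) [] [] = refl
dot-addᶜ (c ∷ cs) [] (x ∷ ρ) = sym (+-identityʳ _)
dot-addᶜ (c ∷ cs) (d ∷ ds) [] = refl
dot-addᶜ (c ∷ cs) (d ∷ ds) (x ∷ ρ) rewrite dot-addᶜ cs ds ρ = rearrange c d x (dot cs ρ) (dot ds ρ)
  where
  rearrange : ∀ c d x s t → (c + d) * x + (s + t) ≡ (c * x + s) + (d * x + t)
  rearrange = solve-∀

dot-scaleᶜ : ∀ a cs ρ → dot (scaleᶜ a cs) ρ ≡ a * dot cs ρ
dot-scaleᶜ a [] ρ = sym (*-zeroʳ a)
dot-scaleᶜ a (c ∷ cs) [] = sym (*-zeroʳ a)
dot-scaleᶜ a (c ∷ cs) (x ∷ ρ) rewrite dot-scaleᶜ a cs ρ = rearrange a c x (dot cs ρ)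
  where
  rearrange : ∀ a c x s → a * c * x + a * s ≡ a * (c * x + s)
  rearrange = solve-∀

dot-unitᶜ : ∀ i ρ → dot (unitᶜ i) ρ ≡ valueAt ρ i
dot-unitᶜ zero [] = refl
dot-unitᶜ zero (x ∷ ρ) = trans (+-identityʳ _) (*-identityˡ x)
dot-unitᶜ (suc i) [] = refl
dot-unitᶜ (suc i) (x ∷ ρ) = dot-unitᶜ i ρ

coeffs-sound : ∀ e ρ → dot (coeffs e) (1 ∷ ρ) ≡ ⟦ e ⟧ ρ
coeffs-sound (# i) ρ = dot-unitᶜ i ρ
coeffs-sound (lit c) ρ = trans (+-identityʳ _) (*-identityʳ c)
coeffs-sound (e ⊕ e′) ρ =
  trans (dot-addᶜ (coeffs e) (coeffs e′) (1 ∷ ρ)) (cong₂ _+_ (coeffs-sound e ρ) (coeffs-sound e′ ρ))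
coeffs-sound (c ⊗ e) ρ = trans (dot-scaleᶜ c (coeffs e) (1 ∷ ρ)) (cong (c *_) (coeffs-sound e ρ))
coeffs-sound (sucᴱ e) ρ = trans (dot-addᶜ (1 ∷ []) (coeffs e) (1 ∷ ρ)) (cong suc (coeffs-sound e ρ))

-- Comparing coefficient by coefficient is sound because the variables take natural values. The test
-- computes, so a certificate is checked by `refl`.
dominated : List ℕ → List ℕ → Bool
dominated [] _ = true
dominated (c ∷ cs) [] = (c ≤ᵇ 0) ∧ dominated cs []
dominated (c ∷ cs) (d ∷ ds) = (c ≤ᵇ d) ∧ dominated cs ds

≤ᵇ-sound : ∀ m n → (m ≤ᵇ n) ≡ true → m ≤ n
≤ᵇ-sound m n eq = ≤ᵇ⇒≤ m n (subst T (sym eq) tt)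

∧-true : ∀ {x y} → x ∧ y ≡ true → x ≡ true × y ≡ true
∧-true {true} {true} _ = refl , refl

dominated-sound : ∀ cs ds ρ → dominated cs ds ≡ true → dot cs ρ ≤ dot ds ρ
dominated-sound [] ds ρ eq = z≤n
dominated-sound (c ∷ cs) ds [] eq = z≤n
dominated-sound (c ∷ cs) [] (x ∷ ρ) eq with ∧-true {(c ≤ᵇ 0)} eq
... | c≤0 , rest rewrite n≤0⇒n≡0 (≤ᵇ-sound c 0 c≤0) = dominated-sound cs [] ρ rest
dominated-sound (c ∷ cs) (d ∷ ds) (x ∷ ρ) eq with ∧-true {(c ≤ᵇ d)} eq
... | c≤d , rest = +-mono-≤ (*-monoˡ-≤ x (≤ᵇ-sound c d c≤d)) (dominated-sound cs ds ρ rest)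

infix 4 _∙_≼_by_

data Hyp (ρ : List ℕ) : Set where
  _∙_≼_by_ : ℕ → (l r : Expr) → ⟦ l ⟧ ρ ≤ ⟦ r ⟧ ρ → Hyp ρ

lhs rhs : ∀ {ρ} → List (Hyp ρ) → List ℕ
lhs [] = []
lhs ((c ∙ l ≼ _ by _) ∷ hs) = addᶜ (scaleᶜ c (coeffs l)) (lhs hs)
rhs [] = []
rhs ((c ∙ _ ≼ r by _) ∷ hs) = addᶜ (scaleᶜ c (coeffs r)) (rhs hs)

lhs≤rhs : ∀ {ρ} (hs : List (Hyp ρ)) → dot (lhs hs) (1 ∷ ρ) ≤ dot (rhs hs) (1 ∷ ρ)
lhs≤rhs [] = z≤n
lhs≤rhs {ρ} ((c ∙ l ≼ r by p) ∷ hs) = begin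
  dot (addᶜ (scaleᶜ c (coeffs l)) (lhs hs)) (1 ∷ ρ) ≡⟨ expand l (lhs hs) ⟩
  c * ⟦ l ⟧ ρ + dot (lhs hs) (1 ∷ ρ)                ≤⟨ +-mono-≤ (*-monoʳ-≤ c p) (lhs≤rhs hs) ⟩
  c * ⟦ r ⟧ ρ + dot (rhs hs) (1 ∷ ρ)                ≡⟨ expand r (rhs hs) ⟨
  dot (addᶜ (scaleᶜ c (coeffs r)) (rhs hs)) (1 ∷ ρ) ∎
  where
  open ≤-Reasoning
  expand : ∀ e cs → dot (addᶜ (scaleᶜ c (coeffs e)) cs) (1 ∷ ρ) ≡ c * ⟦ e ⟧ ρ + dot cs (1 ∷ ρ)
  expand e cs = trans (dot-addᶜ (scaleᶜ c (coeffs e)) cs (1 ∷ ρ))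
    (cong (_+ dot cs (1 ∷ ρ)) (trans (dot-scaleᶜ c (coeffs e) (1 ∷ ρ)) (cong (c *_) (coeffs-sound e ρ))))

-- A Farkas certificate: c ∙ l ≼ r by p is the hypothesis p taken with multiplier c. In entail, the
-- negated goal is a further hypothesis, with multiplier c.
refute : ∀ ρ (hs : List (Hyp ρ)) → dominated (addᶜ (1 ∷ []) (rhs hs)) (lhs hs) ≡ true → ⊥
refute ρ hs eq = <-irrefl refl (≤-trans
  (≤-trans (≤-reflexive (sym (dot-addᶜ (1 ∷ []) (rhs hs) (1 ∷ ρ))))
           (dominated-sound (addᶜ (1 ∷ []) (rhs hs)) (lhs hs) (1 ∷ ρ) eq))
  (lhs≤rhs hs))

entail : ∀ ρ c l r (hs : List (Hyp ρ)) →
  (∀ {p} → dominated (addᶜ (1 ∷ []) (rhs ((c ∙ sucᴱ r ≼ l by p) ∷ hs))) (lhs ((c ∙ sucᴱ r ≼ l by p) ∷ hs)) ≡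
    true) →
  ⟦ l ⟧ ρ ≤ ⟦ r ⟧ ρ
entail ρ c l r hs eq = ≮⇒≥ λ lt → refute ρ ((c ∙ sucᴱ r ≼ l by lt) ∷ hs) (eq {lt})

≡⇒≥ : ∀ {m n : ℕ} → m ≡ n → n ≤ m
≡⇒≥ eq = ≤-reflexive (sym eq)

-- Binomial coefficients

-- bin m k i is C(m, k - i) with the integer difference k - i, hence 0 when k < i.
bin : ℕ → ℕ → ℕ → ℕ
bin m k zero = m C k
bin m zero (suc i) = 0
bin m (suc k) (suc i) = bin m k i

-- The value zero of `bin` for `k < i` makes Pascal's rule hold at the boundary too, so `k` and `i`
-- can stay arbitrary throughout.
bin-pascal : ∀ m k i → bin (suc m) k i ≡ bin m k i + bin m k (suc i)
bin-pascal m zero zero = refl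
bin-pascal m (suc k) zero = trans (sym (nCk+nC[k+1]≡[n+1]C[k+1] m k)) (+-comm (m C k) (m C suc k))
bin-pascal m zero (suc i) = refl
bin-pascal m (suc k) (suc i) = bin-pascal m k i

bin-mono : ∀ {m m′} k i → m ≤ m′ → bin m k i ≤ bin m′ k i
bin-mono {m} {m′} k i m≤m′ = subst (λ x → bin m k i ≤ bin x k i) (m+[n∸m]≡n m≤m′) (go (m′ ∸ m))
  where
  go : ∀ d → bin m k i ≤ bin (m + d) k i
  go zero = ≤-reflexive (cong (λ x → bin x k i) (sym (+-identityʳ m)))
  go (suc d) = ≤-trans (go d) (≤-trans (m≤m+n _ _)
    (≤-reflexive (trans (sym (bin-pascal (m + d) k i)) (cong (λ x → bin x k i) (sym (+-suc m d))))))

-- The identity (j+1) C(m, j+1) = (m-j) C(m, j) with the subtraction moved to the other side, where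
-- truncation cannot interfere. Pascal's rule reduces `suc m` to `m`.
C-absorption : ∀ m j → suc j * (m C suc j) + j * (m C j) ≡ m * (m C j)
C-absorption zero zero = refl
C-absorption zero (suc j) rewrite k>n⇒nCk≡0 {0} {suc j} z<s | k>n⇒nCk≡0 {0} {suc (suc j)} z<s | *-zeroʳ j = refl
C-absorption (suc m) zero
  rewrite sym (nCk+nC[k+1]≡[n+1]C[k+1] m 0) =
  trans (rearrange (m C 0) (m C 1)) (trans (cong (m C 0 +_) (C-absorption m 0)) refl)
  where
  rearrange : ∀ x y → 1 * (x + y) + 0 ≡ x + (1 * y + 0)
  rearrange = solve-∀
C-absorption (suc m) (suc j)
  rewrite sym (nCk+nC[k+1]≡[n+1]C[k+1] m j) | sym (nCk+nC[k+1]≡[n+1]C[k+1] m (suc j)) =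
  trans (rearrange j (m C j) (m C suc j) (m C suc (suc j)))
  (trans (cong₂ (λ s t → s + t + (m C suc j + m C j)) (C-absorption m (suc j)) (C-absorption m j))
  (collect m (m C j) (m C suc j)))
  where
  rearrange : ∀ j x y z → suc (suc j) * (y + z) + suc j * (x + y) ≡
    (suc (suc j) * z + suc j * y) + (suc j * y + j * x) + (y + x)
  rearrange = solve-∀
  collect : ∀ m x y → m * y + m * x + (y + x) ≡ suc m * (x + y)
  collect = solve-∀

bin-absorption : ∀ m k i → i < k → (k ∸ i) * bin m k i + (k ∸ suc i) * bin m k (suc i) ≡ m * bin m k (suc i)
bin-absorption m (suc j) zero _ = C-absorption m j
bin-absorption m (suc k) (suc i) (s≤s i<k) = bin-absorption m k i i<k

bin-zero : ∀ m {k i} → k < i → bin m k i ≡ 0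
bin-zero m {zero} {suc i} _ = refl
bin-zero m {suc k} {suc i} (s≤s k<i) = bin-zero m k<i

-- By absorption the ratio of the two coefficients is (m - (k-i-1)) / (k-i), which is at least c
-- once (c+1) k ≤ m. With 36 k ≤ n - 3 this is the source of the factor 35.
bin-decay : ∀ c m k i → suc c * k ≤ m → c * bin m k (suc i) ≤ bin m k i
bin-decay c m k i ck≤m with i <? k
... | no i≮k rewrite bin-zero m {k} {suc i} (s≤s (≮⇒≥ i≮k)) | *-zeroʳ c = z≤n
... | yes i<k = *-cancelˡ-≤ (k ∸ i) {{>-nonZero (m<n⇒0<n∸m i<k)}} (begin
  (k ∸ i) * (c * y)                          ≡⟨ regroup (k ∸ i) c y ⟩
  (c * (k ∸ i)) * y                          ≤⟨ *-monoˡ-≤ y (m+n≤o⇒m≤o∸n (c * (k ∸ i)) enough) ⟩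
  (m ∸ (k ∸ suc i)) * y                      ≡⟨ *-distribʳ-∸ y m (k ∸ suc i) ⟩
  m * y ∸ (k ∸ suc i) * y                    ≡⟨ cong (_∸ (k ∸ suc i) * y) (bin-absorption m k i i<k) ⟨
  (k ∸ i) * bin m k i + (k ∸ suc i) * y ∸ (k ∸ suc i) * y ≡⟨ m+n∸n≡m _ ((k ∸ suc i) * y) ⟩
  (k ∸ i) * bin m k i                        ∎)
  where
  open ≤-Reasoning
  y : ℕ
  y = bin m k (suc i)
  regroup : ∀ a b c → a * (b * c) ≡ b * a * c
  regroup = solve-∀
  enough : c * (k ∸ i) + (k ∸ suc i) ≤ m
  enough = ≤-trans (+-mono-≤ (*-monoʳ-≤ c (m∸n≤m k i)) (m∸n≤m k (suc i)))
    (≤-trans (≤-reflexive (+-comm (c * k) k)) ck≤m)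

-- Families of subsets and their sizes

Fam : ℕ → Set
Fam n = Subset n → Bool

bit : Bool → ℕ
bit true = 1
bit false = 0

total : ∀ {n} → (Subset n → ℕ) → ℕ
total {zero} g = g []
total {suc n} g = total (g ∘ (true ∷_)) + total (g ∘ (false ∷_))

count : ∀ {n} → Fam n → ℕ
count F = total (bit ∘ F)

restrict : ∀ {n} → Fam n → Fin n → Bool → Fam n
restrict F x true S = F S ∧ lookup S x
restrict F x false S = F S ∧ not (lookup S x)

infixl 9 _⁺_ _⁻_

_⁺_ _⁻_ : ∀ {n} → Fam n → Fin n → Fam n
F ⁺ x = restrict F x true
F ⁻ x = restrict F x false

total-mono : ∀ {n} {f g : Subset n → ℕ} → (∀ S → f S ≤ g S) → total f ≤ total g
total-mono {zero} h = h []
total-mono {suc n} h = +-mono-≤ (total-mono (h ∘ (true ∷_))) (total-mono (h ∘ (false ∷_)))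

total-mono-< : ∀ {n} {f g : Subset n → ℕ} → (∀ S → f S ≤ g S) → ∀ S → f S < g S → total f < total g
total-mono-< h [] lt = lt
total-mono-< h (true ∷ S) lt = +-mono-<-≤ (total-mono-< (h ∘ (true ∷_)) S lt) (total-mono (h ∘ (false ∷_)))
total-mono-< h (false ∷ S) lt = +-mono-≤-< (total-mono (h ∘ (true ∷_))) (total-mono-< (h ∘ (false ∷_)) S lt)

total-cong : ∀ {n} {f g : Subset n → ℕ} → (∀ S → f S ≡ g S) → total f ≡ total g
total-cong {zero} h = h []
total-cong {suc n} h = cong₂ _+_ (total-cong (h ∘ (true ∷_))) (total-cong (h ∘ (false ∷_)))

+-interchange : ∀ a b c d → (a + b) + (c + d) ≡ (a + c) + (b + d)
+-interchange = solve-∀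

total-+ : ∀ {n} (f g : Subset n → ℕ) → total (λ S → f S + g S) ≡ total f + total g
total-+ {zero} f g = refl
total-+ {suc n} f g = trans
  (cong₂ _+_ (total-+ (f ∘ (true ∷_)) (g ∘ (true ∷_))) (total-+ (f ∘ (false ∷_)) (g ∘ (false ∷_))))
  (+-interchange (total (f ∘ (true ∷_))) _ _ _)

restrict⁻ : ∀ {n} (F : Fam n) x b S → restrict F x b S ≡ true → F S ≡ true × lookup S x ≡ b
restrict⁻ F x true S eq = ∧-true {F S} eq
restrict⁻ F x false S eq with F S | lookup S x
... | true | false = refl , refl

restrict⁺ : ∀ {n} (F : Fam n) x b S → F S ≡ true → lookup S x ≡ b → restrict F x b S ≡ true
restrict⁺ F x true S p q rewrite p | q = refl
restrict⁺ F x false S p q rewrite p | q = refl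

restrict-cong : ∀ {n} {F G : Fam n} → F ≗ G → ∀ x b → restrict F x b ≗ restrict G x b
restrict-cong eq x true S = cong (_∧ _) (eq S)
restrict-cong eq x false S = cong (_∧ _) (eq S)

∧-swapʳ : ∀ p q r → (p ∧ q) ∧ r ≡ (p ∧ r) ∧ q
∧-swapʳ p q r = trans (∧-assoc p q r) (trans (cong (p ∧_) (∧-comm q r)) (sym (∧-assoc p r q)))

restrict-comm : ∀ {n} (F : Fam n) x b y c → restrict (restrict F x b) y c ≗ restrict (restrict F y c) x b
restrict-comm F x true y true S = ∧-swapʳ (F S) (lookup S x) (lookup S y)
restrict-comm F x true y false S = ∧-swapʳ (F S) (lookup S x) (not (lookup S y))
restrict-comm F x false y true S = ∧-swapʳ (F S) (not (lookup S x)) (lookup S y)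
restrict-comm F x false y false S = ∧-swapʳ (F S) (not (lookup S x)) (not (lookup S y))

bit-mono : ∀ {p q} → (p ≡ true → q ≡ true) → bit p ≤ bit q
bit-mono {false} h = z≤n
bit-mono {true} {true} h = s≤s z≤n
bit-mono {true} {false} h = contradiction (h refl) λ ()

count-mono : ∀ {n} (F G : Fam n) → (∀ S → F S ≡ true → G S ≡ true) → count F ≤ count G
count-mono F G h = total-mono λ S → bit-mono (h S)

count-cong : ∀ {n} {F G : Fam n} → F ≗ G → count F ≡ count G
count-cong h = total-cong (cong bit ∘ h)

count-restrict : ∀ {n} (F : Fam n) x b → count (restrict F x b) ≤ count F
count-restrict F x b = count-mono (restrict F x b) F λ S e → proj₁ (restrict⁻ F x b S e)

count-split : ∀ {n} (F : Fam n) x → count F ≡ count (F ⁺ x) + count (F ⁻ x)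
count-split F x = trans (total-cong λ S → pointwise (F S) (lookup S x))
  (total-+ (bit ∘ (F ⁺ x)) (bit ∘ (F ⁻ x)))
  where
  pointwise : ∀ p q → bit p ≡ bit (p ∧ q) + bit (p ∧ not q)
  pointwise true true = refl
  pointwise true false = refl
  pointwise false q = refl

count-restrict-comm : ∀ {n} (F : Fam n) x b y c →
  count (restrict (restrict F x b) y c) ≡ count (restrict (restrict F y c) x b)
count-restrict-comm F x b y c = count-cong (restrict-comm F x b y c)

count-split₂ : ∀ {n} (F : Fam n) x b y →
  count (restrict F x b) ≡ count (restrict (F ⁺ y) x b) + count (restrict (F ⁻ y) x b)
count-split₂ F x b y = trans (count-split (restrict F x b) y)
  (cong₂ _+_ (count-restrict-comm F x b y true) (count-restrict-comm F x b y false))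

count-empty : ∀ {n} {F : Fam n} → (∀ S → F S ≡ true → ⊥) → count F ≡ 0
count-empty {zero} {F} h with F [] | h []
... | true | e = ⊥-elim (e refl)
... | false | _ = refl
count-empty {suc n} {F} h = cong₂ _+_ (count-empty (h ∘ (true ∷_))) (count-empty (h ∘ (false ∷_)))

find : ∀ {n} (F : Fam n) → (∃[ S ] F S ≡ true) ⊎ (∀ S → F S ≡ true → ⊥)
find {zero} F with F [] in eq
... | true = inj₁ ([] , eq)
... | false = inj₂ λ { [] e → contradiction (trans (sym e) eq) λ () }
find {suc n} F with find (F ∘ (true ∷_)) | find (F ∘ (false ∷_))
... | inj₁ (S , e) | _ = inj₁ (true ∷ S , e)
... | inj₂ _ | inj₁ (S , e) = inj₁ (false ∷ S , e)
... | inj₂ h | inj₂ h′ = inj₂ λ { (true ∷ S) → h S ; (false ∷ S) → h′ S }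

member : ∀ {n} {F : Fam n} → 0 < count F → ∃[ S ] F S ≡ true
member {F = F} lt with find F
... | inj₁ p = p
... | inj₂ h = contradiction (count-empty h) (>⇒≢ lt)

-- Compressions

cof : ∀ {n} → Fin n → Fin n → Bool → Bool → Subset n → Subset n
cof x y b c S = (S [ x ]≔ b) [ y ]≔ c

-- Overwriting position `x` by either value, over all `S`, produces every set exactly twice. This
-- replaces a splitting of the vector at `x`, so exchange arguments can treat arbitrary positions.
total-cofactor : ∀ {n} (g : Subset n → ℕ) x →
  2 * total g ≡ total (λ S → g (S [ x ]≔ true)) + total (λ S → g (S [ x ]≔ false))
total-cofactor g zero = rearrange (total (g ∘ (true ∷_))) (total (g ∘ (false ∷_)))
  where
  rearrange : ∀ a b → 2 * (a + b) ≡ (a + a) + (b + b)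
  rearrange = solve-∀
total-cofactor g (suc x) = trans (*-distribˡ-+ 2 (total (g ∘ (true ∷_))) _)
  (trans (cong₂ _+_ (total-cofactor (g ∘ (true ∷_)) x) (total-cofactor (g ∘ (false ∷_)) x))
         (+-interchange (total λ S → g (true ∷ S [ x ]≔ true)) _ _ _))

cofactorSum : ∀ {n} → Fin n → Fin n → (Subset n → ℕ) → Subset n → ℕ
cofactorSum x y g S =
  (g (cof x y true true S) + g (cof x y false true S)) + (g (cof x y true false S) + g (cof x y false false S))

total-cofactors : ∀ {n} x y (g : Subset n → ℕ) → 4 * total g ≡ total (cofactorSum x y g)
total-cofactors x y g = begin
  4 * total g ≡⟨ *-assoc 2 2 (total g) ⟩
  2 * (2 * total g) ≡⟨ cong (2 *_) (total-cofactor g y) ⟩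
  2 * (total (gy true) + total (gy false)) ≡⟨ *-distribˡ-+ 2 (total (gy true)) _ ⟩
  2 * total (gy true) + 2 * total (gy false) ≡⟨ cong₂ _+_ (split true) (split false) ⟩
  total (λ S → g (cof x y true true S) + g (cof x y false true S)) +
  total (λ S → g (cof x y true false S) + g (cof x y false false S)) ≡⟨
    total-+ (λ S → g (cof x y true true S) + g (cof x y false true S)) (λ S →
      g (cof x y true false S) + g (cof x y false false S)) ⟨
  total (cofactorSum x y g) ∎
  where
  open ≡-Reasoning
  gy : Bool → Subset _ → ℕ
  gy c S = g (S [ y ]≔ c)
  split : ∀ c → 2 * total (gy c) ≡ total (λ S → g (cof x y true c S) + g (cof x y false c S))
  split c = trans (total-cofactor (gy c) x) (sym (total-+ (λ S → gy c (S [ x ]≔ true)) _))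

-- An exchange of `x` and `y` acts inside the four sets that arise from `S` by overwriting both
-- positions, so it is enough to compare these quadruples.
total-exchange : ∀ {n} x y {f g : Subset n → ℕ} → (∀ S → cofactorSum x y f S ≤ cofactorSum x y g S) →
  total f ≤ total g
total-exchange x y {f} {g} h =
  *-cancelˡ-≤ 4 (subst₂ _≤_ (sym (total-cofactors x y f)) (sym (total-cofactors x y g)) (total-mono h))

total-exchange-< : ∀ {n} x y {f g : Subset n → ℕ} → (∀ S → cofactorSum x y f S ≤ cofactorSum x y g S) →
  ∀ S → cofactorSum x y f S < cofactorSum x y g S → total f < total g
total-exchange-< x y {f} {g} h S lt =
  *-cancelˡ-< 4 _ _ (subst₂ _<_ (sym (total-cofactors x y f)) (sym (total-cofactors x y g))
    (total-mono-< h S lt))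

cof-lookupʸ : ∀ {n} x y b c (S : Subset n) → lookup (cof x y b c S) y ≡ c
cof-lookupʸ x y b c S = lookup∘update y (S [ x ]≔ b) c

cof-lookupˣ : ∀ {n} {x y} → x ≢ y → ∀ b c (S : Subset n) → lookup (cof x y b c S) x ≡ b
cof-lookupˣ {x = x} {y} x≢y b c S = trans (lookup∘update′ x≢y (S [ x ]≔ b) c) (lookup∘update x S b)

cof-lookup : ∀ {n} {x y z} → z ≢ x → z ≢ y → ∀ b c (S : Subset n) → lookup (cof x y b c S) z ≡ lookup S z
cof-lookup {x = x} z≢x z≢y b c S = trans (lookup∘update′ z≢y (S [ x ]≔ b) c) (lookup∘update′ z≢x S b)

cof-cof : ∀ {n} {x y} → x ≢ y → ∀ b c b′ c′ (S : Subset n) → cof x y b c (cof x y b′ c′ S) ≡ cof x y b c S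
cof-cof {x = x} {y} x≢y b c b′ c′ S = begin
  (((S [ x ]≔ b′) [ y ]≔ c′) [ x ]≔ b) [ y ]≔ c ≡⟨ cong (_[ y ]≔ c) ([]≔-commutes (S [ x ]≔ b′) y x (≢-sym x≢y))
    ⟩
  (((S [ x ]≔ b′) [ x ]≔ b) [ y ]≔ c′) [ y ]≔ c ≡⟨ []≔-idempotent ((S [ x ]≔ b′) [ x ]≔ b) y ⟩
  ((S [ x ]≔ b′) [ x ]≔ b) [ y ]≔ c             ≡⟨ cong (_[ y ]≔ c) ([]≔-idempotent S x) ⟩
  (S [ x ]≔ b) [ y ]≔ c                         ∎
  where open ≡-Reasoning

cof-self : ∀ {n} {x y} {b c} (S : Subset n) → lookup S x ≡ b → lookup S y ≡ c → cof x y b c S ≡ S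
cof-self {x = x} {y} S refl refl = trans (cong (_[ y ]≔ lookup S y) ([]≔-lookup S x)) ([]≔-lookup S y)

-- `up` is membership of the set with `y` in place of `x`, `down` that of the set with `x` in place
-- of `y`. The Boolean form is what makes compression commute with restriction at other positions.
compressAt : Bool → Bool → Bool → Bool → Bool → Bool
compressAt true false here up down = here ∨ up
compressAt false true here up down = here ∧ down
compressAt true true here _ _ = here
compressAt false false here _ _ = here

compressAt-∧ : ∀ a b here up down p → compressAt a b here up down ∧ p ≡ compressAt a b (here ∧ p) (up ∧ p)
  (down ∧ p)
compressAt-∧ true true here up down p = refl
compressAt-∧ true false here up down p = ∧-distribʳ-∨ p here up
compressAt-∧ false true false up down p = refl
compressAt-∧ false true true up down true = refl
compressAt-∧ false true true up down false = ∧-zeroʳ down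
compressAt-∧ false false here up down p = refl

compress : ∀ {n} → Fin n → Fin n → Fam n → Fam n
compress x y F S = compressAt (lookup S x) (lookup S y) (F S) (F (cof x y false true S))
  (F (cof x y true false S))

module _ {n} {x y : Fin n} (x≢y : x ≢ y) (F : Fam n) where

  compress-11 : ∀ S → compress x y F (cof x y true true S) ≡ F (cof x y true true S)
  compress-11 S rewrite cof-lookupˣ x≢y true true S | cof-lookupʸ x y true true S = refl

  compress-00 : ∀ S → compress x y F (cof x y false false S) ≡ F (cof x y false false S)
  compress-00 S rewrite cof-lookupˣ x≢y false false S | cof-lookupʸ x y false false S = refl

  compress-10 : ∀ S → compress x y F (cof x y true false S) ≡ F (cof x y true false S) ∨ F
    (cof x y false true S)
  compress-10 S rewrite cof-lookupˣ x≢y true false S | cof-lookupʸ x y true false S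
    | cof-cof x≢y false true true false S = refl

  compress-01 : ∀ S → compress x y F (cof x y false true S) ≡ F (cof x y false true S) ∧ F
    (cof x y true false S)
  compress-01 S rewrite cof-lookupˣ x≢y false true S | cof-lookupʸ x y false true S
    | cof-cof x≢y true false false true S = refl

  compress-weight : ∀ (w : Subset n → ℕ) S →
    cofactorSum x y (λ S → bit (compress x y F S) * w S) S ≡
    (bit (F (cof x y true true S)) * w (cof x y true true S) +
     bit (F (cof x y false true S) ∧ F (cof x y true false S)) * w (cof x y false true S)) +
    (bit (F (cof x y true false S) ∨ F (cof x y false true S)) * w (cof x y true false S) +
     bit (F (cof x y false false S)) * w (cof x y false false S))
  compress-weight w S rewrite compress-11 S | compress-01 S | compress-10 S | compress-00 S = refl

  count-compress : count (compress x y F) ≡ count F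
  count-compress = *-cancelˡ-≡ _ _ 4 (trans (total-cofactors x y (bit ∘ compress x y F))
    (trans (total-cong pointwise) (sym (total-cofactors x y (bit ∘ F)))))
    where
    swap : ∀ p q r s → (bit p + bit (q ∧ r)) + (bit (r ∨ q) + bit s) ≡ (bit p + bit q) + (bit r + bit s)
    swap true true true s = refl
    swap true true false s = refl
    swap true false true s = refl
    swap true false false s = refl
    swap false true true s = refl
    swap false true false s = refl
    swap false false true s = refl
    swap false false false s = refl
    pointwise : ∀ S → cofactorSum x y (bit ∘ compress x y F) S ≡ cofactorSum x y (bit ∘ F) S
    pointwise S rewrite compress-11 S | compress-01 S | compress-10 S | compress-00 S =
      swap (F (cof x y true true S)) (F (cof x y false true S)) (F (cof x y true false S))
        (F (cof x y false false S))

  compress-restrict : ∀ {z} → z ≢ x → z ≢ y → ∀ b →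
    restrict (compress x y F) z b ≗ compress x y (restrict F z b)
  compress-restrict {z} z≢x z≢y true S
    rewrite cof-lookup z≢x z≢y false true S | cof-lookup z≢x z≢y true false S =
    compressAt-∧ (lookup S x) (lookup S y) (F S) _ _ (lookup S z)
  compress-restrict {z} z≢x z≢y false S
    rewrite cof-lookup z≢x z≢y false true S | cof-lookup z≢x z≢y true false S =
    compressAt-∧ (lookup S x) (lookup S y) (F S) _ _ (not (lookup S z))

count-compress-restrict : ∀ {n} {x y z : Fin n} → x ≢ y → z ≢ x → z ≢ y → ∀ (F : Fam n) b →
  count (restrict (compress x y F) z b) ≡ count (restrict F z b)
count-compress-restrict x≢y z≢x z≢y F b =
  trans (count-cong (compress-restrict x≢y F z≢x z≢y b)) (count-compress x≢y (restrict F _ b))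

-- The condition in `stays` records why a member that contains `y` but not `x` was left alone: its
-- image was in the family already.
data Origin {n} (x y : Fin n) (F : Fam n) (S : Subset n) : Set where
  stays : F S ≡ true → (lookup S x ≡ false → lookup S y ≡ true → F (cof x y true false S) ≡ true) →
    Origin x y F S
  moved : lookup S x ≡ true → lookup S y ≡ false → F (cof x y false true S) ≡ true → Origin x y F S

origin : ∀ {n} x y (F : Fam n) S → compress x y F S ≡ true → Origin x y F S
origin x y F S e with lookup S x in ex | lookup S y in ey
... | true | true = stays e λ x≡f → contradiction (trans (sym ex) x≡f) λ ()
... | false | false = stays e λ _ y≡t → contradiction (trans (sym ey) y≡t) λ ()
... | false | true = stays (proj₁ (∧-true {F S} e)) λ _ _ → proj₂ (∧-true {F S} e)
... | true | false with F S in eF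
...   | true = stays eF λ x≡f → contradiction (trans (sym ex) x≡f) λ ()
...   | false = moved ex ey e

-- Only sets that contain `y` are ever replaced.
compress-keeps : ∀ {n} x y (F : Fam n) {S} → F S ≡ true → lookup S y ≡ false → compress x y F S ≡ true
compress-keeps x y F {S} e ey rewrite ey | e with lookup S x
... | true = refl
... | false = refl

count-compress-⁻ : ∀ {n} (x y : Fin n) (F : Fam n) → count (F ⁻ y) ≤ count (compress x y F ⁻ y)
count-compress-⁻ x y F = count-mono (F ⁻ y) (compress x y F ⁻ y) λ S e →
  let (p , q) = restrict⁻ F y false S e in
  restrict⁺ (compress x y F) y false S (compress-keeps x y F {S} p q) q

count-compress-⁺ : ∀ {n} {x y : Fin n} → x ≢ y → (F : Fam n) → count (compress x y F ⁺ y) ≤ count (F ⁺ y)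
count-compress-⁺ {x = x} {y} x≢y F = +-cancelʳ-≤ (count (F ⁻ y)) _ _ (begin
  count (compress x y F ⁺ y) + count (F ⁻ y) ≤⟨ +-monoʳ-≤ _ (count-compress-⁻ x y F) ⟩
  count (compress x y F ⁺ y) + count (compress x y F ⁻ y) ≡⟨ count-split (compress x y F) y ⟨
  count (compress x y F) ≡⟨ count-compress x≢y F ⟩
  count F ≡⟨ count-split F y ⟩
  count (F ⁺ y) + count (F ⁻ y) ∎)
  where open ≤-Reasoning

size-update : ∀ {n} (S : Subset n) x → size (S [ x ]≔ true) ≡ suc (size (S [ x ]≔ false))
size-update (b ∷ S) zero = refl
size-update (true ∷ S) (suc x) = cong suc (size-update S x)
size-update (false ∷ S) (suc x) = size-update S x

size-cof : ∀ {n} {x y : Fin n} → x ≢ y → ∀ S → size (cof x y true false S) ≡ size (cof x y false true S)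
size-cof {x = x} {y} x≢y S = begin
  size ((S [ x ]≔ true) [ y ]≔ false) ≡⟨ cong size ([]≔-commutes S x y x≢y) ⟩
  size ((S [ y ]≔ false) [ x ]≔ true) ≡⟨ size-update (S [ y ]≔ false) x ⟩
  suc (size ((S [ y ]≔ false) [ x ]≔ false)) ≡⟨ cong (suc ∘ size) ([]≔-commutes S x y x≢y) ⟨
  suc (size ((S [ x ]≔ false) [ y ]≔ false)) ≡⟨ size-update (S [ x ]≔ false) y ⟨
  size ((S [ x ]≔ false) [ y ]≔ true) ∎
  where open ≡-Reasoning

-- The potential of a family

weight : ∀ {n} → ℕ → Subset n → ℕ
weight p [] = 0
weight p (b ∷ S) = bit b * p + weight (suc p) S

weight-update : ∀ {n} p (S : Subset n) x → weight p (S [ x ]≔ true) ≡ (p + toℕ x) + weight p (S [ x ]≔ false)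
weight-update p (b ∷ S) zero = cong (_+ weight (suc p) S) (trans (+-identityʳ p) (sym (+-identityʳ p)))
weight-update p (b ∷ S) (suc x) rewrite weight-update (suc p) S x =
  rearrange (bit b * p) p (toℕ x) (weight (suc p) (S [ x ]≔ false))
  where
  rearrange : ∀ a p t w → a + (suc p + t + w) ≡ p + suc t + (a + w)
  rearrange = solve-∀

<⇒≢ᶠ : ∀ {n} {x y : Fin n} → toℕ x < toℕ y → x ≢ y
<⇒≢ᶠ lt refl = <-irrefl refl lt

weight-cof : ∀ {n} {x y : Fin n} → toℕ x < toℕ y → ∀ S →
  weight 0 (cof x y true false S) < weight 0 (cof x y false true S)
weight-cof {x = x} {y} x<y S = subst₂ _<_ (sym eq₁) (sym eq₂) (+-monoˡ-< _ x<y)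
  where
  eq₁ : weight 0 (cof x y true false S) ≡ toℕ x + weight 0 (cof x y false false S)
  eq₁ = trans (cong (weight 0) ([]≔-commutes S x y (<⇒≢ᶠ x<y))) (trans (weight-update 0 (S [ y ]≔ false) x)
    (cong (λ T → toℕ x + weight 0 T) (sym ([]≔-commutes S x y (<⇒≢ᶠ x<y)))))
  eq₂ : weight 0 (cof x y false true S) ≡ toℕ y + weight 0 (cof x y false false S)
  eq₂ = weight-update 0 (S [ x ]≔ false) y

-- Moving an element from `y` to a smaller `x` lowers the weight of a member. This is the
-- termination measure of both compression processes, that of a cross-intersecting pair and that of
-- an ample family.
potential : ∀ {n} → Fam n → ℕ
potential F = total λ S → bit (F S) * weight 0 S

StablePair : ∀ {n} → Fam n → Fin n → Fin n → Set
StablePair F x y = ∀ S → F S ≡ true → lookup S x ≡ false → lookup S y ≡ true → F (cof x y true false S) ≡ true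

module _ {n} {x y : Fin n} (x<y : toℕ x < toℕ y) (F : Fam n) where
  private
    w : Subset n → ℕ
    w = weight 0

    step : ∀ p q r s {a b c d} → c ≤ b →
      (bit p * a + bit (q ∧ r) * b) + (bit (r ∨ q) * c + bit s * d) ≤ (bit p * a + bit q * b) +
        (bit r * c + bit s * d)
    step p true true s le = ≤-refl
    step p false true s le = ≤-refl
    step p false false s le = ≤-refl
    step p true false s {a} {b} {c} {d} le = subst₂ _≤_ (left (bit p * a) c (bit s * d))
      (right (bit p * a) b (bit s * d))
      (+-monoˡ-≤ (bit p * a + bit s * d) le)
      where
      left : ∀ a c d → c + (a + d) ≡ a + 0 + (c + 0 + d)
      left = solve-∀
      right : ∀ a b d → b + (a + d) ≡ a + (b + 0) + (0 + d)
      right = solve-∀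

    step-< : ∀ p q r s {a b c d} → q ≡ true → r ≡ false → c < b →
      (bit p * a + bit (q ∧ r) * b) + (bit (r ∨ q) * c + bit s * d) < (bit p * a + bit q * b) +
        (bit r * c + bit s * d)
    step-< p true false s {a} {b} {c} {d} refl refl lt =
      subst₂ _<_ (left (bit p * a) c (bit s * d)) (right (bit p * a) b (bit s * d))
      (+-monoˡ-< (bit p * a + bit s * d) lt)
      where
      left : ∀ a c d → c + (a + d) ≡ a + 0 + (c + 0 + d)
      left = solve-∀
      right : ∀ a b d → b + (a + d) ≡ a + (b + 0) + (0 + d)
      right = solve-∀

    pointwise : ∀ S → cofactorSum x y (λ S → bit (compress x y F S) * w S) S ≤ cofactorSum x y (λ S →
      bit (F S) * w S) S
    pointwise S = subst (_≤ cofactorSum x y (λ S → bit (F S) * w S) S) (sym (compress-weight (<⇒≢ᶠ x<y) F w S))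
      (step (F (cof x y true true S)) (F (cof x y false true S)) (F (cof x y true false S))
        (F (cof x y false false S))
        (<⇒≤ (weight-cof x<y S)))

  potential-compress-< : ∀ S → F S ≡ true → lookup S x ≡ false → lookup S y ≡ true →
    F (cof x y true false S) ≡ false →
    potential (compress x y F) < potential F
  potential-compress-< S eS ex ey e = total-exchange-< x y pointwise S
    (subst (_< cofactorSum x y (λ S → bit (F S) * w S) S) (sym (compress-weight (<⇒≢ᶠ x<y) F w S))
      (step-< (F (cof x y true true S)) (F (cof x y false true S)) (F (cof x y true false S))
        (F (cof x y false false S))
        (trans (cong F (cof-self S ex ey)) eS) e (weight-cof x<y S)))

  potential-stable : ¬ (potential (compress x y F) < potential F) → StablePair F x y
  potential-stable ≮ S eS ex ey with F (cof x y true false S) in e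
  ... | true = refl
  ... | false = contradiction (potential-compress-< S eS ex ey e) ≮

-- Replacing `y` by `x` is an injection of the left family into the right one.
stable-count : ∀ {n} {x y : Fin n} → x ≢ y → (F : Fam n) → StablePair F x y →
  count (F ⁻ x ⁺ y) ≤ count (F ⁺ x ⁻ y)
stable-count {n} {x} {y} x≢y F st = total-exchange x y λ S → pointwise S
  where
  F⁻⁺ F⁺⁻ : Fam n
  F⁻⁺ = F ⁻ x ⁺ y
  F⁺⁻ = F ⁺ x ⁻ y
  pointwise : ∀ S → cofactorSum x y (bit ∘ F⁻⁺) S ≤ cofactorSum x y (bit ∘ F⁺⁻) S
  pointwise S
    rewrite cof-lookupˣ x≢y true true S | cof-lookupʸ x y true true S
          | cof-lookupˣ x≢y true false S | cof-lookupʸ x y true false S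
          | cof-lookupˣ x≢y false true S | cof-lookupʸ x y false true S
          | cof-lookupˣ x≢y false false S | cof-lookupʸ x y false false S
    with F (cof x y true true S) | F (cof x y false false S)
       | F (cof x y false true S) in e | F (cof x y true false S) in e′
  -- This is the only quadruple that could violate the inequality, and it is the one that stability
  -- forbids.
  ... | _ | _ | true | false = contradiction (trans (sym e′)
        (trans (cong F (sym (cof-cof x≢y true false false true S)))
          (st _ e (cof-lookupˣ x≢y false true S) (cof-lookupʸ x y false true S)))) λ ()
  ... | false | false | true | true = ≤-refl
  ... | false | true | true | true = ≤-refl
  ... | true | false | true | true = ≤-refl
  ... | true | true | true | true = ≤-refl
  ... | false | false | false | true = z≤n
  ... | false | true | false | true = z≤n
  ... | true | false | false | true = z≤n
  ... | true | true | false | true = z≤n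
  ... | false | false | false | false = z≤n
  ... | false | true | false | false = z≤n
  ... | true | false | false | false = z≤n
  ... | true | true | false | false = z≤n

-- Walks along the free coordinates

-- A set S is read as the walk making, at each position of the mask M, a step +1 if the
-- position lies in S and -1 otherwise; hit M l S says that the walk reaches height l.
hit : ∀ {n} → Subset n → ℕ → Subset n → Bool
hit _ zero _ = true
hit [] (suc l) [] = false
hit (false ∷ M) (suc l) (_ ∷ S) = hit M (suc l) S
hit (true ∷ M) (suc l) (true ∷ S) = hit M l S
hit (true ∷ M) (suc l) (false ∷ S) = hit M (suc (suc l)) S

-- S contains one of the first t free positions, or its walk rises by 2 after them.
late : ∀ {n} → Subset n → ℕ → Subset n → Bool
late M zero S = hit M 2 S
late [] (suc t) [] = false
late (false ∷ M) (suc t) (_ ∷ S) = late M (suc t) S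
late (true ∷ M) (suc t) (true ∷ S) = true
late (true ∷ M) (suc t) (false ∷ S) = late M t S

off : ∀ {n} → Subset n → Subset n → ℕ
off [] [] = 0
off (true ∷ M) (_ ∷ R) = off M R
off (false ∷ M) (b ∷ R) = bit b + off M R

AgreeOff : ∀ {n} → Subset n → Subset n → Subset n → Set
AgreeOff M R S = ∀ i → lookup M i ≡ false → lookup S i ≡ lookup R i

-- This describes one trace of a uniform family: the positions outside `M` are frozen to their
-- values in a reference set `R`. An induction along the vector can then proceed without a list of
-- the fixed positions.
Layer : ∀ {n} → Subset n → ℕ → Subset n → Fam n → Set
Layer M k R F = ∀ S → F S ≡ true → (size S) ≡ k × AgreeOff M R S

-- When a leading element is split off, `k` drops by one, and `suc j` compensates for this, so both
-- branches of an induction are stated with the same `k`. For `k` zero the branch is empty.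
count-in : ∀ {n} {G : Fam n} {k c j} → (∀ S → G S ≡ true → suc (size S) ≡ k) →
  (∀ k′ → (∀ S → G S ≡ true → (size S) ≡ k′) → count G ≤ bin c k′ j) → count G ≤ bin c k (suc j)
count-in {k = zero} size h = ≤-reflexive (count-empty λ S e → contradiction (size S e) λ ())
count-in {k = suc k} size h = h k λ S e → suc-injective (size S e)

module _ {n} {m : Bool} {M : Subset n} {k : ℕ} {r : Bool} {R : Subset n} {F : Fam (suc n)}
         (layer : Layer (m ∷ M) k (r ∷ R) F) where

  layer-tail : ∀ b k′ → (∀ S → F (b ∷ S) ≡ true → (size S) ≡ k′) → Layer M k′ R (F ∘ (b ∷_))
  layer-tail b k′ size S e = size S e , λ i → proj₂ (layer (b ∷ S) e) (suc i)

  layer-out : Layer M k R (F ∘ (false ∷_))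
  layer-out = layer-tail false k λ S e → proj₁ (layer (false ∷ S) e)

  layer-fixed : m ≡ false → ∀ S b → r ≢ b → F (b ∷ S) ≡ true → ⊥
  layer-fixed m≡f S b r≢b e = r≢b (sym (proj₂ (layer (b ∷ S) e) zero m≡f))

-- The reflection principle, by induction instead of by reflecting: a step up lowers the height
-- still to be reached and the set size by one, a step down raises that height by one, and the two
-- bounds are the two terms of Pascal's rule.
count-hit : ∀ {n} (M : Subset n) k R {F : Fam n} l → Layer M k R F → (∀ S → F S ≡ true → hit M l S ≡ true) →
  count F ≤ bin (size M) k (off M R + l)
count-hit [] k [] {F} zero layer h with F [] in eq
... | false = z≤n
... | true rewrite sym (proj₁ (layer [] eq)) = ≤-refl
count-hit [] k [] {F} (suc l) layer h = ≤-trans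
  (≤-reflexive (count-empty {F = F} λ { [] e → contradiction (h [] e) λ () })) z≤n
count-hit (false ∷ M) k (true ∷ R) {F} l layer h
  rewrite count-empty {F = F ∘ (false ∷_)} (λ S → layer-fixed {F = F} layer refl S false λ ())
        | +-identityʳ (count (F ∘ (true ∷_))) =
  count-in (λ S e → proj₁ (layer (true ∷ S) e)) λ k′ sz →
    count-hit M k′ R l (layer-tail {F = F} layer true k′ sz) λ S e → hit-fixed l (h (true ∷ S) e)
  where
  hit-fixed : ∀ l {S} → hit (false ∷ M) l (true ∷ S) ≡ true → hit M l S ≡ true
  hit-fixed zero _ = refl
  hit-fixed (suc l) e = e
count-hit (false ∷ M) k (false ∷ R) {F} l layer h
  rewrite count-empty {F = F ∘ (true ∷_)} (λ S → layer-fixed {F = F} layer refl S true λ ()) =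
  count-hit M k R l (layer-out {F = F} layer) λ S e → hit-fixed l (h (false ∷ S) e)
  where
  hit-fixed : ∀ l {S} → hit (false ∷ M) l (false ∷ S) ≡ true → hit M l S ≡ true
  hit-fixed zero _ = refl
  hit-fixed (suc l) e = e
count-hit (true ∷ M) k (r ∷ R) {F} zero layer h = begin
  count (F ∘ (true ∷_)) + count (F ∘ (false ∷_)) ≤⟨ +-mono-≤
    (count-in (λ S e → proj₁ (layer (true ∷ S) e)) λ k′ sz →
      count-hit M k′ R 0 (layer-tail {F = F} layer true k′ sz) λ S e → refl)
    (count-hit M k R 0 (layer-out {F = F} layer) λ S e → refl) ⟩
  bin (size M) k (suc (off M R + 0)) + bin (size M) k (off M R + 0) ≡⟨
    +-comm (bin (size M) k (suc (off M R + 0))) _ ⟩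
  bin (size M) k (off M R + 0) + bin (size M) k (suc (off M R + 0)) ≡⟨ bin-pascal (size M) k (off M R + 0) ⟨
  bin (suc (size M)) k (off M R + 0) ∎
  where open ≤-Reasoning
count-hit (true ∷ M) k (r ∷ R) {F} (suc l) layer h = begin
  count (F ∘ (true ∷_)) + count (F ∘ (false ∷_)) ≤⟨ +-mono-≤
    (count-in (λ S e → proj₁ (layer (true ∷ S) e)) λ k′ sz →
      count-hit M k′ R l (layer-tail {F = F} layer true k′ sz) λ S e → h (true ∷ S) e)
    (count-hit M k R (suc (suc l)) (layer-out {F = F} layer) λ S e → h (false ∷ S) e) ⟩
  bin (size M) k (suc (off M R + l)) + bin (size M) k (off M R + suc (suc l)) ≡⟨
    cong₂ (λ p q → bin (size M) k p + bin (size M) k q) (sym (+-suc (off M R) l)) (+-suc (off M R) (suc l)) ⟩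
  bin (size M) k (off M R + suc l) + bin (size M) k (suc (off M R + suc l)) ≡⟨
    bin-pascal (size M) k (off M R + suc l) ⟨
  bin (suc (size M)) k (off M R + suc l) ∎
  where open ≤-Reasoning

count-layer : ∀ {n} (M : Subset n) k R {F : Fam n} → Layer M k R F → count F ≤ bin (size M) k (off M R)
count-layer M k R {F} layer = subst (λ i → count F ≤ bin (size M) k i) (+-identityʳ (off M R))
  (count-hit M k R 0 layer λ _ _ → refl)

-- Without subtraction this says c ≤ C(m, k-i) - C(m-t, k-i) + C(m-t, k-i-2): all sets, minus those
-- that avoid the first t free positions, plus those among the latter whose walk still rises by 2.
-- Here i is the number of fixed elements.
LateBound : ℕ → ℕ → ℕ → ℕ → ℕ → Set
LateBound c m k i t = c + bin (m ∸ t) k i ≤ bin m k i + bin (m ∸ t) k (i + 2)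

count-late : ∀ {n} (M : Subset n) k R {F : Fam n} t → Layer M k R F → (∀ S → F S ≡ true → late M t S ≡ true) →
  LateBound (count F) (size M) k (off M R) t
count-late M k R {F} zero layer h = ≤-trans (+-monoˡ-≤ _ (count-hit M k R 2 layer h))
  (≤-reflexive (+-comm (bin (size M) k (off M R + 2)) _))
count-late [] k [] {F} (suc t) layer h
  rewrite count-empty {F = F} (λ { [] e → contradiction (h [] e) λ () }) = m≤m+n _ _
count-late (false ∷ M) zero (true ∷ R) {F} (suc t) layer h
  rewrite count-empty {F = F ∘ (false ∷_)} (λ S → layer-fixed {F = F} layer refl S false λ ())
        | count-empty {F = F ∘ (true ∷_)} (λ S e → contradiction (proj₁ (layer (true ∷ S) e)) λ ()) = z≤n
count-late (false ∷ M) (suc k) (true ∷ R) {F} (suc t) layer h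
  rewrite count-empty {F = F ∘ (false ∷_)} (λ S → layer-fixed {F = F} layer refl S false λ ())
        | +-identityʳ (count (F ∘ (true ∷_))) =
  count-late M k R (suc t) (layer-tail {F = F} layer true k λ S e → suc-injective (proj₁ (layer (true ∷ S) e)))
    λ S e → h (true ∷ S) e
count-late (false ∷ M) k (false ∷ R) {F} (suc t) layer h
  rewrite count-empty {F = F ∘ (true ∷_)} (λ S → layer-fixed {F = F} layer refl S true λ ()) =
  count-late M k R (suc t) (layer-out {F = F} layer) λ S e → h (false ∷ S) e
count-late (true ∷ M) k (r ∷ R) {F} (suc t) layer h = begin
  count (F ∘ (true ∷_)) + count (F ∘ (false ∷_)) + bin (size M ∸ t) k i ≡⟨ +-assoc (count (F ∘ (true ∷_))) _ _ ⟩
  count (F ∘ (true ∷_)) + (count (F ∘ (false ∷_)) + bin (size M ∸ t) k i) ≤⟨ +-mono-≤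
    (count-in (λ S e → proj₁ (layer (true ∷ S) e)) λ k′ sz →
      count-layer M k′ R (layer-tail {F = F} layer true k′ sz))
    (count-late M k R t (layer-out {F = F} layer) λ S e → h (false ∷ S) e) ⟩
  bin (size M) k (suc i) + (bin (size M) k i + bin (size M ∸ t) k (i + 2)) ≡⟨
    rearrange (bin (size M) k (suc i)) (bin (size M) k i) _ ⟩
  (bin (size M) k i + bin (size M) k (suc i)) + bin (size M ∸ t) k (i + 2) ≡⟨
    cong (_+ bin (size M ∸ t) k (i + 2)) (bin-pascal (size M) k i) ⟨
  bin (suc (size M)) k i + bin (size M ∸ t) k (i + 2) ∎
  where
  open ≤-Reasoning
  i : ℕ
  i = off M R
  rearrange : ∀ a b c → a + (b + c) ≡ b + a + c
  rearrange = solve-∀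

-- Stable cross-intersecting families

-- Reading from the left, every common free element of S and T can be moved in S to an earlier free
-- position outside S and T; f counts such positions to the left that are not used up yet.
data Good : ∀ {n} → Subset n → ℕ → Subset n → Subset n → Set where
  [] : ∀ {f} → Good [] f [] []
  both : ∀ {n} {M S T : Subset n} {f} → Good M f S T → Good (true ∷ M) (suc f) (true ∷ S) (true ∷ T)
  neither : ∀ {n} {M S T : Subset n} {f} → Good M (suc f) S T → Good (true ∷ M) f (false ∷ S) (false ∷ T)
  left : ∀ {n} {M S T : Subset n} {f m} → Good M f S T → Good (m ∷ M) f (true ∷ S) (false ∷ T)
  right : ∀ {n} {M S T : Subset n} {f m} → Good M f S T → Good (m ∷ M) f (false ∷ S) (true ∷ T)
  fixed : ∀ {n} {M S T : Subset n} {f} → Good M f S T → Good (false ∷ M) f (false ∷ S) (false ∷ T)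

DisjointOff : ∀ {n} → Subset n → Subset n → Subset n → Set
DisjointOff M S T = ∀ i → lookup M i ≡ false → lookup S i ≡ true → lookup T i ≡ true → ⊥

-- The bound is an invariant of the two walks. A free position in both sets lowers `l + l′` by 2 and
-- uses up a spare position, one in neither set raises the sum by 2 and adds a spare position, and
-- one in exactly one set leaves both unchanged.
hit-good : ∀ {n} (M : Subset n) S T f l l′ → DisjointOff M S T → l + l′ ≤ 3 + 2 * f →
  hit M l S ≡ false → hit M l′ T ≡ false → Good M f S T
hit-good [] [] [] f l l′ d le p q = []
hit-good (m ∷ M) (s ∷ S) (t ∷ T) f (suc l) (suc l′) d le p q with m | s | t
... | false | true | true = ⊥-elim (d zero refl refl refl)
... | false | true | false = left (hit-good M S T f (suc l) (suc l′) (d ∘ suc) le p q)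
... | false | false | true = right (hit-good M S T f (suc l) (suc l′) (d ∘ suc) le p q)
... | false | false | false = fixed (hit-good M S T f (suc l) (suc l′) (d ∘ suc) le p q)
... | true | true | false = left (hit-good M S T f l (suc (suc l′)) (d ∘ suc)
      (subst (_≤ 3 + 2 * f) (sym (+-suc l (suc l′))) le) p q)
... | true | false | true = right (hit-good M S T f (suc (suc l)) l′ (d ∘ suc)
      (subst (_≤ 3 + 2 * f) (cong suc (+-suc l l′)) le) p q)
... | true | false | false = neither (hit-good M S T (suc f) (suc (suc l)) (suc (suc l′)) (d ∘ suc)
        (entail (l ∷ l′ ∷ f ∷ []) 1 (sucᴱ (sucᴱ (# 0)) ⊕ sucᴱ (sucᴱ (# 1))) (lit 3 ⊕ 2 ⊗ sucᴱ (# 2))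
          ((1 ∙ sucᴱ (# 0) ⊕ sucᴱ (# 1) ≼ lit 3 ⊕ 2 ⊗ # 2 by le) ∷ []) refl) p q)
hit-good (m ∷ M) (s ∷ S) (t ∷ T) (suc f) (suc l) (suc l′) d le p q | true | true | true =
  both (hit-good M S T f l l′ (d ∘ suc)
    (entail (l ∷ l′ ∷ f ∷ []) 1 (# 0 ⊕ # 1) (lit 3 ⊕ 2 ⊗ # 2)
      ((1 ∙ sucᴱ (# 0) ⊕ sucᴱ (# 1) ≼ lit 3 ⊕ 2 ⊗ sucᴱ (# 2) by le) ∷ []) refl) p q)
-- Without a spare position, both walks can step up and stay below their bounds only if each bound
-- is at least 2; but 2 + 2 exceeds 3.
hit-good (m ∷ M) (s ∷ S) (t ∷ T) zero (suc (suc l)) (suc (suc l′)) d le p q | true | true | true =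
  ⊥-elim (refute (l ∷ l′ ∷ []) ((1 ∙ sucᴱ (sucᴱ (# 0)) ⊕ sucᴱ (sucᴱ (# 1)) ≼ lit 3 by le) ∷ []) refl)

-- `S` contains none of the first `t` free positions, so each of these either brings `T` closer to
-- its bound or becomes a spare position. Afterwards `hit-good` takes over with height 2 for `S`,
-- since 2 + l ≤ 3 + 2 f.
late-good : ∀ {n} (M : Subset n) S T f l t → DisjointOff M S T → l ≤ suc t + 2 * f →
  late M t S ≡ false → hit M l T ≡ false → Good M f S T
late-good M S T f l zero d le p q = hit-good M S T f 2 l d (s≤s (s≤s le)) p q
late-good [] [] [] f l (suc t) d le p q = []
late-good (m ∷ M) (s ∷ S) (r ∷ T) f (suc l) (suc t) d le p q with m | s | r
... | false | true | true = ⊥-elim (d zero refl refl refl)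
... | false | true | false = left (late-good M S T f (suc l) (suc t) (d ∘ suc) le p q)
... | false | false | true = right (late-good M S T f (suc l) (suc t) (d ∘ suc) le p q)
... | false | false | false = fixed (late-good M S T f (suc l) (suc t) (d ∘ suc) le p q)
... | true | false | true = right (late-good M S T f l t (d ∘ suc) (s≤s⁻¹ le) p q)
... | true | false | false = neither (late-good M S T (suc f) (suc (suc l)) t (d ∘ suc)
        (entail (l ∷ t ∷ f ∷ []) 1 (sucᴱ (sucᴱ (# 0))) (sucᴱ (# 1) ⊕ 2 ⊗ sucᴱ (# 2))
          ((1 ∙ sucᴱ (# 0) ≼ sucᴱ (sucᴱ (# 1)) ⊕ 2 ⊗ # 2 by le) ∷ []) refl) p q)

data Meet {n} (S T : Subset n) : Set where
  at : ∀ i → lookup S i ≡ true → lookup T i ≡ true → Meet S T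

meet-tailʳ : ∀ {n s} {S T : Subset n} → Meet (s ∷ S) (false ∷ T) → Meet S T
meet-tailʳ (at (suc i) p q) = at i p q

meet-tailˡ : ∀ {n t} {S T : Subset n} → Meet (false ∷ S) (t ∷ T) → Meet S T
meet-tailˡ (at (suc i) p q) = at i p q

Cross : ∀ {n} → Fam n → Fam n → Set
Cross A B = ∀ S T → A S ≡ true → B T ≡ true → Meet S T

StableOn : ∀ {n} → Subset n → Fam n → Set
StableOn M F = ∀ {x y} → toℕ x < toℕ y → lookup M x ≡ true → lookup M y ≡ true → StablePair F x y

-- D d consists of the sets that lead to members of the stable family once d earlier positions
-- are given back; giving one back costs one element of the set.
good-contra : ∀ {n} (M : Subset n) (D : ℕ → Subset n → Set) (B : Subset n → Set) →
  (∀ d {x y} → toℕ x < toℕ y → lookup M x ≡ true → lookup M y ≡ true →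
     ∀ S → D d S → lookup S x ≡ false → lookup S y ≡ true → D d (cof x y true false S)) →
  (∀ d z → lookup M z ≡ true → ∀ S → D (suc d) S → lookup S z ≡ true → D d (S [ z ]≔ false)) →
  (∀ d S T → D d S → B T → Meet S T) →
  ∀ {f S T} → Good M f S T → D f S → B T → ⊥
good-contra [] D B st cl cr [] p q with cr _ [] [] p q
... | at () _ _
good-contra (true ∷ M) D B st cl cr (both {S = S} {T} {f} g) p q =
  good-contra M (λ d → D d ∘ (false ∷_)) (B ∘ (true ∷_))
    (λ d x<y mx my S → st d (s≤s x<y) mx my (false ∷ S))
    (λ d z mz S → cl d (suc z) mz (false ∷ S))
    (λ d S T p q → meet-tailˡ (cr d (false ∷ S) (true ∷ T) p q))
    g (cl f zero refl (true ∷ S) p refl) q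
good-contra {suc n} (true ∷ M) D B st cl cr (neither g) p q =
  good-contra M D′ (B ∘ (false ∷_)) st′ cl′ cr′ g p q
  where
  -- The current position is free and belongs to neither set. It is filled at level zero and empty
  -- at all higher levels; going from level one to level zero fills it by a move that stability
  -- allows.
  D′ : ℕ → Subset n → Set
  D′ zero = D zero ∘ (true ∷_)
  D′ (suc d) = D d ∘ (false ∷_)
  st′ : ∀ d {x y} → toℕ x < toℕ y → lookup M x ≡ true → lookup M y ≡ true →
     ∀ S → D′ d S → lookup S x ≡ false → lookup S y ≡ true → D′ d (cof x y true false S)
  st′ zero x<y mx my S = st zero (s≤s x<y) mx my (true ∷ S)
  st′ (suc d) x<y mx my S = st d (s≤s x<y) mx my (false ∷ S)
  cl′ : ∀ d z → lookup M z ≡ true → ∀ S → D′ (suc d) S → lookup S z ≡ true → D′ d (S [ z ]≔ false)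
  cl′ zero z mz S p sz = st zero z<s refl mz (false ∷ S) p refl sz
  cl′ (suc d) z mz S = cl d (suc z) mz (false ∷ S)
  cr′ : ∀ d S T → D′ d S → B (false ∷ T) → Meet S T
  cr′ zero S T p q = meet-tailʳ (cr zero (true ∷ S) (false ∷ T) p q)
  cr′ (suc d) S T p q = meet-tailʳ (cr d (false ∷ S) (false ∷ T) p q)
good-contra (m ∷ M) D B st cl cr (left g) p q =
  good-contra M (λ d → D d ∘ (true ∷_)) (B ∘ (false ∷_))
    (λ d x<y mx my S → st d (s≤s x<y) mx my (true ∷ S))
    (λ d z mz S → cl d (suc z) mz (true ∷ S))
    (λ d S T p q → meet-tailʳ (cr d (true ∷ S) (false ∷ T) p q)) g p q
good-contra (m ∷ M) D B st cl cr (right g) p q =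
  good-contra M (λ d → D d ∘ (false ∷_)) (B ∘ (true ∷_))
    (λ d x<y mx my S → st d (s≤s x<y) mx my (false ∷ S))
    (λ d z mz S → cl d (suc z) mz (false ∷ S))
    (λ d S T p q → meet-tailˡ (cr d (false ∷ S) (true ∷ T) p q)) g p q
good-contra (false ∷ M) D B st cl cr (fixed g) p q =
  good-contra M (λ d → D d ∘ (false ∷_)) (B ∘ (false ∷_))
    (λ d x<y mx my S → st d (s≤s x<y) mx my (false ∷ S))
    (λ d z mz S → cl d (suc z) mz (false ∷ S))
    (λ d S T p q → meet-tailʳ (cr d (false ∷ S) (false ∷ T) p q)) g p q

-- All moves take place in the member of `A`, so stability is asked of `A` alone. No position
-- precedes the start, hence the levels above zero are empty.
stable-contra : ∀ {n} (M : Subset n) (A B : Fam n) → StableOn M A → Cross A B →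
  ∀ {S T} → Good M 0 S T → A S ≡ true → B T ≡ true → ⊥
stable-contra {n} M A B st cr = good-contra M D (λ T → B T ≡ true) st′ (λ _ _ _ _ ()) cr′
  where
  D : ℕ → Subset n → Set
  D zero S = A S ≡ true
  D (suc d) S = ⊥
  st′ : ∀ d {x y} → toℕ x < toℕ y → lookup M x ≡ true → lookup M y ≡ true →
     ∀ S → D d S → lookup S x ≡ false → lookup S y ≡ true → D d (cof x y true false S)
  st′ zero = st
  st′ (suc d) _ _ _ _ ()
  cr′ : ∀ d S T → D d S → B T ≡ true → Meet S T
  cr′ zero = cr

¬false⇒true : ∀ {p} → (p ≡ false → ⊥) → p ≡ true
¬false⇒true {true} _ = refl
¬false⇒true {false} h = ⊥-elim (h refl)

dichotomy : ∀ {n} (A : Fam n) (p : Subset n → Bool) →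
  (∃[ S ] A S ≡ true × p S ≡ false) ⊎ (∀ S → A S ≡ true → p S ≡ true)
dichotomy A p with find (λ S → A S ∧ not (p S))
... | inj₁ (S , e) with A S in eA | p S in ep
...   | true | false = inj₁ (S , eA , ep)
dichotomy A p | inj₂ h = inj₂ λ S e → ¬false⇒true λ eq → h S (cong₂ _∧_ e (cong not eq))

-- Compression of a cross-intersecting pair

Meet-sym : ∀ {n} {S T : Subset n} → Meet S T → Meet T S
Meet-sym (at i p q) = at i q p

true≢false : ∀ {ℓ} {A : Set ℓ} {p : Bool} → p ≡ true → p ≡ false → A
true≢false {p = true} _ ()

-- If `T` contains `x`, the sets meet there. Otherwise the preimage of `S` meets `T`, or the image
-- of `T` if `T` contains `y`, and it does so in a point other than `x` and `y`, where nothing was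
-- changed.
meet-moved : ∀ {n} {x y : Fin n} → x ≢ y → {A B : Fam n} → Cross A B → ∀ S T →
  lookup S x ≡ true → lookup S y ≡ false → A (cof x y false true S) ≡ true →
  B T ≡ true → (lookup T x ≡ false → lookup T y ≡ true → B (cof x y true false T) ≡ true) → Meet S T
meet-moved {x = x} {y} x≢y {A} {B} cr S T sx sy up eT down with lookup T x in tx | lookup T y in ty
... | true | _ = at x sx tx
... | false | true with cr _ _ up (down refl refl)
...   | at i p q with i ≟ x | i ≟ y
...     | yes refl | _ = true≢false p (cof-lookupˣ x≢y false true S)
...     | no _ | yes refl = true≢false q (cof-lookupʸ x y true false T)
...     | no i≢x | no i≢y = at i (trans (sym (cof-lookup i≢x i≢y false true S)) p)
      (trans (sym (cof-lookup i≢x i≢y true false T)) q)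
meet-moved {x = x} {y} x≢y {A} {B} cr S T sx sy up eT down | false | false with cr _ _ up eT
... | at i p q with i ≟ x | i ≟ y
...   | yes refl | _ = true≢false p (cof-lookupˣ x≢y false true S)
...   | no _ | yes refl = true≢false q ty
...   | no i≢x | no i≢y = at i (trans (sym (cof-lookup i≢x i≢y false true S)) p) q

compress-cross : ∀ {n} {x y : Fin n} → x ≢ y → {A B : Fam n} → Cross A B →
  Cross (compress x y A) (compress x y B)
compress-cross {x = x} {y} x≢y {A} {B} cr S T eS eT with origin x y A S eS | origin x y B T eT
... | stays p _ | stays q _ = cr S T p q
... | moved sx sy up | stays q down = meet-moved x≢y cr S T sx sy up q down
... | stays p down | moved tx ty up = Meet-sym (meet-moved x≢y (λ S T e e′ → Meet-sym (cr T S e′ e)) T S tx ty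
      up p down)
... | moved sx _ _ | moved tx _ _ = at x sx tx

Uniformᶠ : ∀ {n} → ℕ → Fam n → Set
Uniformᶠ k F = ∀ S → F S ≡ true → (size S) ≡ k

compress-uniform : ∀ {n} {x y : Fin n} → x ≢ y → ∀ {k} {F : Fam n} → Uniformᶠ k F → Uniformᶠ k (compress x y F)
compress-uniform {x = x} {y} x≢y {F = F} u S e with origin x y F S e
... | stays p _ = u S p
... | moved sx sy up = trans (trans (cong size (sym (cof-self S sx sy))) (size-cof x≢y S)) (u _ up)

compress-layer : ∀ {n} {x y : Fin n} {M k R} {F : Fam n} → x ≢ y → lookup M x ≡ true → lookup M y ≡ true →
  Layer M k R F → Layer M k R (compress x y F)
compress-layer {x = x} {y} {M} {k} {R} {F} x≢y mx my layer S e =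
  compress-uniform x≢y {F = F} (λ S e → proj₁ (layer S e)) S e , agree
  where
  agree : AgreeOff M R S
  agree i mi with origin x y F S e
  ... | stays p _ = proj₂ (layer S p) i mi
  ... | moved _ _ up = trans (sym (cof-lookup (λ { refl → true≢false mx mi }) (λ { refl → true≢false my mi })
        false true S))
          (proj₂ (layer _ up) i mi)

module _ {n} (M : Subset n) (k : ℕ) (R R′ : Subset n) (disj : DisjointOff M R R′) (t : ℕ) where

  -- The parameter `t` trades one bound against the other: t = 1 and t = 2 serve the search for a
  -- triangle, the values from 3 on the final estimate.
  Conclusion : Fam n → Fam n → Set
  Conclusion A B = LateBound (count A) (size M) k (off M R) t ⊎ count B ≤ bin (size M) k (off M R′ + suc t)

  disjoint-members : ∀ {S T} → AgreeOff M R S → AgreeOff M R′ T → DisjointOff M S T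
  disjoint-members p q i mi si ti = disj i mi (trans (sym (p i mi)) si) (trans (sym (q i mi)) ti)

  stable-late-or-hit : ∀ {A B} → StableOn M A → Layer M k R A → Layer M k R′ B → Cross A B →
    ∀ {S} → A S ≡ true → late M t S ≡ false → count B ≤ bin (size M) k (off M R′ + suc t)
  stable-late-or-hit {A} {B} st lA lB cr {S} eS lS = count-hit M k R′ (suc t) lB λ T eT → ¬false⇒true λ eq →
    stable-contra M A B st cr
      (late-good M S T 0 (suc t) t (disjoint-members {S} {T} (proj₂ (lA S eS)) (proj₂ (lB T eT)))
        (≤-reflexive (sym (+-identityʳ (suc t)))) lS eq) eS eT

  stable-conclusion : ∀ {A B} → StableOn M A → Layer M k R A → Layer M k R′ B → Cross A B → Conclusion A B
  stable-conclusion {A} {B} st lA lB cr with dichotomy A (late M t)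
  ... | inj₂ h = inj₁ (count-late M k R t lA h)
  ... | inj₁ (S , eS , lS) = inj₂ (stable-late-or-hit st lA lB cr eS lS)

  Improving : Fam n → Fin n → Fin n → Set
  Improving A x y = toℕ x < toℕ y × lookup M x ≡ true × lookup M y ≡ true ×
    potential (compress x y A) < potential A

  improving? : ∀ A → Dec (∃₂ (Improving A))
  improving? A = any? λ x → any? λ y → toℕ x <? toℕ y ×-dec lookup M x ≟ᵇ true ×-dec lookup M y ≟ᵇ true
    ×-dec potential (compress x y A) <? potential A

  -- Both families undergo the same compressions inside the mask. Their sizes, their layers and the
  -- cross-intersection survive, and the process stops as soon as `A` is stable, whatever the state
  -- of `B`.
  cross-conclusion : ∀ A B → Acc _<_ (potential A) → Layer M k R A → Layer M k R′ B → Cross A B → Conclusion A B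
  cross-conclusion A B (acc rec) lA lB cr with improving? A
  ... | no none = stable-conclusion (λ {x} {y} x<y mx my → potential-stable x<y A λ lt →
        none (x , y , x<y , mx , my , lt)) lA lB cr
  ... | yes (x , y , x<y , mx , my , lt) =
    subst₂ (λ a b → LateBound a (size M) k (off M R) t ⊎ b ≤ bin (size M) k (off M R′ + suc t))
      (count-compress (<⇒≢ᶠ x<y) A) (count-compress (<⇒≢ᶠ x<y) B)
      (cross-conclusion (compress x y A) (compress x y B) (rec lt)
        (compress-layer {M = M} {R = R} {F = A} (<⇒≢ᶠ x<y) mx my lA)
          (compress-layer {M = M} {R = R′} {F = B} (<⇒≢ᶠ x<y) mx my lB) (compress-cross (<⇒≢ᶠ x<y) cr))

-- Traces on a few positions

mask : ∀ {n r} → Vec (Fin n) r → Subset n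
mask [] = replicate _ true
mask (x ∷ V) = mask V [ x ]≔ false

infix 4 _♯_

record _♯_ {n r} (x : Fin n) (V : Vec (Fin n) r) : Set where
  constructor fresh
  field free : lookup (mask V) x ≡ true
open _♯_

Distinct : ∀ {n r} → Vec (Fin n) r → Set
Distinct [] = ⊤
Distinct (x ∷ V) = x ♯ V × Distinct V

♯[] : ∀ {n} {x : Fin n} → x ♯ []
♯[] {x = x} = fresh (lookup-replicate x true)

♯∷ : ∀ {n r} {x y : Fin n} {V : Vec (Fin n) r} → x ≢ y → x ♯ V → x ♯ y ∷ V
♯∷ {V = V} x≢y (fresh h) = fresh (trans (lookup∘update′ x≢y (mask V) false) h)

♯-head : ∀ {n r} {x y : Fin n} (V : Vec (Fin n) r) → x ♯ y ∷ V → x ≢ y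
♯-head {x = x} V (fresh h) refl = true≢false h (lookup∘update x (mask V) false)

♯-tail : ∀ {n r} {x y : Fin n} (V : Vec (Fin n) r) → x ♯ y ∷ V → x ♯ V
♯-tail {x = x} {y} V h = fresh (trans (sym (lookup∘update′ (♯-head V h) (mask V) false)) (free h))

-- The head of the vector is restricted last, so that a trace on `c ∷ b ∷ a ∷ []` unfolds to `F`
-- restricted at `a`, then `b`, then `c`. The bit vectors are therefore read backwards.
trace : ∀ {n r} → Fam n → Vec (Fin n) r → Subset r → Fam n
trace F [] [] = F
trace F (x ∷ V) (b ∷ β) = restrict (trace F V β) x b

size-drop : ∀ {n} (M : Subset n) x → lookup M x ≡ true → size M ≡ suc (size (M [ x ]≔ false))
size-drop M x mx = trans (cong size (trans (sym ([]≔-lookup M x)) (cong (M [ x ]≔_) mx))) (size-update M x)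

size-replicate : ∀ n → size (replicate n true) ≡ n
size-replicate zero = refl
size-replicate (suc n) = cong suc (size-replicate n)

size-mask : ∀ {n r} (V : Vec (Fin n) r) → Distinct V → size (mask V) ≡ n ∸ r
size-mask [] _ = size-replicate _
size-mask {n} {suc r} (x ∷ V) (h , d) = begin
  size (mask V [ x ]≔ false)           ≡⟨ cong (_∸ 1) (size-drop (mask V) x (free h)) ⟨
  size (mask V) ∸ 1                    ≡⟨ cong (_∸ 1) (size-mask V d) ⟩
  n ∸ r ∸ 1                            ≡⟨ ∸-+-assoc n r 1 ⟩
  n ∸ (r + 1)                          ≡⟨ cong (n ∸_) (+-comm r 1) ⟩
  n ∸ suc r                            ∎
  where open ≡-Reasoning

off-drop : ∀ {n} (M R : Subset n) x → lookup M x ≡ true → off (M [ x ]≔ false) R ≡ bit (lookup R x) + off M R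
off-drop (true ∷ M) (b ∷ R) zero refl = refl
off-drop (true ∷ M) (b ∷ R) (suc x) h = off-drop M R x h
off-drop (false ∷ M) (b ∷ R) (suc x) h = trans (cong (bit b +_) (off-drop M R x h))
  (rearrange (bit b) (bit (lookup R x)) (off M R))
  where
  rearrange : ∀ a b c → a + (b + c) ≡ b + (a + c)
  rearrange = solve-∀

off-replicate : ∀ {n} (R : Subset n) → off (replicate n true) R ≡ 0
off-replicate [] = refl
off-replicate (_ ∷ R) = off-replicate R

size-∷ : ∀ {n} b (S : Subset n) → size (b ∷ S) ≡ bit b + size S
size-∷ true S = refl
size-∷ false S = refl

trace-member : ∀ {n r} (F : Fam n) (V : Vec (Fin n) r) β S → trace F V β S ≡ true → F S ≡ true
trace-member F [] [] S e = e
trace-member F (x ∷ V) (b ∷ β) S e = trace-member F V β S (proj₁ (restrict⁻ (trace F V β) x b S e))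

off-trace : ∀ {n r} (F : Fam n) (V : Vec (Fin n) r) β → Distinct V → ∀ R → trace F V β R ≡ true →
  off (mask V) R ≡ size β
off-trace F [] [] d R e = off-replicate R
off-trace F (x ∷ V) (b ∷ β) (h , d) R e = let (e′ , rx) = restrict⁻ (trace F V β) x b R e in
  trans (off-drop (mask V) R x (free h)) (trans (cong₂ (λ p q → bit p + q) rx (off-trace F V β d R e′))
    (sym (size-∷ b β)))

trace-agree : ∀ {n r} (F : Fam n) (V : Vec (Fin n) r) β R S → trace F V β R ≡ true → trace F V β S ≡ true →
  AgreeOff (mask V) R S
trace-agree F [] [] R S eR eS i mi = true≢false (lookup-replicate i true) mi
trace-agree F (x ∷ V) (b ∷ β) R S eR eS i mi with i ≟ x
... | yes refl = trans (proj₂ (restrict⁻ (trace F V β) x b S eS))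
      (sym (proj₂ (restrict⁻ (trace F V β) x b R eR)))
... | no i≢x = trace-agree F V β R S (proj₁ (restrict⁻ (trace F V β) x b R eR))
      (proj₁ (restrict⁻ (trace F V β) x b S eS)) i
  (trans (sym (lookup∘update′ i≢x (mask V) false)) mi)

data Apart : ∀ {r} → Subset r → Subset r → Set where
  [] : Apart [] []
  _∷_ : ∀ {r b c} {β γ : Subset r} → b ∧ c ≡ false → Apart β γ → Apart (b ∷ β) (c ∷ γ)

trace-apart : ∀ {n r} (F : Fam n) (V : Vec (Fin n) r) {β γ} → Apart β γ → ∀ S T →
  trace F V β S ≡ true → trace F V γ T ≡ true → DisjointOff (mask V) S T
trace-apart F [] [] S T eS eT i mi _ _ = true≢false (lookup-replicate i true) mi
trace-apart F (x ∷ V) {b ∷ β} {c ∷ γ} (bc ∷ ap) S T eS eT i mi si ti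
  with i ≟ x | restrict⁻ (trace F V β) x b S eS | restrict⁻ (trace F V γ) x c T eT
... | yes refl | _ , sx | _ , tx = true≢false (cong₂ _∧_ (trans (sym sx) si) (trans (sym tx) ti)) bc
... | no i≢x | eS′ , _ | eT′ , _ = trace-apart F V ap S T eS′ eT′ i
      (trans (sym (lookup∘update′ i≢x (mask V) false)) mi) si ti

restrict-stable : ∀ {n} {x y z : Fin n} → z ≢ x → z ≢ y → ∀ {F : Fam n} b → StablePair F x y →
  StablePair (restrict F z b) x y
restrict-stable {x = x} {y} {z} z≢x z≢y {F} b st S e sx sy = let (e′ , sz) = restrict⁻ F z b S e in
  restrict⁺ F z b (cof x y true false S) (st S e′ sx sy) (trans (cof-lookup z≢x z≢y true false S) sz)

trace-stable : ∀ {n r} (F : Fam n) (V : Vec (Fin n) r) β {x y} → x ♯ V → y ♯ V → StablePair F x y →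
  StablePair (trace F V β) x y
trace-stable F [] [] hx hy st = st
trace-stable F (z ∷ V) (b ∷ β) hx hy st =
  restrict-stable (≢-sym (♯-head V hx)) (≢-sym (♯-head V hy)) {trace F V β} b
    (trace-stable F V β (♯-tail V hx) (♯-tail V hy) st)

-- The first free position

First : ∀ {n} → Subset n → Fin n → Set
First M w = lookup M w ≡ true × (∀ z → toℕ z < toℕ w → lookup M z ≡ false)

first : ∀ {n} (M : Subset n) → 0 < size M → ∃ (First M)
first (true ∷ M) _ = zero , refl , λ _ ()
first (false ∷ M) lt with first M lt
... | w , mw , before = suc w , mw , λ { zero _ → refl ; (suc z) lt → before z (s≤s⁻¹ lt) }

First-tail : ∀ {n m} {M : Subset n} {w} → First (m ∷ M) (suc w) → First M w
First-tail (mw , before) = mw , λ z lt → before (suc z) (s≤s lt)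

-- A first free position that lies in neither set is a spare position for everything after it.
good-first : ∀ {n} (M : Subset n) w {f S T} → First M w → lookup S w ≡ false → lookup T w ≡ false →
  Good (M [ w ]≔ false) (suc f) S T → Good M f S T
good-first (true ∷ M) zero {S = false ∷ S} {false ∷ T} fw sw tw (fixed g) = neither g
good-first (true ∷ M) (suc w) fw@(_ , before) sw tw g = true≢false refl (before zero z<s)
good-first (false ∷ M) (suc w) fw sw tw (left g) = left (good-first M w (First-tail fw) sw tw g)
good-first (false ∷ M) (suc w) fw sw tw (right g) = right (good-first M w (First-tail fw) sw tw g)
good-first (false ∷ M) (suc w) fw sw tw (fixed g) = fixed (good-first M w (First-tail fw) sw tw g)

late-first : ∀ {n} (M : Subset n) w t {S} → First M w → lookup S w ≡ false →
  late M (suc t) S ≡ late (M [ w ]≔ false) t S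
late-first (true ∷ M) zero zero {false ∷ S} fw sw = refl
late-first (true ∷ M) zero (suc t) {false ∷ S} fw sw = refl
late-first (true ∷ M) (suc w) t fw@(_ , before) sw = true≢false refl (before zero z<s)
late-first (false ∷ M) (suc w) zero {_ ∷ S} fw sw = late-first M w zero (First-tail fw) sw
late-first (false ∷ M) (suc w) (suc t) {_ ∷ S} fw sw = late-first M w (suc t) (First-tail fw) sw

-- Bounds for traces of an intersecting family

late-1 : ∀ c m k i → 1 ≤ m → LateBound c m k i 1 → c ≤ bin m k (suc i)
late-1 c (suc m) k i _ h
  rewrite bin-pascal m k i | bin-pascal m k (suc i) | +-comm i 2 =
  entail (c ∷ bin m k i ∷ bin m k (suc i) ∷ bin m k (suc (suc i)) ∷ []) 1 (# 0) (# 2 ⊕ # 3)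
    ((1 ∙ # 0 ⊕ # 1 ≼ # 1 ⊕ # 2 ⊕ # 3 by h) ∷ []) refl

-- With j = k - i, Pascal's rule leaves C(m-1, j-1) + C(m-2, j-1) + C(m-2, j-2), and the last two
-- terms add up to the first.
late-2 : ∀ c m k i → 2 ≤ m → LateBound c m k i 2 → c ≤ 2 * bin (m ∸ 1) k (suc i)
late-2 c (suc (suc m)) k i _ h
  rewrite bin-pascal (suc m) k i | bin-pascal m k i | bin-pascal m k (suc i) | +-comm i 2 =
  entail (c ∷ bin m k i ∷ bin m k (suc i) ∷ bin m k (suc (suc i)) ∷ []) 1 (# 0) (2 ⊗ (# 2 ⊕ # 3))
    ((1 ∙ # 0 ⊕ # 1 ≼ # 1 ⊕ # 2 ⊕ (# 2 ⊕ # 3) ⊕ # 3 by h) ∷ []) refl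
late-2 c (suc zero) k i (s≤s ()) h

module _ {n k : ℕ} {F : Fam n} (uniform : Uniformᶠ k F) where

  module _ {r} (V : Vec (Fin n) r) (distinct : Distinct V) where

    -- Any member of the trace can serve as reference set. This is why empty traces are treated
    -- separately below.
    trace-layer : ∀ β R → trace F V β R ≡ true → Layer (mask V) k R (trace F V β)
    trace-layer β R eR S eS = uniform S (trace-member F V β S eS) , trace-agree F V β R S eR eS

    hit-trace : ∀ β l → (∀ S → trace F V β S ≡ true → hit (mask V) l S ≡ true) →
      count (trace F V β) ≤ bin (n ∸ r) k (size β + l)
    hit-trace β l h with find (trace F V β)
    ... | inj₂ none = ≤-trans (≤-reflexive (count-empty none)) z≤n
    ... | inj₁ (R , eR) = subst₂ (λ m i → count (trace F V β) ≤ bin m k (i + l))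
      (size-mask V distinct) (off-trace F V β distinct R eR) (count-hit (mask V) k R l (trace-layer β R eR) h)

    count-trace : ∀ β → count (trace F V β) ≤ bin (n ∸ r) k (size β)
    count-trace β = subst (λ i → count (trace F V β) ≤ bin (n ∸ r) k i) (+-identityʳ (size β))
      (hit-trace β 0 λ _ _ → refl)

  module _ (intersecting : Cross F F) {r} (V : Vec (Fin n) r) (distinct : Distinct V) where

    trace-cross : ∀ β γ → Cross (trace F V β) (trace F V γ)
    trace-cross β γ S T eS eT = intersecting S T (trace-member F V β S eS) (trace-member F V γ T eT)

    late-or-hit : ∀ t {β γ} → Apart β γ →
      LateBound (count (trace F V β)) (n ∸ r) k (size β) t ⊎
        count (trace F V γ) ≤ bin (n ∸ r) k (size γ + suc t)
    late-or-hit t {β} {γ} ap with find (trace F V β) | find (trace F V γ)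
    ... | inj₂ none | _ rewrite count-empty none = inj₁
          (≤-trans (bin-mono k (size β) (m∸n≤m (n ∸ r) t)) (m≤m+n _ _))
    ... | inj₁ _ | inj₂ none rewrite count-empty none = inj₂ z≤n
    ... | inj₁ (R , eR) | inj₁ (R′ , eR′) rewrite sym (size-mask V distinct)
        | sym (off-trace F V β distinct R eR) | sym (off-trace F V γ distinct R′ eR′) =
      cross-conclusion (mask V) k R R′ (trace-apart F V ap R R′ eR eR′) t (trace F V β) (trace F V γ)
        (<-wellFounded _)
        (trace-layer V distinct β R eR) (trace-layer V distinct γ R′ eR′) (trace-cross β γ)

    -- If both traces are taken outside `w`, then `w` is a spare position and raises the admissible
    -- sum of heights from 3 to 5. So a member of one trace and a member of the other cannot both
    -- miss height 2.
    stable-first : ∀ {β γ} → Apart β γ → StableOn (mask V) (trace F V β) → ∀ w → First (mask V) w →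
      count (trace F (w ∷ V) (false ∷ β)) ≤ bin (n ∸ suc r) k (size β + 2) ⊎
      count (trace F (w ∷ V) (false ∷ γ)) ≤ bin (n ∸ suc r) k (size γ + 2)
    stable-first {β} {γ} ap st w fw with dichotomy (trace F (w ∷ V) (false ∷ β)) (hit (mask (w ∷ V)) 2)
    ... | inj₂ all = inj₁ (hit-trace (w ∷ V) (fresh (proj₁ fw) , distinct) (false ∷ β) 2 all)
    ... | inj₁ (S , eS , hS) = inj₂ (hit-trace (w ∷ V) (fresh (proj₁ fw) , distinct) (false ∷ γ) 2 λ T eT →
          ¬false⇒true λ eq →
        let (eS′ , sw) = restrict⁻ (trace F V β) w false S eS
            (eT′ , tw) = restrict⁻ (trace F V γ) w false T eT
        in stable-contra (mask V) (trace F V β) (trace F V γ) st (trace-cross β γ)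
             (good-first (mask V) w fw sw tw (hit-good (mask (w ∷ V)) S T 1 2 2
               (trace-apart F (w ∷ V) {false ∷ β} {false ∷ γ} (refl ∷ ap) S T eS eT) (n≤1+n 4) hS eq)) eS′ eT′)

    -- A member of the first trace that avoids both positions and does not rise by 2 after them is
    -- not `late` for t = 2, and so forces height 3 on every member of the other trace.
    stable-first₂ : ∀ {β γ} → Apart β γ → StableOn (mask V) (trace F V β) →
      ∀ w w′ → First (mask V) w → First (mask (w ∷ V)) w′ →
      count (trace F (w′ ∷ w ∷ V) (false ∷ false ∷ β)) ≤ bin (n ∸ suc (suc r)) k (size β + 2) ⊎
      count (trace F V γ) ≤ bin (n ∸ r) k (size γ + 3)
    stable-first₂ {β} {γ} ap st w w′ fw fw′ with dichotomy (trace F (w′ ∷ w ∷ V) (false ∷ false ∷ β))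
      (hit (mask (w′ ∷ w ∷ V)) 2)
    ... | inj₂ all = inj₁ (hit-trace (w′ ∷ w ∷ V) (fresh (proj₁ fw′) , fresh (proj₁ fw) , distinct) (false ∷
          false ∷ β) 2 all)
    ... | inj₁ (S , eS , hS) = inj₂ (hit-trace V distinct γ 3 λ T eT → ¬false⇒true λ eq →
        stable-contra (mask V) (trace F V β) (trace F V γ) st (trace-cross β γ)
          (late-good (mask V) S T 0 3 2 (trace-apart F V ap S T eS₂ eT) ≤-refl late₂ eq) eS₂ eT)
      where
      eS₁ = proj₁ (restrict⁻ (trace F (w ∷ V) (false ∷ β)) w′ false S eS)
      sw′ = proj₂ (restrict⁻ (trace F (w ∷ V) (false ∷ β)) w′ false S eS)
      eS₂ = proj₁ (restrict⁻ (trace F V β) w false S eS₁)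
      late₂ : late (mask V) 2 S ≡ false
      late₂ = trans (late-first (mask V) w 1 fw (proj₂ (restrict⁻ (trace F V β) w false S eS₁)))
        (trans (late-first (mask (w ∷ V)) w′ 0 fw′ sw′) hS)

  -- A member is compared with itself. Two spare positions admit the heights 3 and 3, because 3 + 3
  -- ≤ 3 + 2 · 2.
  stable-both-first : Cross F F → StableOn (mask []) F → ∀ w w′ → First (mask []) w → First (mask (w ∷ [])) w′ →
    count (F ⁻ w ⁻ w′) ≤ bin (n ∸ 2) k 3
  stable-both-first intersecting st w w′ fw fw′ =
    hit-trace (w′ ∷ w ∷ []) (fresh (proj₁ fw′) , fresh (proj₁ fw) , tt) (false ∷ false ∷ []) 3 λ S eS →
      ¬false⇒true λ eq →
      let (eS₁ , sw′) = restrict⁻ (F ⁻ w) w′ false S eS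
          (eS₂ , sw) = restrict⁻ F w false S eS₁
      in stable-contra (mask []) F F st intersecting
           (good-first (mask []) w fw sw sw (good-first (mask (w ∷ [])) w′ fw′ sw′ sw′
             (hit-good (mask (w′ ∷ w ∷ [])) S S 2 3 3
               (trace-apart F (w′ ∷ w ∷ []) {false ∷ false ∷ []} {false ∷ false ∷ []} (refl ∷ refl ∷ []) S S eS
                 eS)
               (n≤1+n 6) eq eq))) eS₂ eS₂

count-rotate : ∀ {n} (F : Fam n) a α b β c γ →
  count (restrict (restrict (restrict F b β) c γ) a α) ≡ count (restrict (restrict (restrict F a α) b β) c γ)
count-rotate F a α b β c γ = trans (count-restrict-comm (restrict F b β) c γ a α)
  (count-cong (restrict-cong (restrict-comm F b β a α) c γ))

C-pos : ∀ m j → j ≤ m → 0 < m C j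
C-pos m zero _ = ≤-refl
C-pos (suc m) (suc j) (s≤s j≤m) =
  subst (0 <_) (nCk+nC[k+1]≡[n+1]C[k+1] m j) (≤-trans (C-pos m j j≤m) (m≤m+n _ _))

bin-pos : ∀ m k i → i ≤ k → k ≤ m + i → 0 < bin m k i
bin-pos m k zero _ k≤m = C-pos m k (subst (k ≤_) (+-identityʳ m) k≤m)
bin-pos m (suc k) (suc i) (s≤s i≤k) h = bin-pos m k i i≤k (s≤s⁻¹ (subst (suc k ≤_) (+-suc m i) h))

-- The constants u and v, heavy pairs and triangles

module Setting {n k : ℕ} (3≤k : 3 ≤ k) (large : 36 * (k + 6) ≤ n) where

  36k≤n∸3 : 36 * k ≤ n ∸ 3
  36k≤n∸3 = m+n≤o⇒m≤o∸n (36 * k) (≤-trans (≤-trans (+-monoʳ-≤ (36 * k) (≤ᵇ⇒≤ 3 216 tt))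
    (≤-reflexive (sym (*-distribˡ-+ 36 k 6)))) large)

  216≤n : 216 ≤ n
  216≤n = ≤-trans (*-monoʳ-≤ 36 (m≤n+m 6 k)) large

  u v : ℕ
  u = bin (n ∸ 3) k 3
  v = bin (n ∸ 3) k 4

  u-pos : 0 < u
  u-pos = bin-pos (n ∸ 3) k 3 3≤k (≤-trans (m≤n*m k 36) (≤-trans 36k≤n∸3 (m≤m+n _ 3)))

  35v≤u : 35 * v ≤ u
  35v≤u = bin-decay 35 (n ∸ 3) k 3 36k≤n∸3

  bin-5≤v : bin (n ∸ 3) k 5 ≤ v
  bin-5≤v = ≤-trans (m≤n*m _ 35) (bin-decay 35 (n ∸ 3) k 4 36k≤n∸3)

  bin-2-3 : bin (n ∸ 2) k 3 ≡ u + v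
  bin-2-3 = trans (cong (λ m → bin m k 3) (+-∸-assoc 1 {n} {3} (≤-trans (≤ᵇ⇒≤ 3 216 tt) 216≤n)))
    (bin-pascal (n ∸ 3) k 3)

  bin-shrink : ∀ {r} i → 3 ≤ r → bin (n ∸ r) k i ≤ bin (n ∸ 3) k i
  bin-shrink i 3≤r = bin-mono k i (∸-monoʳ-≤ n 3≤r)

  room : ∀ {r} → r ≤ 5 → 2 ≤ n ∸ r
  room r≤5 = ≤-trans (≤ᵇ⇒≤ 2 211 tt) (≤-trans (∸-monoˡ-≤ 5 216≤n) (∸-monoʳ-≤ n r≤5))

  module _ {F : Fam n} (uniform : Uniformᶠ k F) (intersecting : Cross F F) where

    count-triple : ∀ {a b c : Fin n} → a ≢ b → a ≢ c → b ≢ c → count (F ⁺ a ⁺ b ⁺ c) ≤ u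
    count-triple {a} {b} {c} a≢b a≢c b≢c =
      count-trace uniform (c ∷ b ∷ a ∷ []) (♯∷ (≢-sym b≢c) (♯∷ (≢-sym a≢c) ♯[]) , ♯∷ (≢-sym a≢b) ♯[] , ♯[] , tt)
        (true ∷ true ∷ true ∷ [])

    module _ {r} (V : Vec (Fin n) r) (distinct : Distinct V) (3≤r : 3 ≤ r) (r≤5 : r ≤ 5) where

      -- This is `late-or-hit` for t = 2, and 2 u is the bound that `late-2` gives for a trace of
      -- size two. The disjoint trace then has at most u, C(n-3, k-4) or C(n-3, k-5) members,
      -- according to whether its size is 0, 1 or 2.
      heavy-light : ∀ {β γ} → size β ≡ 2 → Apart β γ → 2 * u < count (trace F V β) →
        count (trace F V γ) ≤ bin (n ∸ 3) k (size γ + 3)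
      heavy-light {β} {γ} two ap heavy with late-or-hit uniform intersecting V distinct 2 ap
      ... | inj₂ le = ≤-trans le (bin-shrink (size γ + 3) 3≤r)
      ... | inj₁ le = contradiction heavy (≤⇒≯ (≤-trans
              (late-2 _ (n ∸ r) k 2 (room r≤5) (subst (λ i → LateBound (count (trace F V β)) (n ∸ r) k i 2) two
                le))
              (*-monoʳ-≤ 2 (bin-mono k 3 (subst (_≤ n ∸ 3) (sym (∸-+-assoc n r 1))
                (∸-monoʳ-≤ n (≤-trans 3≤r (m≤m+n r 1))))))))

      -- The case t = 1: more than u members on a pair already force a disjoint singleton trace down
      -- to u.
      heavy-light₁ : ∀ {β γ} → size β ≡ 2 → Apart β γ → u < count (trace F V β) →
        count (trace F V γ) ≤ bin (n ∸ 3) k (size γ + 2)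
      heavy-light₁ {β} {γ} two ap heavy with late-or-hit uniform intersecting V distinct 1 ap
      ... | inj₂ le = ≤-trans le (bin-shrink (size γ + 2) 3≤r)
      ... | inj₁ le = contradiction heavy (≤⇒≯ (≤-trans
              (late-1 _ (n ∸ r) k 2 (≤-trans (n≤1+n 1) (room r≤5))
                (subst (λ i → LateBound (count (trace F V β)) (n ∸ r) k i 1) two le))
              (bin-shrink 3 3≤r)))

  -- At most u of these members contain a given third point, so more than the 2 u that heavy-light needs
  -- avoid it.
  Heavy : Fam n → Fin n → Fin n → Set
  Heavy F a b = 3 * u < count (F ⁺ a ⁺ b)

  heavy-sym : ∀ {F a b} → Heavy F a b → Heavy F b a
  heavy-sym {F} {a} {b} = subst (3 * u <_) (count-restrict-comm F a true b true)

  record Triangle (F : Fam n) : Set where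
    constructor triangle
    field
      {p q r} : Fin n
      p≢q : p ≢ q
      p≢r : p ≢ r
      q≢r : q ≢ r
      pq : Heavy F p q
      pr : Heavy F p r
      qr : Heavy F q r

  module Outside {F : Fam n} (uniform : Uniformᶠ k F) (intersecting : Cross F F) where

    heavy-pair : ∀ {a b c} → a ≢ b → a ≢ c → b ≢ c → Heavy F a b → 2 * u < count (F ⁺ a ⁺ b ⁻ c)
    heavy-pair {a} {b} {c} a≢b a≢c b≢c h = entail (u ∷ count (F ⁺ a ⁺ b) ∷ count (F ⁺ a ⁺ b ⁺ c) ∷
        count (F ⁺ a ⁺ b ⁻ c) ∷ [])
      1 (sucᴱ (2 ⊗ # 0)) (# 3)
      ((1 ∙ # 1 ≼ # 2 ⊕ # 3 by ≤-reflexive (count-split (F ⁺ a ⁺ b) c)) ∷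
       (1 ∙ # 2 ≼ # 0 by count-triple uniform intersecting a≢b a≢c b≢c) ∷ (1 ∙ sucᴱ (3 ⊗ # 0) ≼ # 1 by h) ∷ [])
         refl

    outside-pair : ∀ {a b c} → a ≢ b → a ≢ c → b ≢ c → Heavy F a b →
      count (F ⁻ a ⁻ b ⁺ c) ≤ v × count (F ⁻ a ⁻ b ⁻ c) ≤ u
    outside-pair {a} {b} {c} a≢b a≢c b≢c h =
      light {true ∷ false ∷ false ∷ []} (refl ∷ refl ∷ refl ∷ []) ,
        light {false ∷ false ∷ false ∷ []} (refl ∷ refl ∷ refl ∷ [])
      where
      light : ∀ {γ} → Apart (false ∷ true ∷ true ∷ []) γ →
        count (trace F (c ∷ b ∷ a ∷ []) γ) ≤ bin (n ∸ 3) k (size γ + 3)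
      light ap = heavy-light uniform intersecting (c ∷ b ∷ a ∷ [])
        (♯∷ (≢-sym b≢c) (♯∷ (≢-sym a≢c) ♯[]) , ♯∷ (≢-sym a≢b) ♯[] , ♯[] , tt) ≤-refl (≤ᵇ⇒≤ 3 5 tt) refl ap
        (heavy-pair a≢b a≢c b≢c h)

    -- Together the four bounds say that all but u + 3 v members contain at least two of the three
    -- points.
    record Rigid (a b c : Fin n) : Set where
      field
        none≤ : count (F ⁻ a ⁻ b ⁻ c) ≤ u
        only-a≤ : count (F ⁺ a ⁻ b ⁻ c) ≤ v
        only-b≤ : count (F ⁻ a ⁺ b ⁻ c) ≤ v
        only-c≤ : count (F ⁻ a ⁻ b ⁺ c) ≤ v

    rigid : ∀ {a b c} → a ≢ b → a ≢ c → b ≢ c → Heavy F a b → Heavy F a c → Heavy F b c → Rigid a b c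
    rigid {a} {b} {c} a≢b a≢c b≢c ab ac bc = record
      { none≤ = proj₂ (outside-pair a≢b a≢c b≢c ab)
      ; only-a≤ = subst (_≤ v) (count-rotate F a true b false c false)
        (proj₁ (outside-pair b≢c (≢-sym a≢b) (≢-sym a≢c) bc))
      ; only-b≤ = subst (_≤ v) (count-restrict-comm (F ⁻ a) c false b true)
        (proj₁ (outside-pair a≢c a≢b (≢-sym b≢c) ac))
      ; only-c≤ = proj₁ (outside-pair a≢b a≢c b≢c ab)
      }

restrict-mono : ∀ {n} {F G : Fam n} → (∀ S → F S ≡ true → G S ≡ true) → ∀ x b S → restrict F x b S ≡ true →
  restrict G x b S ≡ true
restrict-mono {F = F} {G} h x b S e = let (p , q) = restrict⁻ F x b S e in restrict⁺ G x b S (h S p) q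

drop-inner : ∀ {n} (F : Fam n) x a y b → count (restrict (restrict F x a) y b) ≤ count (restrict F y b)
drop-inner F x a y b = count-mono _ _ λ S → restrict-mono {F = restrict F x a} {F} (λ S e →
  proj₁ (restrict⁻ F x a S e)) y b S

count-split-pair : ∀ {n} (F : Fam n) x y →
  count F ≡ (count (F ⁺ x ⁺ y) + count (F ⁺ x ⁻ y)) + (count (F ⁻ x ⁺ y) + count (F ⁻ x ⁻ y))
count-split-pair F x y = trans (count-split F x) (cong₂ _+_ (count-split (F ⁺ x) y) (count-split (F ⁻ x) y))

count-split-inner : ∀ {n} (F : Fam n) x y z b →
  count (restrict F z b) ≡ (count (restrict (F ⁺ x ⁺ y) z b) + count (restrict (F ⁺ x ⁻ y) z b)) +
                           (count (restrict (F ⁻ x ⁺ y) z b) + count (restrict (F ⁻ x ⁻ y) z b))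
count-split-inner F x y z b = trans (count-split₂ F z b x)
  (cong₂ _+_ (count-split₂ (F ⁺ x) z b y) (count-split₂ (F ⁻ x) z b y))

count-split-inner₂ : ∀ {n} (F : Fam n) x z b w c →
  count (restrict (restrict F z b) w c) ≡
  count (restrict (restrict (F ⁺ x) z b) w c) + count (restrict (restrict (F ⁻ x) z b) w c)
count-split-inner₂ F x z b w c = trans (count-split (restrict (restrict F z b) w c) x)
  (cong₂ _+_ (count-rotate F x true z b w c) (count-rotate F x false z b w c))

-- Traces on two disjoint edges

module Edges {n k : ℕ} (3≤k : 3 ≤ k) (large : 36 * (k + 6) ≤ n) where

  open Setting {n} {k} 3≤k large

  Edge : Fam n → Fin n → Fin n → Set
  Edge F x y = count (F ⁻ x ⁻ y) < 9 * u

  -- 35 = 3 · 9 + 8 makes three disjoint edges impossible.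
  record Ample (F : Fam n) : Set where
    field
      uniform : Uniformᶠ k F
      intersecting : Cross F F
      many : 35 * u ≤ count F
      spread : ∀ j → 9 * u ≤ count (F ⁻ j)

  module TwoEdges {F : Fam n} (ample : Ample F) {x y z w : Fin n} (distinct : Distinct (w ∷ z ∷ y ∷ x ∷ []))
    (edge-xy : Edge F x y) (edge-zw : Edge F z w) (stable : StableOn (mask (w ∷ z ∷ y ∷ x ∷ [])) F) where

    open Ample ample

    V : Vec (Fin n) 4
    V = w ∷ z ∷ y ∷ x ∷ []

    -- The digits of t1010 say which of x, y, z, w belong to the members that are counted.
    t1111 t1110 t1101 t1100 t1011 t1010 t1001 t1000 t0111 t0110 t0101 t0100 t0011 t0010 t0001 t0000 : ℕ
    t1111 = count (trace F V (true ∷ true ∷ true ∷ true ∷ []))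
    t1110 = count (trace F V (false ∷ true ∷ true ∷ true ∷ []))
    t1101 = count (trace F V (true ∷ false ∷ true ∷ true ∷ []))
    t1100 = count (trace F V (false ∷ false ∷ true ∷ true ∷ []))
    t1011 = count (trace F V (true ∷ true ∷ false ∷ true ∷ []))
    t1010 = count (trace F V (false ∷ true ∷ false ∷ true ∷ []))
    t1001 = count (trace F V (true ∷ false ∷ false ∷ true ∷ []))
    t1000 = count (trace F V (false ∷ false ∷ false ∷ true ∷ []))
    t0111 = count (trace F V (true ∷ true ∷ true ∷ false ∷ []))
    t0110 = count (trace F V (false ∷ true ∷ true ∷ false ∷ []))
    t0101 = count (trace F V (true ∷ false ∷ true ∷ false ∷ []))
    t0100 = count (trace F V (false ∷ false ∷ true ∷ false ∷ []))
    t0011 = count (trace F V (true ∷ true ∷ false ∷ false ∷ []))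
    t0010 = count (trace F V (false ∷ true ∷ false ∷ false ∷ []))
    t0001 = count (trace F V (true ∷ false ∷ false ∷ false ∷ []))
    t0000 = count (trace F V (false ∷ false ∷ false ∷ false ∷ []))

    expand : count F ≡ _
    expand = trans (count-split-pair F x y) (cong₂ _+_
      (cong₂ _+_ (count-split-pair (F ⁺ x ⁺ y) z w) (count-split-pair (F ⁺ x ⁻ y) z w))
      (cong₂ _+_ (count-split-pair (F ⁻ x ⁺ y) z w) (count-split-pair (F ⁻ x ⁻ y) z w)))

    expand-x : count (F ⁻ x) ≡ _
    expand-x = trans (count-split (F ⁻ x) y) (cong₂ _+_ (count-split-pair (F ⁻ x ⁺ y) z w)
      (count-split-pair (F ⁻ x ⁻ y) z w))

    expand-xy : count (F ⁻ x ⁻ y) ≡ _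
    expand-xy = count-split-pair (F ⁻ x ⁻ y) z w

    expand-z : count (F ⁻ z) ≡ _
    expand-z = trans (count-split-inner F x y z false) (cong₂ _+_
      (cong₂ _+_ (count-split (F ⁺ x ⁺ y ⁻ z) w) (count-split (F ⁺ x ⁻ y ⁻ z) w))
      (cong₂ _+_ (count-split (F ⁻ x ⁺ y ⁻ z) w) (count-split (F ⁻ x ⁻ y ⁻ z) w)))

    expand-zw : count (F ⁻ z ⁻ w) ≡ _
    expand-zw = trans (count-split-inner₂ F x z false w false)
      (cong₂ _+_ (count-split-inner₂ (F ⁺ x) y z false w false) (count-split-inner₂ (F ⁻ x) y z false w false))

    small : ∀ β → size β ≡ 3 → count (trace F V β) ≤ u
    small β size3 = ≤-trans (count-trace uniform V distinct β)
      (subst (λ i → bin (n ∸ 4) k i ≤ u) (sym size3) (bin-shrink 3 (n≤1+n 3)))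

    tiny : count (trace F V (true ∷ true ∷ true ∷ true ∷ [])) ≤ v
    tiny = ≤-trans (count-trace uniform V distinct (true ∷ true ∷ true ∷ true ∷ [])) (bin-shrink 4 (n≤1+n 3))

    heavy-light′ : ∀ {β γ} → size β ≡ 2 → Apart β γ → 2 * u < count (trace F V β) →
      count (trace F V γ) ≤ bin (n ∸ 3) k (size γ + 3)
    heavy-light′ {β} {γ} = heavy-light uniform intersecting V distinct (n≤1+n 3) (n≤1+n 4) {β} {γ}

    heavy-light₁′ : ∀ {β γ} → size β ≡ 2 → Apart β γ → u < count (trace F V β) →
      count (trace F V γ) ≤ bin (n ∸ 3) k (size γ + 2)
    heavy-light₁′ {β} {γ} = heavy-light₁ uniform intersecting V distinct (n≤1+n 3) (n≤1+n 4) {β} {γ}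

    3u⇒2u : ∀ {p} → 3 * u < p → 2 * u < p
    3u⇒2u = ≤-<-trans (*-monoˡ-≤ u (n≤1+n 2))

    y≢x : y ≢ x
    y≢x = ♯-head [] (proj₁ (proj₂ (proj₂ distinct)))

    z♯ : z ♯ y ∷ x ∷ []
    z♯ = proj₁ (proj₂ distinct)

    z≢y : z ≢ y
    z≢y = ♯-head (x ∷ []) z♯

    z≢x : z ≢ x
    z≢x = ♯-head [] (♯-tail (x ∷ []) z♯)

    w♯ : w ♯ z ∷ y ∷ x ∷ []
    w♯ = proj₁ distinct

    w≢z : w ≢ z
    w≢z = ♯-head (y ∷ x ∷ []) w♯

    w≢x : w ≢ x
    w≢x = ♯-head [] (♯-tail (x ∷ []) (♯-tail (y ∷ x ∷ []) w♯))

    heavy-xz : 3 * u < t1010 → Heavy F x z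
    heavy-xz lt = <-≤-trans lt (≤-trans (count-restrict (F ⁺ x ⁻ y ⁺ z) w false)
      (drop-inner (F ⁺ x) y false z true))

    heavy-xw : 3 * u < t1001 → Heavy F x w
    heavy-xw lt = <-≤-trans lt (≤-trans (drop-inner (F ⁺ x ⁻ y) z false w true)
      (drop-inner (F ⁺ x) y false w true))

    heavy-xy : 3 * u < t1100 → Heavy F x y
    heavy-xy lt = <-≤-trans lt (≤-trans (count-restrict (F ⁺ x ⁺ y ⁻ z) w false)
      (count-restrict (F ⁺ x ⁺ y) z false))

    heavy-yz : 3 * u < t0110 → Heavy F y z
    heavy-yz lt = <-≤-trans lt (≤-trans (count-restrict (F ⁻ x ⁺ y ⁺ z) w false)
      (count-mono _ _ λ S → restrict-mono (restrict-mono (λ S e → proj₁ (restrict⁻ F x false S e)) y true) z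
        true S))

    heavy-zw : 3 * u < t0011 → Heavy F z w
    heavy-zw lt = <-≤-trans lt (count-mono _ _ λ S → restrict-mono (restrict-mono
      (λ S e → proj₁ (restrict⁻ F x false S (proj₁ (restrict⁻ (F ⁻ x) y false S e)))) z true) w true S)

    -- By the symmetries of the two edges, xz may be taken as the largest of the four traces with
    -- one point on each edge.
    module _ (xw≤xz : t1001 ≤ t1010)
             (yz≤xz : t0110 ≤ t1010)
             (yw≤xz : t0101 ≤ t1010) where

      -- The two edges are missed by fewer than 18 u members, the traces of size three have at most
      -- 4 u and the full trace at most v. Of 35 u members more than 12 u remain for the four
      -- crossing traces.
      xz>3u : 3 * u < t1010
      xz>3u = entail (u ∷ v ∷ count F ∷ count (F ⁻ x ⁻ y) ∷ count (F ⁻ z ⁻ w) ∷ t1111 ∷ t1110 ∷ t1101 ∷ t1100 ∷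
          t1011 ∷ t1010 ∷ t1001 ∷ t1000 ∷ t0111 ∷ t0110 ∷ t0101 ∷ t0100 ∷ t0011 ∷ t0010 ∷ t0001 ∷ t0000 ∷ [])
        140 (sucᴱ (3 ⊗ # 0)) (# 10)
        ((35 ∙ # 2 ≼ # 5 ⊕ # 6 ⊕ (# 7 ⊕ # 8) ⊕ (# 9 ⊕ # 10 ⊕ (# 11 ⊕ # 12)) ⊕
          (# 13 ⊕ # 14 ⊕ (# 15 ⊕ # 16) ⊕ (# 17 ⊕ # 18 ⊕ (# 19 ⊕ # 20))) by ≤-reflexive expand) ∷
         (35 ∙ # 17 ⊕ # 18 ⊕ (# 19 ⊕ # 20) ≼ # 3 by ≡⇒≥ expand-xy) ∷
         (35 ∙ # 8 ⊕ # 12 ⊕ (# 16 ⊕ # 20) ≼ # 4 by ≡⇒≥ expand-zw) ∷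
         (35 ∙ # 6 ≼ # 0 by small (false ∷ true ∷ true ∷ true ∷ []) refl) ∷
         (35 ∙ # 7 ≼ # 0 by small (true ∷ false ∷ true ∷ true ∷ []) refl) ∷
         (35 ∙ # 9 ≼ # 0 by small (true ∷ true ∷ false ∷ true ∷ []) refl) ∷
         (35 ∙ # 13 ≼ # 0 by small (true ∷ true ∷ true ∷ false ∷ []) refl) ∷ (35 ∙ # 5 ≼ # 1 by tiny) ∷
         (35 ∙ 35 ⊗ # 0 ≼ # 2 by many) ∷ (35 ∙ sucᴱ (# 3) ≼ 9 ⊗ # 0 by edge-xy) ∷
         (35 ∙ sucᴱ (# 4) ≼ 9 ⊗ # 0 by edge-zw) ∷ (1 ∙ 35 ⊗ # 1 ≼ # 0 by 35v≤u) ∷ (34 ∙ lit 1 ≼ # 0 by u-pos) ∷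
         (35 ∙ # 11 ≼ # 10 by xw≤xz) ∷ (35 ∙ # 14 ≼ # 10 by yz≤xz) ∷ (35 ∙ # 15 ≼ # 10 by yw≤xz) ∷ []) refl

      xz>2u : 2 * u < t1010
      xz>2u = 3u⇒2u xz>3u

      t0101≤v : t0101 ≤ v
      t0101≤v = ≤-trans (heavy-light′ {false ∷ true ∷ false ∷ true ∷ []} {true ∷ false ∷ true ∷ false ∷ []} refl
        (refl ∷ refl ∷ refl ∷ refl ∷ []) xz>2u) bin-5≤v

      t0100≤v : t0100 ≤ v
      t0100≤v = heavy-light′ {false ∷ true ∷ false ∷ true ∷ []} {false ∷ false ∷ true ∷ false ∷ []} refl (refl ∷
        refl ∷ refl ∷ refl ∷ []) xz>2u

      t0001≤v : t0001 ≤ v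
      t0001≤v = heavy-light′ {false ∷ true ∷ false ∷ true ∷ []} {true ∷ false ∷ false ∷ false ∷ []} refl (refl ∷
        refl ∷ refl ∷ refl ∷ []) xz>2u

      t0000≤u : t0000 ≤ u
      t0000≤u = heavy-light′ {false ∷ true ∷ false ∷ true ∷ []} {false ∷ false ∷ false ∷ false ∷ []} refl
        (refl ∷ refl ∷ refl ∷ refl ∷ []) xz>2u

      without-x : 7 * u ≤ t0010 + t0110 + t0011 + 3 * v
      without-x = entail (u ∷ v ∷ count (F ⁻ x) ∷ t0111 ∷ t0110 ∷ t0101 ∷ t0100 ∷ t0011 ∷ t0010 ∷ t0001 ∷
          t0000 ∷ [])
        1 (7 ⊗ # 0) (# 8 ⊕ # 4 ⊕ # 7 ⊕ 3 ⊗ # 1)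
        ((1 ∙ # 2 ≼ # 3 ⊕ # 4 ⊕ (# 5 ⊕ # 6) ⊕ (# 7 ⊕ # 8 ⊕ (# 9 ⊕ # 10)) by ≤-reflexive expand-x) ∷
         (1 ∙ # 3 ≼ # 0 by small (true ∷ true ∷ true ∷ false ∷ []) refl) ∷ (1 ∙ 9 ⊗ # 0 ≼ # 2 by spread x) ∷
         (1 ∙ # 5 ≼ # 1 by t0101≤v) ∷ (1 ∙ # 6 ≼ # 1 by t0100≤v) ∷ (1 ∙ # 9 ≼ # 1 by t0001≤v) ∷
         (1 ∙ # 10 ≼ # 0 by t0000≤u) ∷ []) refl

      without-z : 7 * u ≤ t1000 + t1001 + t1100 + 3 * v
      without-z = entail (u ∷ v ∷ count (F ⁻ z) ∷ t1101 ∷ t1100 ∷ t1001 ∷ t1000 ∷ t0101 ∷ t0100 ∷ t0001 ∷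
          t0000 ∷ [])
        1 (7 ⊗ # 0) (# 6 ⊕ # 5 ⊕ # 4 ⊕ 3 ⊗ # 1)
        ((1 ∙ # 2 ≼ # 3 ⊕ # 4 ⊕ (# 5 ⊕ # 6) ⊕ (# 7 ⊕ # 8 ⊕ (# 9 ⊕ # 10)) by ≤-reflexive expand-z) ∷
         (1 ∙ # 3 ≼ # 0 by small (true ∷ false ∷ true ∷ true ∷ []) refl) ∷ (1 ∙ 9 ⊗ # 0 ≼ # 2 by spread z) ∷
         (1 ∙ # 7 ≼ # 1 by t0101≤v) ∷ (1 ∙ # 8 ≼ # 1 by t0100≤v) ∷ (1 ∙ # 9 ≼ # 1 by t0001≤v) ∷
         (1 ∙ # 10 ≼ # 0 by t0000≤u) ∷ []) refl

      -- The traces {y, z} and {z} are disjoint from {x, w} and therefore light, so `without-x`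
      -- leaves only {z, w} to be large.
      xw-heavy : 3 * u < t1001 → Triangle F
      xw-heavy h = triangle (≢-sym z≢x) (≢-sym w≢x) (≢-sym w≢z) (heavy-xz xz>3u) (heavy-xw h) (heavy-zw
        (entail (u ∷ v ∷ t0110 ∷ t0011 ∷ t0010 ∷ [])
          7 (sucᴱ (3 ⊗ # 0)) (# 3)
          ((7 ∙ 7 ⊗ # 0 ≼ # 4 ⊕ # 2 ⊕ # 3 ⊕ 3 ⊗ # 1 by without-x) ∷ (1 ∙ 35 ⊗ # 1 ≼ # 0 by 35v≤u) ∷
           (27 ∙ lit 1 ≼ # 0 by u-pos) ∷
           (7 ∙ # 2 ≼ # 1 by ≤-trans (heavy-light′ {true ∷ false ∷ false ∷ true ∷ []} {false ∷ true ∷ true ∷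
             false ∷ []} refl (refl ∷ refl ∷ refl ∷ refl ∷ []) (3u⇒2u h)) bin-5≤v) ∷
           (7 ∙ # 4 ≼ # 1 by heavy-light′ {true ∷ false ∷ false ∷ true ∷ []} {false ∷ true ∷ false ∷ false ∷ []}
             refl (refl ∷ refl ∷ refl ∷ refl ∷ []) (3u⇒2u h)) ∷
           []) refl))

      yz-heavy : 3 * u < t0110 → Triangle F
      yz-heavy h = triangle (≢-sym y≢x) (≢-sym z≢x) (≢-sym z≢y) (heavy-xy
        (entail (u ∷ v ∷ t1100 ∷ t1001 ∷ t1000 ∷ [])
          7 (sucᴱ (3 ⊗ # 0)) (# 2)
          ((7 ∙ 7 ⊗ # 0 ≼ # 4 ⊕ # 3 ⊕ # 2 ⊕ 3 ⊗ # 1 by without-z) ∷ (1 ∙ 35 ⊗ # 1 ≼ # 0 by 35v≤u) ∷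
           (27 ∙ lit 1 ≼ # 0 by u-pos) ∷
           (7 ∙ # 3 ≼ # 1 by ≤-trans (heavy-light′ {false ∷ true ∷ true ∷ false ∷ []} {true ∷ false ∷ false ∷
             true ∷ []} refl (refl ∷ refl ∷ refl ∷ refl ∷ []) (3u⇒2u h)) bin-5≤v) ∷
           (7 ∙ # 4 ≼ # 1 by heavy-light′ {false ∷ true ∷ true ∷ false ∷ []} {false ∷ false ∷ false ∷ true ∷ []}
             refl (refl ∷ refl ∷ refl ∷ refl ∷ []) (3u⇒2u h)) ∷
           []) refl))
        (heavy-xz xz>3u) (heavy-yz h)

      -- No other crossing trace is heavy. The members avoiding z then concentrate on the trace {x},
      -- those avoiding x on the trace {z}, and a fifth point p completes the triangle.
      module Light (xw≤3u : t1001 ≤ 3 * u) (yz≤3u : t0110 ≤ 3 * u) where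

        zw≤2u : t0011 ≤ 2 * u
        zw≤2u = ≮⇒≥ λ h → (refute (u ∷ v ∷ t1100 ∷ t1001 ∷ t1000 ∷ [])
          ((7 ∙ 7 ⊗ # 0 ≼ # 4 ⊕ # 3 ⊕ # 2 ⊕ 3 ⊗ # 1 by without-z) ∷ (1 ∙ 35 ⊗ # 1 ≼ # 0 by 35v≤u) ∷
           (27 ∙ lit 1 ≼ # 0 by u-pos) ∷ (7 ∙ # 3 ≼ 3 ⊗ # 0 by xw≤3u) ∷
           (7 ∙ # 4 ≼ # 1 by heavy-light′ {true ∷ true ∷ false ∷ false ∷ []} {false ∷ false ∷ false ∷ true ∷ []}
             refl (refl ∷ refl ∷ refl ∷ refl ∷ []) h) ∷
           (7 ∙ # 2 ≼ # 1 by ≤-trans (heavy-light′ {true ∷ true ∷ false ∷ false ∷ []} {false ∷ false ∷ true ∷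
             true ∷ []} refl (refl ∷ refl ∷ refl ∷ refl ∷ []) h) bin-5≤v) ∷
           []) refl)

        xy≤2u : t1100 ≤ 2 * u
        xy≤2u = ≮⇒≥ λ h → (refute (u ∷ v ∷ t0110 ∷ t0011 ∷ t0010 ∷ [])
          ((7 ∙ 7 ⊗ # 0 ≼ # 4 ⊕ # 2 ⊕ # 3 ⊕ 3 ⊗ # 1 by without-x) ∷ (1 ∙ 35 ⊗ # 1 ≼ # 0 by 35v≤u) ∷
           (27 ∙ lit 1 ≼ # 0 by u-pos) ∷ (7 ∙ # 2 ≼ 3 ⊗ # 0 by yz≤3u) ∷
           (7 ∙ # 4 ≼ # 1 by heavy-light′ {false ∷ false ∷ true ∷ true ∷ []} {false ∷ true ∷ false ∷ false ∷ []}
             refl (refl ∷ refl ∷ refl ∷ refl ∷ []) h) ∷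
           (7 ∙ # 3 ≼ # 1 by ≤-trans (heavy-light′ {false ∷ false ∷ true ∷ true ∷ []} {true ∷ true ∷ false ∷
             false ∷ []} refl (refl ∷ refl ∷ refl ∷ refl ∷ []) h) bin-5≤v) ∷
           []) refl)

        x-large : u < t1000
        x-large = entail (u ∷ v ∷ t1100 ∷ t1001 ∷ t1000 ∷ [])
          35 (sucᴱ (# 0)) (# 4)
          ((35 ∙ 7 ⊗ # 0 ≼ # 4 ⊕ # 3 ⊕ # 2 ⊕ 3 ⊗ # 1 by without-z) ∷ (3 ∙ 35 ⊗ # 1 ≼ # 0 by 35v≤u) ∷
           (32 ∙ lit 1 ≼ # 0 by u-pos) ∷ (35 ∙ # 3 ≼ 3 ⊗ # 0 by xw≤3u) ∷ (35 ∙ # 2 ≼ 2 ⊗ # 0 by xy≤2u) ∷ [])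
             refl

        z-large : u < t0010
        z-large = entail (u ∷ v ∷ t0110 ∷ t0011 ∷ t0010 ∷ [])
          35 (sucᴱ (# 0)) (# 4)
          ((35 ∙ 7 ⊗ # 0 ≼ # 4 ⊕ # 2 ⊕ # 3 ⊕ 3 ⊗ # 1 by without-x) ∷ (3 ∙ 35 ⊗ # 1 ≼ # 0 by 35v≤u) ∷
           (32 ∙ lit 1 ≼ # 0 by u-pos) ∷ (35 ∙ # 2 ≼ 3 ⊗ # 0 by yz≤3u) ∷ (35 ∙ # 3 ≼ 2 ⊗ # 0 by zw≤2u) ∷ [])
             refl

        -- The singleton traces now exceed u, so `heavy-light₁` lowers the bounds 2 u and 3 u on the
        -- pairs to u.
        xy≤u : t1100 ≤ u
        xy≤u = ≮⇒≥ λ h → <⇒≱ z-large (heavy-light₁′ {false ∷ false ∷ true ∷ true ∷ []} {false ∷ true ∷ false ∷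
          false ∷ []} refl (refl ∷ refl ∷ refl ∷ refl ∷ []) h)

        xw≤u : t1001 ≤ u
        xw≤u = ≮⇒≥ λ h → <⇒≱ z-large (heavy-light₁′ {true ∷ false ∷ false ∷ true ∷ []} {false ∷ true ∷ false ∷
          false ∷ []} refl (refl ∷ refl ∷ refl ∷ refl ∷ []) h)

        zw≤u : t0011 ≤ u
        zw≤u = ≮⇒≥ λ h → <⇒≱ x-large (heavy-light₁′ {true ∷ true ∷ false ∷ false ∷ []} {false ∷ false ∷ false ∷
          true ∷ []} refl (refl ∷ refl ∷ refl ∷ refl ∷ []) h)

        yz≤u : t0110 ≤ u
        yz≤u = ≮⇒≥ λ h → <⇒≱ x-large (heavy-light₁′ {false ∷ true ∷ true ∷ false ∷ []} {false ∷ false ∷ false ∷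
          true ∷ []} refl (refl ∷ refl ∷ refl ∷ refl ∷ []) h)

        x-bound : 5 * u ≤ t1000 + 3 * v
        x-bound = entail (u ∷ v ∷ t1100 ∷ t1001 ∷ t1000 ∷ [])
          1 (5 ⊗ # 0) (# 4 ⊕ 3 ⊗ # 1)
          ((1 ∙ 7 ⊗ # 0 ≼ # 4 ⊕ # 3 ⊕ # 2 ⊕ 3 ⊗ # 1 by without-z) ∷ (1 ∙ # 3 ≼ # 0 by xw≤u) ∷
           (1 ∙ # 2 ≼ # 0 by xy≤u) ∷ []) refl

        z-bound : 5 * u ≤ t0010 + 3 * v
        z-bound = entail (u ∷ v ∷ t0110 ∷ t0011 ∷ t0010 ∷ [])
          1 (5 ⊗ # 0) (# 4 ⊕ 3 ⊗ # 1)
          ((1 ∙ 7 ⊗ # 0 ≼ # 4 ⊕ # 2 ⊕ # 3 ⊕ 3 ⊗ # 1 by without-x) ∷ (1 ∙ # 2 ≼ # 0 by yz≤u) ∷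
           (1 ∙ # 3 ≼ # 0 by zw≤u) ∷ []) refl

        A B : Subset 4
        A = false ∷ false ∷ false ∷ true ∷ []
        B = false ∷ true ∷ false ∷ false ∷ []

        result : Triangle F
        result with first (mask V) (subst (0 <_) (sym (size-mask V distinct))
          (≤-trans (n≤1+n 1) (room (n≤1+n 4))))
        -- Stability makes one of the two singleton traces small outside p; the part through p is
        -- then heavy and makes the other trace small outside p as well. Which trace comes first is
        -- open, hence the two symmetric cases.
        ... | p , fp = finish (stable-first uniform intersecting V distinct {A} {B} (refl ∷ refl ∷ refl ∷ refl ∷
              [])
                (λ x<y mx my → trace-stable F V A (fresh mx) (fresh my) (stable x<y mx my)) p fp)
          where
          p♯ : p ♯ V
          p♯ = fresh (proj₁ fp)

          V₅ : Vec (Fin n) 5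
          V₅ = p ∷ V

          light : ∀ {β γ} → size β ≡ 2 → Apart β γ → 2 * u < count (trace F V₅ β) →
            count (trace F V₅ γ) ≤ bin (n ∸ 3) k (size γ + 3)
          light {β} {γ} = heavy-light uniform intersecting V₅ (p♯ , distinct) (m≤m+n 3 2) ≤-refl {β} {γ}

          conclude : 3 * u < count (trace F V₅ (true ∷ A)) → 3 * u < count (trace F V₅ (true ∷ B)) → Triangle F
          conclude hx hz = triangle (≢-sym z≢x) (≢-sym
            (♯-head [] (♯-tail (x ∷ []) (♯-tail (y ∷ x ∷ []) (♯-tail (z ∷ y ∷ x ∷ []) p♯)))))
            (≢-sym (♯-head (y ∷ x ∷ []) (♯-tail (z ∷ y ∷ x ∷ []) p♯))) (heavy-xz xz>3u)
            (<-≤-trans hx (≤-trans (drop-inner (F ⁺ x ⁻ y ⁻ z) w false p true)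
              (≤-trans (drop-inner (F ⁺ x ⁻ y) z false p true) (drop-inner (F ⁺ x) y false p true))))
            (<-≤-trans hz (≤-trans (drop-inner (F ⁻ x ⁻ y ⁺ z) w false p true) (count-mono _ _ λ S →
              restrict-mono (restrict-mono
              (λ S e → proj₁ (restrict⁻ F x false S (proj₁ (restrict⁻ (F ⁻ x) y false S e)))) z true) p true
                S)))

          shrink : bin (n ∸ 5) k 3 ≤ u
          shrink = bin-shrink 3 (m≤m+n 3 2)

          finish : count (trace F V₅ (false ∷ A)) ≤ bin (n ∸ 5) k 3 ⊎
            count (trace F V₅ (false ∷ B)) ≤ bin (n ∸ 5) k 3 → Triangle F
          finish (inj₁ le) = conclude hx hz
            where
            hx : 3 * u < count (trace F V₅ (true ∷ A))
            hx = entail (u ∷ v ∷ count (trace F V A) ∷ count (trace F V₅ (true ∷ A)) ∷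
                count (trace F V₅ (false ∷ A)) ∷ [])
              35 (sucᴱ (3 ⊗ # 0)) (# 3)
              ((35 ∙ # 2 ≼ # 3 ⊕ # 4 by ≤-reflexive (count-split (trace F V A) p)) ∷
               (35 ∙ # 4 ≼ # 0 by ≤-trans le shrink) ∷ (35 ∙ 5 ⊗ # 0 ≼ # 2 ⊕ 3 ⊗ # 1 by x-bound) ∷
               (3 ∙ 35 ⊗ # 1 ≼ # 0 by 35v≤u) ∷ (32 ∙ lit 1 ≼ # 0 by u-pos) ∷ []) refl
            hz : 3 * u < count (trace F V₅ (true ∷ B))
            hz = entail (u ∷ v ∷ count (trace F V B) ∷ count (trace F V₅ (true ∷ B)) ∷
                count (trace F V₅ (false ∷ B)) ∷ [])
              35 (sucᴱ (3 ⊗ # 0)) (# 3)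
              ((35 ∙ # 2 ≼ # 3 ⊕ # 4 by ≤-reflexive (count-split (trace F V B) p)) ∷
               (35 ∙ # 4 ≼ # 1 by light {true ∷ A} {false ∷ B} refl (refl ∷ refl ∷ refl ∷ refl ∷ refl ∷ [])
                 (3u⇒2u hx)) ∷
               (35 ∙ 5 ⊗ # 0 ≼ # 2 ⊕ 3 ⊗ # 1 by z-bound) ∷ (4 ∙ 35 ⊗ # 1 ≼ # 0 by 35v≤u) ∷
               (66 ∙ lit 1 ≼ # 0 by u-pos) ∷ []) refl
          finish (inj₂ le) = conclude hx hz
            where
            hz : 3 * u < count (trace F V₅ (true ∷ B))
            hz = entail (u ∷ v ∷ count (trace F V B) ∷ count (trace F V₅ (true ∷ B)) ∷
                count (trace F V₅ (false ∷ B)) ∷ [])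
              35 (sucᴱ (3 ⊗ # 0)) (# 3)
              ((35 ∙ # 2 ≼ # 3 ⊕ # 4 by ≤-reflexive (count-split (trace F V B) p)) ∷
               (35 ∙ # 4 ≼ # 0 by ≤-trans le shrink) ∷ (35 ∙ 5 ⊗ # 0 ≼ # 2 ⊕ 3 ⊗ # 1 by z-bound) ∷
               (3 ∙ 35 ⊗ # 1 ≼ # 0 by 35v≤u) ∷ (32 ∙ lit 1 ≼ # 0 by u-pos) ∷ []) refl
            hx : 3 * u < count (trace F V₅ (true ∷ A))
            hx = entail (u ∷ v ∷ count (trace F V A) ∷ count (trace F V₅ (true ∷ A)) ∷
                count (trace F V₅ (false ∷ A)) ∷ [])
              35 (sucᴱ (3 ⊗ # 0)) (# 3)
              ((35 ∙ # 2 ≼ # 3 ⊕ # 4 by ≤-reflexive (count-split (trace F V A) p)) ∷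
               (35 ∙ # 4 ≼ # 1 by light {true ∷ B} {false ∷ A} refl (refl ∷ refl ∷ refl ∷ refl ∷ refl ∷ [])
                 (3u⇒2u hz)) ∷
               (35 ∙ 5 ⊗ # 0 ≼ # 2 ⊕ 3 ⊗ # 1 by x-bound) ∷ (4 ∙ 35 ⊗ # 1 ≼ # 0 by 35v≤u) ∷
               (66 ∙ lit 1 ≼ # 0 by u-pos) ∷ []) refl

      triangle-xz : Triangle F
      triangle-xz with 3 * u <? t1001 | 3 * u <? t0110
      ... | yes h | _ = xw-heavy h
      ... | no _ | yes h = yz-heavy h
      ... | no h | no h′ = Light.result (≮⇒≥ h) (≮⇒≥ h′)

-- Traces on one edge

module OneEdge {n k : ℕ} (3≤k : 3 ≤ k) (large : 36 * (k + 6) ≤ n) where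

  open Setting {n} {k} 3≤k large
  open Edges {n} {k} 3≤k large

  2u<3u : 2 * u < 3 * u
  2u<3u = m<n+m (2 * u) u-pos

  -- `stable-first` bounds the trace {x} or the trace {y} outside the first free position w. The
  -- edge is oriented so that the bounded trace is {y}.
  module Oriented {F : Fam n} (ample : Ample F) {x y : Fin n} (distinct : Distinct (y ∷ x ∷ []))
    (edge : Edge F x y)
    (stable : StableOn (mask (y ∷ x ∷ [])) F) {w : Fin n} (fw : First (mask (y ∷ x ∷ [])) w)
      (b0≤u : count (F ⁻ x ⁺ y ⁻ w) ≤ u) where

    open Ample ample

    V₂ : Vec (Fin n) 2
    V₂ = y ∷ x ∷ []

    V₃ : Vec (Fin n) 3
    V₃ = w ∷ V₂

    w♯ : w ♯ V₂
    w♯ = fresh (proj₁ fw)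

    distinct₃ : Distinct V₃
    distinct₃ = w♯ , distinct

    y≢x : y ≢ x
    y≢x = ♯-head [] (proj₁ distinct)

    w≢x : w ≢ x
    w≢x = ♯-head [] (♯-tail (x ∷ []) w♯)

    w≢y : w ≢ y
    w≢y = ♯-head (x ∷ []) w♯

    -- The letters a, b, c, e stand for x only, y only, both and neither; the digit tells whether w
    -- belongs to the members.
    a1 a0 b1 b0 c1 c0 e1 e0 : ℕ
    a1 = count (F ⁺ x ⁻ y ⁺ w)
    a0 = count (F ⁺ x ⁻ y ⁻ w)
    b1 = count (F ⁻ x ⁺ y ⁺ w)
    b0 = count (F ⁻ x ⁺ y ⁻ w)
    c1 = count (F ⁺ x ⁺ y ⁺ w)
    c0 = count (F ⁺ x ⁺ y ⁻ w)
    e1 = count (F ⁻ x ⁻ y ⁺ w)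
    e0 = count (F ⁻ x ⁻ y ⁻ w)

    expand : count F ≡ ((c1 + c0) + (a1 + a0)) + ((b1 + b0) + (e1 + e0))
    expand = trans (count-split-pair F x y) (cong₂ _+_
      (cong₂ _+_ (count-split (F ⁺ x ⁺ y) w) (count-split (F ⁺ x ⁻ y) w))
      (cong₂ _+_ (count-split (F ⁻ x ⁺ y) w) (count-split (F ⁻ x ⁻ y) w)))

    expand-x : count (F ⁻ x) ≡ (b1 + b0) + (e1 + e0)
    expand-x = count-split-pair (F ⁻ x) y w

    expand-y : count (F ⁻ y) ≡ (a1 + a0) + (e1 + e0)
    expand-y = trans (count-split₂ F y false x) (cong₂ _+_ (count-split (F ⁺ x ⁻ y) w)
      (count-split (F ⁻ x ⁻ y) w))

    c1≤u : c1 ≤ u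
    c1≤u = count-triple uniform intersecting (≢-sym y≢x) (≢-sym w≢x) (≢-sym w≢y)

    light : ∀ {β γ} → size β ≡ 2 → Apart β γ → 2 * u < count (trace F V₃ β) →
      count (trace F V₃ γ) ≤ bin (n ∸ 3) k (size γ + 3)
    light {β} {γ} = heavy-light uniform intersecting V₃ distinct₃ ≤-refl (m≤m+n 3 2) {β} {γ}

    b1-a0 : 2 * u < b1 → a0 ≤ v
    b1-a0 = light {true ∷ true ∷ false ∷ []} {false ∷ false ∷ true ∷ []} refl (refl ∷ refl ∷ refl ∷ [])

    b1-e0 : 2 * u < b1 → e0 ≤ u
    b1-e0 = light {true ∷ true ∷ false ∷ []} {false ∷ false ∷ false ∷ []} refl (refl ∷ refl ∷ refl ∷ [])

    c0-e1 : 2 * u < c0 → e1 ≤ v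
    c0-e1 = light {false ∷ true ∷ true ∷ []} {true ∷ false ∷ false ∷ []} refl (refl ∷ refl ∷ refl ∷ [])

    c0-e0 : 2 * u < c0 → e0 ≤ u
    c0-e0 = light {false ∷ true ∷ true ∷ []} {false ∷ false ∷ false ∷ []} refl (refl ∷ refl ∷ refl ∷ [])

    a1-e0 : 2 * u < a1 → e0 ≤ u
    a1-e0 = light {true ∷ false ∷ true ∷ []} {false ∷ false ∷ false ∷ []} refl (refl ∷ refl ∷ refl ∷ [])

    heavy-xw : 3 * u < a1 → Heavy F x w
    heavy-xw lt = <-≤-trans lt (drop-inner (F ⁺ x) y false w true)

    drop-x : ∀ S → (F ⁻ x) S ≡ true → F S ≡ true
    drop-x S e = proj₁ (restrict⁻ F x false S e)

    -- All traces disjoint from {y, w} are light. So the members avoiding w concentrate on {x, y},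
    -- and then those avoiding y on {x, w}.
    b1-large : 3 * u < b1 → Triangle F
    b1-large b1>3u = triangle (≢-sym y≢x) (≢-sym w≢x) (≢-sym w≢y)
      (<-≤-trans (≤-<-trans ≤-refl c0>3u) (count-restrict (F ⁺ x ⁺ y) w false)) (heavy-xw a1>3u)
      (<-≤-trans b1>3u (count-mono _ _ λ S → restrict-mono (restrict-mono drop-x y true) w true S))
      where
      c0>3u : 3 * u < c0
      c0>3u = entail (u ∷ v ∷ count (F ⁻ w) ∷ a0 ∷ b0 ∷ c0 ∷ e0 ∷ [])
        35 (sucᴱ (3 ⊗ # 0)) (# 5)
        ((35 ∙ # 2 ≼ # 5 ⊕ # 3 ⊕ (# 4 ⊕ # 6) by ≤-reflexive (count-split-inner F x y w false)) ∷
         (35 ∙ # 4 ≼ # 0 by b0≤u) ∷ (35 ∙ 9 ⊗ # 0 ≼ # 2 by spread w) ∷ (1 ∙ 35 ⊗ # 1 ≼ # 0 by 35v≤u) ∷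
         (139 ∙ lit 1 ≼ # 0 by u-pos) ∷ (35 ∙ # 3 ≼ # 1 by b1-a0 (<-trans 2u<3u b1>3u)) ∷
         (35 ∙ # 6 ≼ # 0 by b1-e0 (<-trans 2u<3u b1>3u)) ∷ []) refl
      a1>3u : 3 * u < a1
      a1>3u = entail (u ∷ v ∷ count (F ⁻ y) ∷ a1 ∷ a0 ∷ e1 ∷ e0 ∷ [])
        35 (sucᴱ (3 ⊗ # 0)) (# 3)
        ((35 ∙ # 2 ≼ # 3 ⊕ # 4 ⊕ (# 5 ⊕ # 6) by ≤-reflexive expand-y) ∷ (35 ∙ 9 ⊗ # 0 ≼ # 2 by spread y) ∷
         (2 ∙ 35 ⊗ # 1 ≼ # 0 by 35v≤u) ∷ (173 ∙ lit 1 ≼ # 0 by u-pos) ∷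
         (35 ∙ # 4 ≼ # 1 by b1-a0 (<-trans 2u<3u b1>3u)) ∷ (35 ∙ # 6 ≼ # 0 by b1-e0 (<-trans 2u<3u b1>3u)) ∷
         (35 ∙ # 5 ≼ # 1 by c0-e1 (<-trans 2u<3u c0>3u)) ∷ []) refl

    module _ (b1≤3u : b1 ≤ 3 * u) where

      c0≤2u : c0 ≤ 2 * u
      c0≤2u = ≮⇒≥ λ h → (refute (u ∷ v ∷ count (F ⁻ x) ∷ b1 ∷ b0 ∷ e1 ∷ e0 ∷ [])
        ((35 ∙ # 2 ≼ # 3 ⊕ # 4 ⊕ (# 5 ⊕ # 6) by ≤-reflexive expand-x) ∷ (35 ∙ # 4 ≼ # 0 by b0≤u) ∷
         (35 ∙ 9 ⊗ # 0 ≼ # 2 by spread x) ∷ (1 ∙ 35 ⊗ # 1 ≼ # 0 by 35v≤u) ∷ (139 ∙ lit 1 ≼ # 0 by u-pos) ∷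
         (35 ∙ # 3 ≼ 3 ⊗ # 0 by b1≤3u) ∷ (35 ∙ # 5 ≼ # 1 by c0-e1 h) ∷ (35 ∙ # 6 ≼ # 0 by c0-e0 h) ∷ []) refl)

      module _ {w′ : Fin n} (fw′ : First (mask V₃) w′) where

        V₄ : Vec (Fin n) 4
        V₄ = w′ ∷ V₃

        w′♯ : w′ ♯ V₃
        w′♯ = fresh (proj₁ fw′)

        w′≢w : w′ ≢ w
        w′≢w = ♯-head V₂ w′♯

        w′≢x : w′ ≢ x
        w′≢x = ♯-head [] (♯-tail (x ∷ []) (♯-tail V₂ w′♯))

        a01 a00 e11 e10 : ℕ
        a01 = count (F ⁺ x ⁻ y ⁻ w ⁺ w′)
        a00 = count (F ⁺ x ⁻ y ⁻ w ⁻ w′)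
        e11 = count (F ⁻ x ⁻ y ⁺ w ⁺ w′)
        e10 = count (F ⁻ x ⁻ y ⁺ w ⁻ w′)

        light₄ : ∀ {β γ} → size β ≡ 2 → Apart β γ → 2 * u < count (trace F V₄ β) →
          count (trace F V₄ γ) ≤ bin (n ∸ 3) k (size γ + 3)
        light₄ {β} {γ} = heavy-light uniform intersecting V₄ (w′♯ , distinct₃) (n≤1+n 3) (n≤1+n 4) {β} {γ}

        -- Of the members avoiding w, at least 5 u meet the three points in x alone; of those
        -- avoiding x, at least 4 u meet them in w alone. The next free position w′ is joined to
        -- both by `stable-first`.
        a1-large : 3 * u < a1 → Triangle F
        a1-large a1>3u = finish (stable-first uniform intersecting V₃ distinct₃ {false ∷ false ∷ true ∷ []}
          {true ∷ false ∷ false ∷ []} (refl ∷ refl ∷ refl ∷ [])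
            (λ p<q mp mq → trace-stable F V₃ (false ∷ false ∷ true ∷ []) (fresh mp) (fresh mq)
              (stable p<q (free (♯-tail V₂ (fresh mp))) (free (♯-tail V₂ (fresh mq))))) w′ fw′)
          where
          a0≥5u : 5 * u ≤ a0
          a0≥5u = entail (u ∷ count (F ⁻ w) ∷ a0 ∷ b0 ∷ c0 ∷ e0 ∷ [])
            1 (5 ⊗ # 0) (# 2)
            ((1 ∙ # 1 ≼ # 4 ⊕ # 2 ⊕ (# 3 ⊕ # 5) by ≤-reflexive (count-split-inner F x y w false)) ∷
             (1 ∙ # 3 ≼ # 0 by b0≤u) ∷ (1 ∙ 9 ⊗ # 0 ≼ # 1 by spread w) ∷ (1 ∙ # 4 ≼ 2 ⊗ # 0 by c0≤2u) ∷
             (1 ∙ # 5 ≼ # 0 by a1-e0 (<-trans 2u<3u a1>3u)) ∷ []) refl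
          e1≥4u : 4 * u ≤ e1
          e1≥4u = entail (u ∷ count (F ⁻ x) ∷ b1 ∷ b0 ∷ e1 ∷ e0 ∷ [])
            1 (4 ⊗ # 0) (# 4)
            ((1 ∙ # 1 ≼ # 2 ⊕ # 3 ⊕ (# 4 ⊕ # 5) by ≤-reflexive expand-x) ∷ (1 ∙ # 3 ≼ # 0 by b0≤u) ∷
             (1 ∙ 9 ⊗ # 0 ≼ # 1 by spread x) ∷ (1 ∙ # 2 ≼ 3 ⊗ # 0 by b1≤3u) ∷
             (1 ∙ # 5 ≼ # 0 by a1-e0 (<-trans 2u<3u a1>3u)) ∷ []) refl
          e10≤v : 2 * u < a01 → e10 ≤ v
          e10≤v = light₄ {true ∷ false ∷ false ∷ true ∷ []} {false ∷ true ∷ false ∷ false ∷ []} refl (refl ∷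
            refl ∷ refl ∷ refl ∷ [])
          a00≤v : 2 * u < e11 → a00 ≤ v
          a00≤v = light₄ {true ∷ true ∷ false ∷ false ∷ []} {false ∷ false ∷ false ∷ true ∷ []} refl (refl ∷
            refl ∷ refl ∷ refl ∷ [])
          conclude : 3 * u < a01 → Triangle F
          conclude a01>3u = triangle (≢-sym w≢x) (≢-sym w′≢x) (≢-sym w′≢w) (heavy-xw a1>3u)
            (<-≤-trans a01>3u (≤-trans (drop-inner (F ⁺ x ⁻ y) w false w′ true)
              (drop-inner (F ⁺ x) y false w′ true)))
            (<-≤-trans e11>3u (count-mono _ _ λ S → restrict-mono (restrict-mono
              (λ S e → drop-x S (proj₁ (restrict⁻ (F ⁻ x) y false S e))) w true) w′ true S))
            where
            e11>3u : 3 * u < e11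
            e11>3u = entail (u ∷ v ∷ e1 ∷ e11 ∷ e10 ∷ [])
              35 (sucᴱ (3 ⊗ # 0)) (# 3)
              ((35 ∙ # 2 ≼ # 3 ⊕ # 4 by ≤-reflexive (count-split (F ⁻ x ⁻ y ⁺ w) w′)) ∷
               (35 ∙ 4 ⊗ # 0 ≼ # 2 by e1≥4u) ∷ (35 ∙ # 4 ≼ # 1 by e10≤v (<-trans 2u<3u a01>3u)) ∷
               (1 ∙ 35 ⊗ # 1 ≼ # 0 by 35v≤u) ∷ (34 ∙ lit 1 ≼ # 0 by u-pos) ∷ []) refl
          finish : a00 ≤ bin (n ∸ 4) k 3 ⊎ e10 ≤ bin (n ∸ 4) k 3 → Triangle F
          finish (inj₁ le) = conclude (entail (u ∷ a0 ∷ a01 ∷ a00 ∷ [])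
            1 (sucᴱ (3 ⊗ # 0)) (# 2)
            ((1 ∙ # 1 ≼ # 2 ⊕ # 3 by ≤-reflexive (count-split (F ⁺ x ⁻ y ⁻ w) w′)) ∷
             (1 ∙ 5 ⊗ # 0 ≼ # 1 by a0≥5u) ∷ (1 ∙ # 3 ≼ # 0 by ≤-trans le (bin-shrink 3 (n≤1+n 3))) ∷
             (1 ∙ lit 1 ≼ # 0 by u-pos) ∷ []) refl)
          finish (inj₂ le) = conclude (entail (u ∷ v ∷ a0 ∷ a01 ∷ a00 ∷ [])
            35 (sucᴱ (3 ⊗ # 0)) (# 3)
            ((35 ∙ # 2 ≼ # 3 ⊕ # 4 by ≤-reflexive (count-split (F ⁺ x ⁻ y ⁻ w) w′)) ∷
             (35 ∙ 5 ⊗ # 0 ≼ # 2 by a0≥5u) ∷ (35 ∙ # 4 ≼ # 1 by a00≤v e11>2u) ∷ (1 ∙ 35 ⊗ # 1 ≼ # 0 by 35v≤u) ∷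
             (69 ∙ lit 1 ≼ # 0 by u-pos) ∷ []) refl)
            where
            e11>2u : 2 * u < e11
            e11>2u = entail (u ∷ e1 ∷ e11 ∷ e10 ∷ [])
              1 (sucᴱ (2 ⊗ # 0)) (# 2)
              ((1 ∙ # 1 ≼ # 2 ⊕ # 3 by ≤-reflexive (count-split (F ⁻ x ⁻ y ⁺ w) w′)) ∷
               (1 ∙ 4 ⊗ # 0 ≼ # 1 by e1≥4u) ∷ (1 ∙ # 3 ≼ # 0 by ≤-trans le (bin-shrink 3 (n≤1+n 3))) ∷
               (1 ∙ lit 1 ≼ # 0 by u-pos) ∷ []) refl

        A E : Subset 2
        A = false ∷ true ∷ []
        E = false ∷ false ∷ []

        w<w′ : toℕ w < toℕ w′
        w<w′ = ≤∧≢⇒< (≮⇒≥ λ lt → true≢false (free (♯-tail V₂ w′♯)) (proj₂ fw w′ lt)) (λ eq →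
          w′≢w (sym (toℕ-injective eq)))

        a01≤a1 : a01 ≤ a1
        a01≤a1 = ≤-trans (stable-count (<⇒≢ᶠ w<w′) (trace F V₂ A)
          (trace-stable F V₂ A w♯ (♯-tail V₂ w′♯) (stable w<w′ (free w♯) (free (♯-tail V₂ w′♯)))))
          (count-restrict (F ⁺ x ⁻ y ⁺ w) w′ false)

        -- By stability `a01` is at most `a1`. In the first case of `stable-first₂` this caps |F| at
        -- u + 2 u + 3 u + 4 u + 3 u + u + 9 u = 23 u, below 35 u; in the second case |F(x̄)| falls
        -- below 9 u.
        a1-small : a1 ≤ 3 * u → ⊥
        a1-small a1≤3u = finish (stable-first₂ uniform intersecting V₂ distinct {A} {E} (refl ∷ refl ∷ [])
            (λ p<q mp mq → trace-stable F V₂ A (fresh mp) (fresh mq) (stable p<q mp mq)) w w′ fw fw′)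
          where
          finish : a00 ≤ bin (n ∸ 4) k 3 ⊎ count (F ⁻ x ⁻ y) ≤ bin (n ∸ 2) k 3 → ⊥
          finish (inj₁ le) = refute (u ∷ count F ∷ count (F ⁻ x ⁻ y) ∷ a1 ∷ a0 ∷ b1 ∷ b0 ∷ c1 ∷ c0 ∷ e1 ∷ e0 ∷
              a01 ∷ a00 ∷ [])
            ((1 ∙ # 1 ≼ # 7 ⊕ # 8 ⊕ (# 3 ⊕ # 4) ⊕ (# 5 ⊕ # 6 ⊕ (# 9 ⊕ # 10)) by ≤-reflexive expand) ∷
             (1 ∙ # 9 ⊕ # 10 ≼ # 2 by ≡⇒≥ (count-split (F ⁻ x ⁻ y) w)) ∷ (1 ∙ # 7 ≼ # 0 by c1≤u) ∷
             (1 ∙ # 6 ≼ # 0 by b0≤u) ∷ (1 ∙ 35 ⊗ # 0 ≼ # 1 by many) ∷ (1 ∙ sucᴱ (# 2) ≼ 9 ⊗ # 0 by edge) ∷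
             (12 ∙ lit 1 ≼ # 0 by u-pos) ∷ (1 ∙ # 5 ≼ 3 ⊗ # 0 by b1≤3u) ∷ (1 ∙ # 8 ≼ 2 ⊗ # 0 by c0≤2u) ∷
             (2 ∙ # 3 ≼ 3 ⊗ # 0 by a1≤3u) ∷ (1 ∙ # 11 ≼ # 3 by a01≤a1) ∷
             (1 ∙ # 4 ≼ # 11 ⊕ # 12 by ≤-reflexive (count-split (F ⁺ x ⁻ y ⁻ w) w′)) ∷
             (1 ∙ # 12 ≼ # 0 by ≤-trans le (bin-shrink 3 (n≤1+n 3))) ∷ []) refl
          finish (inj₂ le) = refute (u ∷ v ∷ count (F ⁻ x) ∷ count (F ⁻ x ⁻ y) ∷ b1 ∷ b0 ∷ e1 ∷ e0 ∷ [])
            ((35 ∙ # 2 ≼ # 4 ⊕ # 5 ⊕ (# 6 ⊕ # 7) by ≤-reflexive expand-x) ∷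
             (35 ∙ # 6 ⊕ # 7 ≼ # 3 by ≡⇒≥ (count-split (F ⁻ x ⁻ y) w)) ∷ (35 ∙ # 5 ≼ # 0 by b0≤u) ∷
             (35 ∙ 9 ⊗ # 0 ≼ # 2 by spread x) ∷ (1 ∙ 35 ⊗ # 1 ≼ # 0 by 35v≤u) ∷ (139 ∙ lit 1 ≼ # 0 by u-pos) ∷
             (35 ∙ # 4 ≼ 3 ⊗ # 0 by b1≤3u) ∷ (35 ∙ # 3 ≼ # 0 ⊕ # 1 by ≤-trans le (≤-reflexive bin-2-3)) ∷ [])
               refl

    result : Triangle F
    result with 3 * u <? b1
    ... | yes h = b1-large h
    ... | no h with first (mask V₃) (subst (0 <_) (sym (size-mask V₃ distinct₃))
          (≤-trans (n≤1+n 1) (room (m≤m+n 3 2))))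
    ...   | w′ , fw′ with 3 * u <? a1
    ...     | yes h′ = a1-large (≮⇒≥ h) fw′ h′
    ...     | no h′ = ⊥-elim (a1-small (≮⇒≥ h) fw′ (≮⇒≥ h′))

  distinct-pair : ∀ {x y : Fin n} → x ≢ y → Distinct (y ∷ x ∷ [])
  distinct-pair x≢y = ♯∷ (≢-sym x≢y) ♯[] , ♯[] , tt

  one-edge : ∀ {F : Fam n} → Ample F → ∀ {x y : Fin n} → x ≢ y → Edge F x y → StableOn (mask (y ∷ x ∷ [])) F →
    Triangle F
  one-edge {F} ample {x} {y} x≢y edge stable
    with first (mask (y ∷ x ∷ [])) (subst (0 <_) (sym (size-mask (y ∷ x ∷ []) (distinct-pair x≢y)))
      (≤-trans (n≤1+n 1) (room (m≤m+n 2 3))))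
  ... | w , fw with stable-first (Ample.uniform ample) (Ample.intersecting ample) (y ∷ x ∷ [])
        (distinct-pair x≢y)
                      {false ∷ true ∷ []} {true ∷ false ∷ []} (refl ∷ refl ∷ [])
                      (λ p<q mp mq → trace-stable F (y ∷ x ∷ []) (false ∷ true ∷ []) (fresh mp) (fresh mq)
                        (stable p<q mp mq)) w fw
  ...   | inj₂ le = Oriented.result ample (distinct-pair x≢y) edge stable fw le
  ...   | inj₁ le = Oriented.result ample (distinct-pair (≢-sym x≢y))
            (subst (_< 9 * u) (count-restrict-comm F x false y false) edge)
            (subst (λ M → StableOn M F) mask-swap stable) (subst (λ M → First M w) mask-swap fw)
            (subst (_≤ u) (count-cong (restrict-cong (restrict-comm F x true y false) w false)) le)
    where
    mask-swap : mask (y ∷ x ∷ []) ≡ mask (x ∷ y ∷ [])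
    mask-swap = []≔-commutes (replicate n true) x y x≢y

-- Every ample family has a heavy triangle

compress-fixes : ∀ {n} (x y : Fin n) (F : Fam n) b S → lookup S x ≡ b → lookup S y ≡ b → compress x y F S ≡ F S
compress-fixes x y F true S ex ey rewrite ex | ey = refl
compress-fixes x y F false S ex ey rewrite ex | ey = refl

count-compress-fixed : ∀ {n} (x y : Fin n) (F : Fam n) b →
  count (restrict (restrict (compress x y F) x b) y b) ≡ count (restrict (restrict F x b) y b)
count-compress-fixed x y F b = ≤-antisym
  (count-mono _ _ λ S e → let (e₁ , sy) = restrict⁻ (restrict (compress x y F) x b) y b S e ; (e₂ , sx) = restrict⁻ (compress x y F) x b S e₁ in
    restrict⁺ (restrict F x b) y b S (restrict⁺ F x b S (trans (sym (compress-fixes x y F b S sx sy)) e₂) sx)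
      sy)
  (count-mono _ _ λ S e → let (e₁ , sy) = restrict⁻ (restrict F x b) y b S e ; (e₂ , sx) = restrict⁻ F x b S e₁ in
    restrict⁺ (restrict (compress x y F) x b) y b S
      (restrict⁺ (compress x y F) x b S (trans (compress-fixes x y F b S sx sy) e₂) sx) sy)

count-compress-moved : ∀ {n} {x y : Fin n} → x ≢ y → (F : Fam n) →
  count (compress x y F ⁺ x ⁻ y) + count (compress x y F ⁻ x ⁺ y) ≡ count (F ⁺ x ⁻ y) + count (F ⁻ x ⁺ y)
count-compress-moved {x = x} {y} x≢y F = +-cancelˡ-≡ (count (F ⁺ x ⁺ y) + count (F ⁻ x ⁻ y)) _ _ (begin
  (count (F ⁺ x ⁺ y) + count (F ⁻ x ⁻ y)) + (count (K ⁺ x ⁻ y) + count (K ⁻ x ⁺ y)) ≡⟨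
    cong₂ (λ s t → (s + t) + (count (K ⁺ x ⁻ y) + count (K ⁻ x ⁺ y))) (count-compress-fixed x y F true)
      (count-compress-fixed x y F false) ⟨
  (count (K ⁺ x ⁺ y) + count (K ⁻ x ⁻ y)) + (count (K ⁺ x ⁻ y) + count (K ⁻ x ⁺ y)) ≡⟨
    rearrange (count (K ⁺ x ⁺ y)) _ _ _ ⟩
  (count (K ⁺ x ⁺ y) + count (K ⁺ x ⁻ y)) + (count (K ⁻ x ⁺ y) + count (K ⁻ x ⁻ y)) ≡⟨ count-split-pair K x y ⟨
  count K ≡⟨ count-compress x≢y F ⟩
  count F ≡⟨ count-split-pair F x y ⟩
  (count (F ⁺ x ⁺ y) + count (F ⁺ x ⁻ y)) + (count (F ⁻ x ⁺ y) + count (F ⁻ x ⁻ y)) ≡⟨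
    rearrange (count (F ⁺ x ⁺ y)) _ _ _ ⟨
  (count (F ⁺ x ⁺ y) + count (F ⁻ x ⁻ y)) + (count (F ⁺ x ⁻ y) + count (F ⁻ x ⁺ y)) ∎)
  where
  open ≡-Reasoning
  K = compress x y F
  rearrange : ∀ a b c d → (a + b) + (c + d) ≡ (a + c) + (d + b)
  rearrange = solve-∀

cover : ∀ {n} → Fam n → Fin n → Fin n → Fam n
cover F x y S = F S ∧ (lookup S x ∨ lookup S y)

count-cover : ∀ {n} (F : Fam n) x y → count F ≡ count (cover F x y) + count (F ⁻ x ⁻ y)
count-cover F x y = trans (total-cong λ S → pointwise (F S) (lookup S x) (lookup S y))
  (total-+ (bit ∘ cover F x y) (bit ∘ (F ⁻ x ⁻ y)))
  where
  pointwise : ∀ p q r → bit p ≡ bit (p ∧ (q ∨ r)) + bit ((p ∧ not q) ∧ not r)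
  pointwise false q r = refl
  pointwise true true r = refl
  pointwise true false true = refl
  pointwise true false false = refl

count-cover-≤ : ∀ {n} (F : Fam n) x y → count (cover F x y) ≤ count (F ⁺ x) + count (F ⁺ y)
count-cover-≤ F x y = ≤-trans (total-mono λ S → pointwise (F S) (lookup S x) (lookup S y))
  (≤-reflexive (total-+ (bit ∘ (F ⁺ x)) (bit ∘ (F ⁺ y))))
  where
  pointwise : ∀ p q r → bit (p ∧ (q ∨ r)) ≤ bit (p ∧ q) + bit (p ∧ r)
  pointwise false q r = z≤n
  pointwise true true r = s≤s z≤n
  pointwise true false r = ≤-refl

cover-member : ∀ {n} (F : Fam n) x y S → cover F x y S ≡ true → F S ≡ true
cover-member F x y S e = proj₁ (∧-true {F S} e)

count-cover-restrict : ∀ {n} (F : Fam n) x y z b →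
  count (restrict (cover F x y) z b) ≤ count (cover (restrict F z b) x y)
count-cover-restrict F x y z b = count-mono _ _ λ S e → let (e₁ , sz) = restrict⁻ (cover F x y) z b S e ; (e₂ , c) = ∧-true {F S} e₁ in
  cong₂ _∧_ (restrict⁺ F z b S e₂ sz) c

module Triangles {n k : ℕ} (3≤k : 3 ≤ k) (large : 36 * (k + 6) ≤ n) where

  open Setting {n} {k} 3≤k large
  open Edges {n} {k} 3≤k large
  open OneEdge {n} {k} 3≤k large

  module _ {F : Fam n} (ample : Ample F) where

    open Ample ample

    pair-cover : ∀ {a b x y : Fin n} → a ≢ b → a ≢ x → a ≢ y → b ≢ x → b ≢ y →
      count (cover (F ⁺ a ⁺ b) x y) ≤ 2 * u
    pair-cover {a} {b} {x} {y} a≢b a≢x a≢y b≢x b≢y = ≤-trans (count-cover-≤ (F ⁺ a ⁺ b) x y)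
      (≤-trans (+-mono-≤ (count-triple uniform intersecting a≢b a≢x b≢x)
        (count-triple uniform intersecting a≢b a≢y b≢y))
        (≤-reflexive (cong (u +_) (sym (+-identityʳ u)))))

    single-cover : ∀ {a z w x y : Fin n} → a ≢ z → a ≢ w → a ≢ x → a ≢ y → z ≢ x → z ≢ y → w ≢ x → w ≢ y →
      count (cover (cover (F ⁺ a) x y) z w) ≤ 4 * u
    single-cover {a} {z} {w} {x} {y} a≢z a≢w a≢x a≢y z≢x z≢y w≢x w≢y = ≤-trans
      (count-cover-≤ (cover (F ⁺ a) x y) z w)
      (≤-trans (+-mono-≤ (≤-trans (count-cover-restrict (F ⁺ a) x y z true) (pair-cover a≢z a≢x a≢y z≢x z≢y))
                         (≤-trans (count-cover-restrict (F ⁺ a) x y w true) (pair-cover a≢w a≢x a≢y w≢x w≢y)))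
        (≤-reflexive (sym (*-distribʳ-+ u 2 2))))

    three-edges : ∀ {x y z w p q : Fin n} → z ≢ x → z ≢ y → w ≢ x → w ≢ y →
      p ≢ z → p ≢ w → p ≢ x → p ≢ y → q ≢ z → q ≢ w → q ≢ x → q ≢ y → Edge F x y → Edge F z w → Edge F p q → ⊥
    three-edges {x} {y} {z} {w} {p} {q} z≢x z≢y w≢x w≢y p≢z p≢w p≢x p≢y q≢z q≢w q≢x q≢y exy ezw epq =
      (refute (u ∷ count F ∷ count F₁ ∷ count F₂ ∷ count F₃ ∷ count (F ⁻ x ⁻ y) ∷ count (F₁ ⁻ z ⁻ w) ∷
          count (F₂ ⁻ p ⁻ q) ∷ count (F ⁻ z ⁻ w) ∷ count (F ⁻ p ⁻ q) ∷ count (F₂ ⁺ p) ∷ count (F₂ ⁺ q) ∷ [])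
        ((1 ∙ # 1 ≼ # 2 ⊕ # 5 by ≤-reflexive (count-cover F x y)) ∷
         (1 ∙ # 2 ≼ # 3 ⊕ # 6 by ≤-reflexive (count-cover F₁ z w)) ∷
         (1 ∙ # 3 ≼ # 4 ⊕ # 7 by ≤-reflexive (count-cover F₂ p q)) ∷
         (1 ∙ # 6 ≼ # 8 by count-mono _ _ λ S → restrict-mono (restrict-mono (cover-member F x y) z false) w
           false S) ∷
         (1 ∙ # 7 ≼ # 9 by count-mono _ _ λ S → restrict-mono
           (restrict-mono (λ S e → cover-member F x y S (cover-member F₁ z w S e)) p false) q false S) ∷
         (1 ∙ sucᴱ (# 5) ≼ 9 ⊗ # 0 by exy) ∷ (1 ∙ sucᴱ (# 8) ≼ 9 ⊗ # 0 by ezw) ∷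
         (1 ∙ sucᴱ (# 9) ≼ 9 ⊗ # 0 by epq) ∷ (1 ∙ # 4 ≼ # 10 ⊕ # 11 by count-cover-≤ F₂ p q) ∷
         (1 ∙ # 10 ≼ 4 ⊗ # 0 by through p≢z p≢w p≢x p≢y) ∷ (1 ∙ # 11 ≼ 4 ⊗ # 0 by through q≢z q≢w q≢x q≢y) ∷
         (1 ∙ 35 ⊗ # 0 ≼ # 1 by many) ∷ []) refl)
      where
      F₁ F₂ F₃ : Fam n
      F₁ = cover F x y
      F₂ = cover F₁ z w
      F₃ = cover F₂ p q
      through : ∀ {a} → a ≢ z → a ≢ w → a ≢ x → a ≢ y → count (F₂ ⁺ a) ≤ 4 * u
      through {a} a≢z a≢w a≢x a≢y = ≤-trans (count-cover-restrict F₁ z w a true)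
        (≤-trans (count-mono _ _ λ S e → let (e₁ , c) = ∧-true {(F₁ ⁺ a) S} e ; (e₂ , sa) = restrict⁻ F₁ a true S e₁ ; (e₃ , c′) = ∧-true {F S} e₂ in
            cong₂ _∧_ (cong₂ _∧_ (restrict⁺ F a true S e₃ sa) c′) c)
          (single-cover a≢z a≢w a≢x a≢y z≢x z≢y w≢x w≢y))

    -- At most u + v members avoid both of the first two positions, which is less than 9 u. So these
    -- positions form an edge, and the case of one edge applies.
    zero-edges : StableOn (mask []) F → Triangle F
    zero-edges stable with first (mask []) (subst (0 <_) (sym (size-replicate n))
      (≤-trans (≤ᵇ⇒≤ 1 216 tt) 216≤n))
    ... | w , fw with first (mask (w ∷ [])) (subst (0 <_) (sym (size-mask (w ∷ []) (♯[] , tt)))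
          (≤-trans (n≤1+n 1) (room (m≤m+n 1 4))))
    ...   | w′ , fw′ = one-edge ample (≢-sym (♯-head [] (fresh (proj₁ fw′))))
            ((entail (u ∷ v ∷ count (F ⁻ w ⁻ w′) ∷ [])
              35 (sucᴱ (# 2)) (9 ⊗ # 0)
              ((35 ∙ # 2 ≼ # 0 ⊕ # 1 by ≤-trans (stable-both-first uniform intersecting stable w w′ fw fw′)
                (≤-reflexive bin-2-3)) ∷
               (1 ∙ 35 ⊗ # 1 ≼ # 0 by 35v≤u) ∷ (279 ∙ lit 1 ≼ # 0 by u-pos) ∷ []) refl))
            (λ {p} {q} p<q _ _ → stable p<q (lookup-replicate p true) (lookup-replicate q true))

    OffPairs : Fin n → Fin n → Fin n → Fin n → Fin n → Set
    OffPairs x y z w p = p ≢ x × p ≢ y × p ≢ z × p ≢ w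

    off-pairs : ∀ {x y z w p} → p ♯ w ∷ z ∷ y ∷ x ∷ [] → OffPairs x y z w p
    off-pairs {x} {y} {z} h = ♯-head [] (♯-tail (x ∷ []) (♯-tail (y ∷ x ∷ []) (♯-tail (z ∷ y ∷ x ∷ []) h))) ,
      ♯-head (x ∷ []) (♯-tail (y ∷ x ∷ []) (♯-tail (z ∷ y ∷ x ∷ []) h)) ,
        ♯-head (y ∷ x ∷ []) (♯-tail (z ∷ y ∷ x ∷ []) h) , ♯-head (z ∷ y ∷ x ∷ []) h

    crossing : Fin n → Fin n → Fin n → Fin n → ℕ
    crossing x y z w = count (F ⁺ x ⁻ y ⁺ z ⁻ w)

    two-edges-max : ∀ {x y z w} → x ≢ y → z ≢ x → z ≢ y → w ≢ x → w ≢ y → w ≢ z → Edge F x y → Edge F z w →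
      (∀ {p q} → toℕ p < toℕ q → OffPairs x y z w p → OffPairs x y z w q → StablePair F p q) →
      crossing x y w z ≤ crossing x y z w → crossing y x z w ≤ crossing x y z w →
        crossing y x w z ≤ crossing x y z w → Triangle F
    two-edges-max {x} {y} {z} {w} x≢y z≢x z≢y w≢x w≢y w≢z exy ezw stable m₁ m₂ m₃ =
      TwoEdges.triangle-xz ample (♯∷ w≢z (♯∷ w≢y (♯∷ w≢x ♯[])) , ♯∷ z≢y (♯∷ z≢x ♯[]) , ♯∷ (≢-sym x≢y) ♯[] ,
        ♯[] , tt) exy ezw
        (λ p<q mp mq → stable p<q (off-pairs (fresh mp)) (off-pairs (fresh mq)))
        (subst (_≤ crossing x y z w) (count-restrict-comm (F ⁺ x ⁻ y) w true z false) m₁)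
        (subst (_≤ crossing x y z w) (count-cong (restrict-cong
          (restrict-cong (restrict-comm F y true x false) z true) w false)) m₂)
        (subst (_≤ crossing x y z w) (trans (count-restrict-comm (F ⁺ y ⁻ x) w true z false)
          (count-cong (restrict-cong (restrict-cong (restrict-comm F y true x false) z false) w true))) m₃)

    two-edges : ∀ {x y z w} → x ≢ y → z ≢ x → z ≢ y → w ≢ x → w ≢ y → w ≢ z → Edge F x y → Edge F z w →
      (∀ {p q} → toℕ p < toℕ q → OffPairs x y z w p → OffPairs x y z w q → StablePair F p q) → Triangle F
    two-edges {x} {y} {z} {w} x≢y z≢x z≢y w≢x w≢y w≢z exy ezw stable =
      choose (≤-total xz xw) (≤-total yz yw) (≤-total xz yz) (≤-total xz yw) (≤-total xw yz) (≤-total xw yw)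
      where
      xz xw yz yw : ℕ
      xz = crossing x y z w
      xw = crossing x y w z
      yz = crossing y x z w
      yw = crossing y x w z
      eyx : Edge F y x
      eyx = subst (_< 9 * u) (count-restrict-comm F x false y false) exy
      ewz : Edge F w z
      ewz = subst (_< 9 * u) (count-restrict-comm F z false w false) ezw
      at-xz : xw ≤ xz → yz ≤ xz → yw ≤ xz → Triangle F
      at-xz = two-edges-max x≢y z≢x z≢y w≢x w≢y w≢z exy ezw stable
      at-xw : xz ≤ xw → yw ≤ xw → yz ≤ xw → Triangle F
      at-xw = two-edges-max x≢y w≢x w≢y z≢x z≢y (≢-sym w≢z) exy ewz
        λ { p<q (a , b , c , d) (a′ , b′ , c′ , d′) → stable p<q (a , b , d , c) (a′ , b′ , d′ , c′) }
      at-yz : yw ≤ yz → xz ≤ yz → xw ≤ yz → Triangle F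
      at-yz = two-edges-max (≢-sym x≢y) z≢y z≢x w≢y w≢x w≢z eyx ezw
        λ { p<q (a , b , c , d) (a′ , b′ , c′ , d′) → stable p<q (b , a , c , d) (b′ , a′ , c′ , d′) }
      at-yw : yz ≤ yw → xw ≤ yw → xz ≤ yw → Triangle F
      at-yw = two-edges-max (≢-sym x≢y) w≢y w≢x z≢y z≢x (≢-sym w≢z) eyx ewz
        λ { p<q (a , b , c , d) (a′ , b′ , c′ , d′) → stable p<q (b , a , d , c) (b′ , a′ , d′ , c′) }
      choose : xz ≤ xw ⊎ xw ≤ xz → yz ≤ yw ⊎ yw ≤ yz → xz ≤ yz ⊎ yz ≤ xz → xz ≤ yw ⊎ yw ≤ xz →
        xw ≤ yz ⊎ yz ≤ xw → xw ≤ yw ⊎ yw ≤ xw → Triangle F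
      choose (inj₁ a≤b) (inj₁ c≤d) _ _ _ (inj₁ b≤d) = at-yw c≤d b≤d (≤-trans a≤b b≤d)
      choose (inj₁ a≤b) (inj₁ c≤d) _ _ _ (inj₂ d≤b) = at-xw a≤b d≤b (≤-trans c≤d d≤b)
      choose (inj₁ a≤b) (inj₂ d≤c) _ _ (inj₁ b≤c) _ = at-yz d≤c (≤-trans a≤b b≤c) b≤c
      choose (inj₁ a≤b) (inj₂ d≤c) _ _ (inj₂ c≤b) _ = at-xw a≤b (≤-trans d≤c c≤b) c≤b
      choose (inj₂ b≤a) (inj₁ c≤d) _ (inj₁ a≤d) _ _ = at-yw c≤d (≤-trans b≤a a≤d) a≤d
      choose (inj₂ b≤a) (inj₁ c≤d) _ (inj₂ d≤a) _ _ = at-xz b≤a (≤-trans c≤d d≤a) d≤a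
      choose (inj₂ b≤a) (inj₂ d≤c) (inj₁ a≤c) _ _ _ = at-yz d≤c a≤c (≤-trans b≤a a≤c)
      choose (inj₂ b≤a) (inj₂ d≤c) (inj₂ c≤a) _ _ _ = at-xz b≤a c≤a (≤-trans d≤c c≤a)

  -- Pairs that avoid x have no more members in K than in F, so their heaviness pulls back at once.
  -- The work lies in the triangles through x, where rigidity in K is played against the spread of
  -- F.
  module Uncompress {F : Fam n} (ample : Ample F) {x y : Fin n} (x≢y : x ≢ y) where

    open Ample ample

    K : Fam n
    K = compress x y F

    open Outside {K} (compress-uniform x≢y uniform) (compress-cross x≢y intersecting)

    count-back : ∀ {a b} → a ≢ x → b ≢ x → a ≢ b → a ≢ y → count (K ⁺ a ⁺ b) ≤ count (F ⁺ a ⁺ b)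
    count-back {a} {b} a≢x b≢x a≢b a≢y = ≤-trans
      (≤-reflexive (count-cong (restrict-cong (compress-restrict x≢y F a≢x a≢y true) b true))) (last (b ≟ y))
      where
      last : Dec (b ≡ y) → count (compress x y (F ⁺ a) ⁺ b) ≤ count (F ⁺ a ⁺ b)
      last (yes refl) = count-compress-⁺ x≢y (F ⁺ a)
      last (no b≢y) = ≤-reflexive (count-compress-restrict x≢y b≢x b≢y (F ⁺ a) true)

    heavy-back : ∀ {a b} → a ≢ x → b ≢ x → a ≢ b → Heavy K a b → Heavy F a b
    heavy-back {a} {b} a≢x b≢x a≢b h with a ≟ y
    ... | no a≢y = <-≤-trans h (count-back a≢x b≢x a≢b a≢y)
    ... | yes refl = heavy-sym {F} (<-≤-trans (heavy-sym {K} h) (count-back b≢x a≢x (≢-sym a≢b) (≢-sym a≢b)))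

    -- Members without y survive in K. By rigidity there, at most 2 v + u of the 9 u or more members
    -- of F avoiding y miss x or q.
    with-y : ∀ {q} → q ≢ x → q ≢ y → Heavy K x y → Heavy K x q → Heavy K y q → Triangle F
    with-y {q} q≢x q≢y xy xq yq = triangle x≢y (≢-sym q≢x) (≢-sym q≢y)
      (subst (3 * u <_) (count-compress-fixed x y F true) xy)
      (<-≤-trans heavy (count-mono _ _ λ S → restrict-mono
        (restrict-mono (λ S e → proj₁ (restrict⁻ F y false S e)) x true) q true S))
      (heavy-back (≢-sym x≢y) q≢x (≢-sym q≢y) yq)
      where
      open Rigid (rigid (≢-sym x≢y) (≢-sym q≢y) (≢-sym q≢x) (heavy-sym {K} xy) yq xq)
      lift : ∀ α β → count (restrict (restrict (F ⁻ y) x α) q β) ≤ count (restrict (restrict (K ⁻ y) x α) q β)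
      lift α β = count-mono _ _ λ S → restrict-mono (restrict-mono (λ S e → let (p , s) = restrict⁻ F y false S e in
        restrict⁺ K y false S (compress-keeps x y F {S} p s) s) x α) q β S
      heavy : 3 * u < count (F ⁻ y ⁺ x ⁺ q)
      heavy = entail (u ∷ v ∷ count (F ⁻ y) ∷ count (F ⁻ y ⁺ x ⁺ q) ∷ count (F ⁻ y ⁺ x ⁻ q) ∷
          count (F ⁻ y ⁻ x ⁺ q) ∷ count (F ⁻ y ⁻ x ⁻ q) ∷ [])
        35 (sucᴱ (3 ⊗ # 0)) (# 3)
        ((35 ∙ # 2 ≼ # 3 ⊕ # 4 ⊕ (# 5 ⊕ # 6) by ≤-reflexive (count-split-pair (F ⁻ y) x q)) ∷
         (35 ∙ # 4 ≼ # 1 by ≤-trans (lift true false) only-b≤) ∷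
         (35 ∙ # 5 ≼ # 1 by ≤-trans (lift false true) only-c≤) ∷
         (35 ∙ # 6 ≼ # 0 by ≤-trans (lift false false) none≤) ∷ (35 ∙ 9 ⊗ # 0 ≼ # 2 by spread y) ∷
         (2 ∙ 35 ⊗ # 1 ≼ # 0 by 35v≤u) ∷ (173 ∙ lit 1 ≼ # 0 by u-pos) ∷ []) refl

    -- Members counted at x in K may have come from y. In F one of x and y forms a heavy triangle
    -- with p and q: `without-p` puts {q, x} or {q, y} above 2 u, and this choice determines the
    -- rest.
    module Without-y {p q} (p≢x : p ≢ x) (q≢x : q ≢ x) (p≢q : p ≢ q) (p≢y : p ≢ y) (q≢y : q ≢ y)
                     (xp : Heavy K x p) (xq : Heavy K x q) (pq : Heavy K p q) where

      V : Vec (Fin n) 4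
      V = y ∷ x ∷ q ∷ p ∷ []

      distinct₄ : Distinct V
      distinct₄ = ♯∷ (≢-sym x≢y) (♯∷ (≢-sym q≢y) (♯∷ (≢-sym p≢y) ♯[])) , ♯∷ (≢-sym q≢x) (♯∷ (≢-sym p≢x) ♯[]) ,
        ♯∷ (≢-sym p≢q) ♯[] , ♯[] , tt

      open Rigid (rigid p≢q p≢x q≢x pq (heavy-sym {K} xp) (heavy-sym {K} xq))

      f g : Bool → Bool → Bool → Bool → ℕ
      f α β γ δ = count (trace F V (δ ∷ γ ∷ β ∷ α ∷ []))
      g α β γ δ = count (trace K V (δ ∷ γ ∷ β ∷ α ∷ []))

      -- The digits stand for p, q, x, y, in this order.
      f1111 f1110 f1101 f1100 f1011 f1010 f1001 f1000 f0111 f0110 f0101 f0100 f0011 f0010 f0001 f0000 : ℕ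
      f1111 = f true true true true
      f1110 = f true true true false
      f1101 = f true true false true
      f1100 = f true true false false
      f1011 = f true false true true
      f1010 = f true false true false
      f1001 = f true false false true
      f1000 = f true false false false
      f0111 = f false true true true
      f0110 = f false true true false
      f0101 = f false true false true
      f0100 = f false true false false
      f0011 = f false false true true
      f0010 = f false false true false
      f0001 = f false false false true
      f0000 = f false false false false

      compressed : ∀ α β → restrict (restrict K p α) q β ≗ compress x y (restrict (restrict F p α) q β)
      compressed α β S = trans (restrict-cong (compress-restrict x≢y F p≢x p≢y α) q β S)
        (compress-restrict x≢y (restrict F p α) q≢x q≢y β S)

      same : ∀ α β γ δ → g α β γ δ ≡ count (restrict (restrict (compress x y (restrict (restrict F p α) q β)) x
        γ) y δ)
      same α β γ δ = count-cong (restrict-cong (restrict-cong (compressed α β) x γ) y δ)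

      same₁₁ : ∀ α β → g α β true true ≡ f α β true true
      same₁₁ α β = trans (same α β true true) (count-compress-fixed x y (restrict (restrict F p α) q β) true)

      same₀₀ : ∀ α β → g α β false false ≡ f α β false false
      same₀₀ α β = trans (same α β false false) (count-compress-fixed x y (restrict (restrict F p α) q β) false)

      same-sum : ∀ α β → g α β true false + g α β false true ≡ f α β true false + f α β false true
      same-sum α β = trans (cong₂ _+_ (same α β true false) (same α β false true))
        (count-compress-moved x≢y (restrict (restrict F p α) q β))

      expand-x : count (F ⁻ x) ≡ _
      expand-x = trans (count-split-inner F p q x false) (cong₂ _+_
        (cong₂ _+_ (count-split (F ⁺ p ⁺ q ⁻ x) y) (count-split (F ⁺ p ⁻ q ⁻ x) y))
        (cong₂ _+_ (count-split (F ⁻ p ⁺ q ⁻ x) y) (count-split (F ⁻ p ⁻ q ⁻ x) y)))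

      expand-y : count (F ⁻ y) ≡ _
      expand-y = trans (count-split-inner F p q y false) (cong₂ _+_
        (cong₂ _+_ (count-split₂ (F ⁺ p ⁺ q) y false x) (count-split₂ (F ⁺ p ⁻ q) y false x))
        (cong₂ _+_ (count-split₂ (F ⁻ p ⁺ q) y false x) (count-split₂ (F ⁻ p ⁻ q) y false x)))

      triple₁ : f0111 ≤ u
      triple₁ = ≤-trans (count-trace uniform V distinct₄ (true ∷ true ∷ true ∷ false ∷ []))
        (bin-shrink 3 (n≤1+n 3))

      triple₂ : f1011 ≤ u
      triple₂ = ≤-trans (count-trace uniform V distinct₄ (true ∷ true ∷ false ∷ true ∷ []))
        (bin-shrink 3 (n≤1+n 3))

      light : ∀ {β γ} → size β ≡ 2 → Apart β γ → 2 * u < count (trace F V β) →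
        count (trace F V γ) ≤ bin (n ∸ 3) k (size γ + 3)
      light {β} {γ} = heavy-light uniform intersecting V distinct₄ (n≤1+n 3) (n≤1+n 4) {β} {γ}

      f0110-f1001 : 2 * u < f0110 → f1001 ≤ v
      f0110-f1001 h = ≤-trans (light {false ∷ true ∷ true ∷ false ∷ []} {true ∷ false ∷ false ∷ true ∷ []} refl
        (refl ∷ refl ∷ refl ∷ refl ∷ []) h) bin-5≤v

      f1010-f0101 : 2 * u < f1010 → f0101 ≤ v
      f1010-f0101 h = ≤-trans (light {false ∷ true ∷ false ∷ true ∷ []} {true ∷ false ∷ true ∷ false ∷ []} refl
        (refl ∷ refl ∷ refl ∷ refl ∷ []) h) bin-5≤v

      f0101-f1010 : 2 * u < f0101 → f1010 ≤ v
      f0101-f1010 h = ≤-trans (light {true ∷ false ∷ true ∷ false ∷ []} {false ∷ true ∷ false ∷ true ∷ []} refl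
        (refl ∷ refl ∷ refl ∷ refl ∷ []) h) bin-5≤v

      f1001-f0110 : 2 * u < f1001 → f0110 ≤ v
      f1001-f0110 h = ≤-trans (light {true ∷ false ∷ false ∷ true ∷ []} {false ∷ true ∷ true ∷ false ∷ []} refl
        (refl ∷ refl ∷ refl ∷ refl ∷ []) h) bin-5≤v

      only-p : f1000 ≤ v
      only-p = entail (v ∷ count (K ⁺ p ⁻ q ⁻ x) ∷ f1000 ∷ g true false false true ∷ g true false false false ∷
          [])
        1 (# 2) (# 0)
        ((1 ∙ # 3 ⊕ # 4 ≼ # 1 by ≡⇒≥ (count-split (K ⁺ p ⁻ q ⁻ x) y)) ∷ (1 ∙ # 1 ≼ # 0 by only-a≤) ∷
         (1 ∙ # 2 ≼ # 4 by ≡⇒≥ (same₀₀ true false)) ∷ []) refl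

      only-q : f0100 ≤ v
      only-q = entail (v ∷ count (K ⁻ p ⁺ q ⁻ x) ∷ f0100 ∷ g false true false true ∷ g false true false false ∷
          [])
        1 (# 2) (# 0)
        ((1 ∙ # 3 ⊕ # 4 ≼ # 1 by ≡⇒≥ (count-split (K ⁻ p ⁺ q ⁻ x) y)) ∷ (1 ∙ # 1 ≼ # 0 by only-b≤) ∷
         (1 ∙ # 2 ≼ # 4 by ≡⇒≥ (same₀₀ false true)) ∷ []) refl

      -- Compression keeps the number of members with a given trace on p and q, so the bound can be
      -- read off from K.
      neither-pq : f0011 + f0010 + (f0001 + f0000) ≤ u + v
      neither-pq = entail (u ∷ v ∷ count (K ⁻ p ⁻ q ⁻ x) ∷ count (K ⁻ p ⁻ q ⁺ x) ∷ f0011 ∷ f0010 ∷ f0001 ∷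
          f0000 ∷ g false false true true ∷ g false false true false ∷ g false false false true ∷
          g false false false false ∷ [])
        1 (# 4 ⊕ # 5 ⊕ (# 6 ⊕ # 7)) (# 0 ⊕ # 1)
        ((1 ∙ # 10 ⊕ # 11 ≼ # 2 by ≡⇒≥ (count-split (K ⁻ p ⁻ q ⁻ x) y)) ∷
         (1 ∙ # 8 ⊕ # 9 ≼ # 3 by ≡⇒≥ (count-split (K ⁻ p ⁻ q ⁺ x) y)) ∷ (1 ∙ # 2 ≼ # 0 by none≤) ∷
         (1 ∙ # 3 ≼ # 1 by only-c≤) ∷ (1 ∙ # 4 ≼ # 8 by ≡⇒≥ (same₁₁ false false)) ∷
         (1 ∙ # 7 ≼ # 11 by ≡⇒≥ (same₀₀ false false)) ∷
         (1 ∙ # 5 ⊕ # 6 ≼ # 9 ⊕ # 10 by ≡⇒≥ (same-sum false false)) ∷ []) refl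

      without-p : 7 * u ≤ f0110 + f0101 + 2 * v
      without-p = entail (u ∷ v ∷ count (F ⁻ p) ∷ f0111 ∷ f0110 ∷ f0101 ∷ f0100 ∷ f0011 ∷ f0010 ∷ f0001 ∷
          f0000 ∷ [])
        1 (7 ⊗ # 0) (# 4 ⊕ # 5 ⊕ 2 ⊗ # 1)
        ((1 ∙ # 2 ≼ # 3 ⊕ # 4 ⊕ (# 5 ⊕ # 6) ⊕ (# 7 ⊕ # 8 ⊕ (# 9 ⊕ # 10)) by ≤-reflexive
          (trans (count-split (F ⁻ p) q) (cong₂ _+_ (count-split-pair (F ⁻ p ⁺ q) x y)
            (count-split-pair (F ⁻ p ⁻ q) x y)))) ∷
         (1 ∙ # 3 ≼ # 0 by triple₁) ∷ (1 ∙ 9 ⊗ # 0 ≼ # 2 by spread p) ∷ (1 ∙ # 6 ≼ # 1 by only-q) ∷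
         (1 ∙ # 7 ⊕ # 8 ⊕ (# 9 ⊕ # 10) ≼ # 0 ⊕ # 1 by neither-pq) ∷ []) refl

      without-q : 7 * u ≤ f1010 + f1001 + 2 * v
      without-q = entail (u ∷ v ∷ count (F ⁻ q) ∷ f1011 ∷ f1010 ∷ f1001 ∷ f1000 ∷ f0011 ∷ f0010 ∷ f0001 ∷
          f0000 ∷ [])
        1 (7 ⊗ # 0) (# 4 ⊕ # 5 ⊕ 2 ⊗ # 1)
        ((1 ∙ # 2 ≼ # 3 ⊕ # 4 ⊕ (# 5 ⊕ # 6) ⊕ (# 7 ⊕ # 8 ⊕ (# 9 ⊕ # 10)) by ≤-reflexive
          (trans (count-split₂ F q false p) (cong₂ _+_ (count-split-pair (F ⁺ p ⁻ q) x y)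
            (count-split-pair (F ⁻ p ⁻ q) x y)))) ∷
         (1 ∙ # 3 ≼ # 0 by triple₂) ∷ (1 ∙ 9 ⊗ # 0 ≼ # 2 by spread q) ∷ (1 ∙ # 6 ≼ # 1 by only-p) ∷
         (1 ∙ # 7 ⊕ # 8 ⊕ (# 9 ⊕ # 10) ≼ # 0 ⊕ # 1 by neither-pq) ∷ []) refl

      without-x : 8 * u ≤ count (F ⁺ p ⁺ q) + f1001 + f0101 + 3 * v
      without-x = entail (u ∷ v ∷ count (F ⁻ x) ∷ f1111 ∷ f1110 ∷ f1101 ∷ f1100 ∷ f1001 ∷ f1000 ∷ f0101 ∷
          f0100 ∷ f0011 ∷ f0010 ∷ f0001 ∷ f0000 ∷ count (F ⁺ p ⁺ q) ∷ [])
        1 (8 ⊗ # 0) (# 15 ⊕ # 7 ⊕ # 9 ⊕ 3 ⊗ # 1)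
        ((1 ∙ # 2 ≼ # 5 ⊕ # 6 ⊕ (# 7 ⊕ # 8) ⊕ (# 9 ⊕ # 10 ⊕ (# 13 ⊕ # 14)) by ≤-reflexive expand-x) ∷
         (1 ∙ 9 ⊗ # 0 ≼ # 2 by spread x) ∷ (1 ∙ # 8 ≼ # 1 by only-p) ∷ (1 ∙ # 10 ≼ # 1 by only-q) ∷
         (1 ∙ # 11 ⊕ # 12 ⊕ (# 13 ⊕ # 14) ≼ # 0 ⊕ # 1 by neither-pq) ∷
         (1 ∙ # 3 ⊕ # 4 ⊕ (# 5 ⊕ # 6) ≼ # 15 by ≡⇒≥ (count-split-pair (F ⁺ p ⁺ q) x y)) ∷ []) refl

      without-y : 8 * u ≤ count (F ⁺ p ⁺ q) + f1010 + f0110 + 3 * v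
      without-y = entail (u ∷ v ∷ count (F ⁻ y) ∷ f1111 ∷ f1110 ∷ f1101 ∷ f1100 ∷ f1010 ∷ f1000 ∷ f0110 ∷
          f0100 ∷ f0011 ∷ f0010 ∷ f0001 ∷ f0000 ∷ count (F ⁺ p ⁺ q) ∷ [])
        1 (8 ⊗ # 0) (# 15 ⊕ # 7 ⊕ # 9 ⊕ 3 ⊗ # 1)
        ((1 ∙ # 2 ≼ # 4 ⊕ # 6 ⊕ (# 7 ⊕ # 8) ⊕ (# 9 ⊕ # 10 ⊕ (# 12 ⊕ # 14)) by ≤-reflexive expand-y) ∷
         (1 ∙ 9 ⊗ # 0 ≼ # 2 by spread y) ∷ (1 ∙ # 8 ≼ # 1 by only-p) ∷ (1 ∙ # 10 ≼ # 1 by only-q) ∷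
         (1 ∙ # 11 ⊕ # 12 ⊕ (# 13 ⊕ # 14) ≼ # 0 ⊕ # 1 by neither-pq) ∷
         (1 ∙ # 3 ⊕ # 4 ⊕ (# 5 ⊕ # 6) ≼ # 15 by ≡⇒≥ (count-split-pair (F ⁺ p ⁺ q) x y)) ∷ []) refl

      weaken : ∀ {c} → 3 * u < c → 2 * u < c
      weaken = <-trans 2u<3u

      drop-p : ∀ S → (F ⁻ p) S ≡ true → F S ≡ true
      drop-p S e = proj₁ (restrict⁻ F p false S e)

      -- A chain of disjoint pairs: {q, x} is large, so {p, y} is light, so {p, x} is heavy, so {q,
      -- y} is light, so {q, x} exceeds even 3 u. With {p, y} and {q, y} light, the members avoiding
      -- x must lie mostly on {p, q}.
      via-x : 2 * u < f0110 → Triangle F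
      via-x h = triangle (≢-sym p≢x) (≢-sym q≢x) p≢q
        (heavy-sym {F} (<-≤-trans px (≤-trans (count-restrict (F ⁺ p ⁻ q ⁺ x) y false)
          (drop-inner (F ⁺ p) q false x true))))
        (heavy-sym {F} (<-≤-trans qx (≤-trans (count-restrict (F ⁻ p ⁺ q ⁺ x) y false) (count-mono _ _ λ S →
          restrict-mono (restrict-mono drop-p q true) x true S))))
        (entail (u ∷ v ∷ f1001 ∷ f0101 ∷ count (F ⁺ p ⁺ q) ∷ [])
          7 (sucᴱ (3 ⊗ # 0)) (# 4)
          ((7 ∙ 8 ⊗ # 0 ≼ # 4 ⊕ # 2 ⊕ # 3 ⊕ 3 ⊗ # 1 by without-x) ∷ (1 ∙ 35 ⊗ # 1 ≼ # 0 by 35v≤u) ∷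
           (34 ∙ lit 1 ≼ # 0 by u-pos) ∷ (7 ∙ # 2 ≼ # 1 by f0110-f1001 h) ∷
           (7 ∙ # 3 ≼ # 1 by f1010-f0101 (weaken px)) ∷ []) refl)
        where
        px : 3 * u < f1010
        px = entail (u ∷ v ∷ f1010 ∷ f1001 ∷ [])
          35 (sucᴱ (3 ⊗ # 0)) (# 2)
          ((35 ∙ 7 ⊗ # 0 ≼ # 2 ⊕ # 3 ⊕ 2 ⊗ # 1 by without-q) ∷ (3 ∙ 35 ⊗ # 1 ≼ # 0 by 35v≤u) ∷
           (137 ∙ lit 1 ≼ # 0 by u-pos) ∷ (35 ∙ # 3 ≼ # 1 by f0110-f1001 h) ∷ []) refl
        qx : 3 * u < f0110
        qx = entail (u ∷ v ∷ f0110 ∷ f0101 ∷ [])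
          35 (sucᴱ (3 ⊗ # 0)) (# 2)
          ((35 ∙ 7 ⊗ # 0 ≼ # 2 ⊕ # 3 ⊕ 2 ⊗ # 1 by without-p) ∷ (3 ∙ 35 ⊗ # 1 ≼ # 0 by 35v≤u) ∷
           (137 ∙ lit 1 ≼ # 0 by u-pos) ∷ (35 ∙ # 3 ≼ # 1 by f1010-f0101 (weaken px)) ∷ []) refl

      via-y : 2 * u < f0101 → Triangle F
      via-y h = triangle (≢-sym p≢y) (≢-sym q≢y) p≢q
        (heavy-sym {F} (<-≤-trans py (≤-trans (drop-inner (F ⁺ p ⁻ q) x false y true)
          (drop-inner (F ⁺ p) q false y true))))
        (heavy-sym {F} (<-≤-trans qy (≤-trans (drop-inner (F ⁻ p ⁺ q) x false y true) (count-mono _ _ λ S →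
          restrict-mono (restrict-mono drop-p q true) y true S))))
        (entail (u ∷ v ∷ f1010 ∷ f0110 ∷ count (F ⁺ p ⁺ q) ∷ [])
          7 (sucᴱ (3 ⊗ # 0)) (# 4)
          ((7 ∙ 8 ⊗ # 0 ≼ # 4 ⊕ # 2 ⊕ # 3 ⊕ 3 ⊗ # 1 by without-y) ∷ (1 ∙ 35 ⊗ # 1 ≼ # 0 by 35v≤u) ∷
           (34 ∙ lit 1 ≼ # 0 by u-pos) ∷ (7 ∙ # 2 ≼ # 1 by f0101-f1010 h) ∷
           (7 ∙ # 3 ≼ # 1 by f1001-f0110 (weaken py)) ∷ []) refl)
        where
        py : 3 * u < f1001
        py = entail (u ∷ v ∷ f1010 ∷ f1001 ∷ [])
          35 (sucᴱ (3 ⊗ # 0)) (# 3)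
          ((35 ∙ 7 ⊗ # 0 ≼ # 2 ⊕ # 3 ⊕ 2 ⊗ # 1 by without-q) ∷ (3 ∙ 35 ⊗ # 1 ≼ # 0 by 35v≤u) ∷
           (137 ∙ lit 1 ≼ # 0 by u-pos) ∷ (35 ∙ # 2 ≼ # 1 by f0101-f1010 h) ∷ []) refl
        qy : 3 * u < f0101
        qy = entail (u ∷ v ∷ f0110 ∷ f0101 ∷ [])
          35 (sucᴱ (3 ⊗ # 0)) (# 3)
          ((35 ∙ 7 ⊗ # 0 ≼ # 2 ⊕ # 3 ⊕ 2 ⊗ # 1 by without-p) ∷ (3 ∙ 35 ⊗ # 1 ≼ # 0 by 35v≤u) ∷
           (137 ∙ lit 1 ≼ # 0 by u-pos) ∷ (35 ∙ # 2 ≼ # 1 by f1001-f0110 (weaken py)) ∷ []) refl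

      result : Triangle F
      result with 2 * u <? f0110 | 2 * u <? f0101
      ... | yes h | _ = via-x h
      ... | no _ | yes h = via-y h
      ... | no h | no h′ = ⊥-elim (refute (u ∷ v ∷ f0110 ∷ f0101 ∷ [])
        ((35 ∙ 7 ⊗ # 0 ≼ # 2 ⊕ # 3 ⊕ 2 ⊗ # 1 by without-p) ∷ (2 ∙ 35 ⊗ # 1 ≼ # 0 by 35v≤u) ∷
         (103 ∙ lit 1 ≼ # 0 by u-pos) ∷ (35 ∙ # 2 ≼ 2 ⊗ # 0 by ≮⇒≥ h) ∷ (35 ∙ # 3 ≼ 2 ⊗ # 0 by ≮⇒≥ h′) ∷ [])
           refl)

    through-x : ∀ {p q} → p ≢ x → q ≢ x → p ≢ q → Heavy K x p → Heavy K x q → Heavy K p q → Triangle F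
    through-x {p} {q} p≢x q≢x p≢q xp xq pq with p ≟ y | q ≟ y
    ... | yes refl | _ = with-y q≢x (≢-sym p≢q) xp xq pq
    ... | no _ | yes refl = with-y p≢x p≢q xq xp (heavy-sym {K} pq)
    ... | no p≢y | no q≢y = Without-y.result p≢x q≢x p≢q p≢y q≢y xp xq pq

    uncompress : Triangle K → Triangle F
    uncompress (triangle {p} {q} {r} p≢q p≢r q≢r pq pr qr) with p ≟ x | q ≟ x | r ≟ x
    ... | yes refl | _ | _ = through-x (≢-sym p≢q) (≢-sym p≢r) q≢r pq pr qr
    ... | no p≢x | yes refl | _ = through-x p≢x (≢-sym q≢r) p≢r (heavy-sym {K} pq) qr pr
    ... | no p≢x | no q≢x | yes refl = through-x p≢x q≢x p≢q (heavy-sym {K} pr) (heavy-sym {K} qr) pq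
    ... | no p≢x | no q≢x | no r≢x = triangle p≢q p≢r q≢r (heavy-back p≢x q≢x p≢q pq)
          (heavy-back p≢x r≢x p≢r pr) (heavy-back q≢x r≢x q≢r qr)

  -- Replacing y by x can reduce the number of members avoiding a point only if this point is x, so
  -- the guard is needed there alone.
  compress-ample : ∀ {F x y} → x ≢ y → Ample F → 9 * u ≤ count (compress x y F ⁻ x) → Ample (compress x y F)
  compress-ample {F} {x} {y} x≢y ample le = record
    { uniform = compress-uniform x≢y (Ample.uniform ample)
    ; intersecting = compress-cross x≢y (Ample.intersecting ample)
    ; many = subst (35 * u ≤_) (sym (count-compress x≢y F)) (Ample.many ample)
    ; spread = spread′ }
    where
    spread′ : ∀ j → 9 * u ≤ count (compress x y F ⁻ j)
    spread′ j with j ≟ x | j ≟ y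
    ... | yes refl | _ = le
    ... | no _ | yes refl = ≤-trans (Ample.spread ample y) (count-compress-⁻ x y F)
    ... | no j≢x | no j≢y = subst (9 * u ≤_) (sym (count-compress-restrict x≢y j≢x j≢y F false))
          (Ample.spread ample j)

  module Terminal {F : Fam n} (ample : Ample F) (settled : ∀ x y → toℕ x < toℕ y → Edge F x y ⊎
    StablePair F x y) where

    EdgeIn : Subset n → Fin n → Fin n → Set
    EdgeIn M x y = toℕ x < toℕ y × lookup M x ≡ true × lookup M y ≡ true × Edge F x y

    edge-or-stable : ∀ M → (∃₂ (EdgeIn M)) ⊎ StableOn M F
    edge-or-stable M with any? (λ x → any? λ y → toℕ x <? toℕ y ×-dec lookup M x ≟ᵇ true ×-dec lookup M y ≟ᵇ
      true ×-dec count (F ⁻ x ⁻ y) <? 9 * u)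
    ... | yes found = inj₁ found
    ... | no none = inj₂ stable
      where
      stable : StableOn M F
      stable {x} {y} x<y mx my with settled x y x<y
      ... | inj₁ e = contradiction (x , y , x<y , mx , my , e) none
      ... | inj₂ st = st

    result : Triangle F
    result with edge-or-stable (mask [])
    ... | inj₂ st = zero-edges ample st
    ... | inj₁ (x , y , x<y , _ , _ , exy) with edge-or-stable (mask (y ∷ x ∷ []))
    ...   | inj₂ st = one-edge ample (<⇒≢ᶠ x<y) exy st
    ...   | inj₁ (z , w , z<w , mz , mw , ezw) with edge-or-stable (mask (w ∷ z ∷ y ∷ x ∷ []))
    ...     | inj₂ st = two-edges ample (<⇒≢ᶠ x<y) z≢x z≢y w≢x w≢y (≢-sym (<⇒≢ᶠ z<w)) exy ezw λ p<q op oq →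
          st p<q (on op) (on oq)
      where
      z≢y = ♯-head (x ∷ []) (fresh mz)
      z≢x = ♯-head [] (♯-tail (x ∷ []) (fresh mz))
      w≢y = ♯-head (x ∷ []) (fresh mw)
      w≢x = ♯-head [] (♯-tail (x ∷ []) (fresh mw))
      on : ∀ {p} → OffPairs ample x y z w p → lookup (mask (w ∷ z ∷ y ∷ x ∷ [])) p ≡ true
      on (p≢x , p≢y , p≢z , p≢w) = free (♯∷ p≢w (♯∷ p≢z (♯∷ p≢y (♯∷ p≢x ♯[]))))
    ...     | inj₁ (p , q , _ , mp , mq , epq) with off-pairs ample (fresh mp) | off-pairs ample (fresh mq)
    ...       | p≢x , p≢y , p≢z , p≢w | q≢x , q≢y , q≢z , q≢w = ⊥-elim (three-edges ample
                (♯-head [] (♯-tail (x ∷ []) (fresh mz))) (♯-head (x ∷ []) (fresh mz))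
                (♯-head [] (♯-tail (x ∷ []) (fresh mw))) (♯-head (x ∷ []) (fresh mw))
                p≢z p≢w p≢x p≢y q≢z q≢w q≢x q≢y exy ezw epq)

  ample-triangle : ∀ F → Acc _<_ (potential F) → Ample F → Triangle F
  ample-triangle F (acc rec) ample
    with any? (λ x → any? λ y → toℕ x <? toℕ y ×-dec potential (compress x y F) <? potential F ×-dec 9 * u ≤?
      count (compress x y F ⁻ x))
  ... | yes (x , y , x<y , lt , le) = Uncompress.uncompress ample (<⇒≢ᶠ x<y)
          (ample-triangle (compress x y F) (rec lt) (compress-ample (<⇒≢ᶠ x<y) ample le))
  ... | no none = Terminal.result ample settled
    where
    settled : ∀ x y → toℕ x < toℕ y → Edge F x y ⊎ StablePair F x y
    settled x y x<y with potential (compress x y F) <? potential F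
    ... | no ≮ = inj₂ (potential-stable x<y F ≮)
    -- The compression is blocked because it would leave fewer than 9 u members avoiding x. The
    -- members of F avoiding both points are among these, so the pair is an edge.
    ... | yes lt = inj₁ (≤-<-trans (count-mono _ _ λ S e → let (e₁ , sy) = restrict⁻ (F ⁻ x) y false S e ; (e₂ , sx) = restrict⁻ F x false S e₁ in
        restrict⁺ (compress x y F) x false S (compress-keeps x y F {S} e₂ sy) sx)
        (≰⇒> λ le → none (x , y , x<y , lt , le)))

-- Double counting

Σ∈ : ∀ {n} → Subset n → (Fin n → ℕ) → ℕ
Σ∈ [] g = 0
Σ∈ (true ∷ M) g = g zero + Σ∈ M (g ∘ suc)
Σ∈ (false ∷ M) g = Σ∈ M (g ∘ suc)

Σ∈-≥ : ∀ {n} (M : Subset n) {g c} → (∀ i → lookup M i ≡ true → c ≤ g i) → size M * c ≤ Σ∈ M g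
Σ∈-≥ [] h = z≤n
Σ∈-≥ (true ∷ M) h = +-mono-≤ (h zero refl) (Σ∈-≥ M (h ∘ suc))
Σ∈-≥ (false ∷ M) h = Σ∈-≥ M (h ∘ suc)

Σ∈-cong : ∀ {n} (M : Subset n) {f g} → (∀ i → f i ≡ g i) → Σ∈ M f ≡ Σ∈ M g
Σ∈-cong [] h = refl
Σ∈-cong (true ∷ M) h = cong₂ _+_ (h zero) (Σ∈-cong M (h ∘ suc))
Σ∈-cong (false ∷ M) h = Σ∈-cong M (h ∘ suc)

Σ∈-+ : ∀ {n} (M : Subset n) f g → Σ∈ M (λ i → f i + g i) ≡ Σ∈ M f + Σ∈ M g
Σ∈-+ [] f g = refl
Σ∈-+ (true ∷ M) f g = trans (cong (f zero + g zero +_) (Σ∈-+ M (f ∘ suc) (g ∘ suc)))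
  (+-interchange (f zero) _ _ _)
Σ∈-+ (false ∷ M) f g = Σ∈-+ M (f ∘ suc) (g ∘ suc)

common : ∀ {n} → Subset n → Subset n → ℕ
common [] [] = 0
common (true ∷ M) (b ∷ S) = bit b + common M S
common (false ∷ M) (_ ∷ S) = common M S

size-common : ∀ {n} (M S : Subset n) → size S ≡ common M S + off M S
size-common [] [] = refl
size-common (true ∷ M) (b ∷ S) = trans (size-∷ b S)
  (trans (cong (bit b +_) (size-common M S)) (sym (+-assoc (bit b) _ _)))
size-common (false ∷ M) (b ∷ S) = trans (size-∷ b S)
  (trans (cong (bit b +_) (size-common M S)) (rearrange (bit b) (common M S) (off M S)))
  where
  rearrange : ∀ a c d → a + (c + d) ≡ c + (a + d)
  rearrange = solve-∀

-- Incidences between members and positions of `M` are counted in two ways.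
degrees : ∀ {n} (M : Subset n) (G : Fam n) a → (∀ S → G S ≡ true → common M S ≤ a) →
  Σ∈ M (λ i → count (G ⁺ i)) ≤ a * count G
degrees [] G a h = z≤n
degrees (false ∷ M) G a h = begin
  Σ∈ M (λ i → count ((G ∘ (true ∷_)) ⁺ i) + count ((G ∘ (false ∷_)) ⁺ i)) ≡⟨ Σ∈-+ M _ _ ⟩
  Σ∈ M (λ i → count ((G ∘ (true ∷_)) ⁺ i)) + Σ∈ M (λ i → count ((G ∘ (false ∷_)) ⁺ i)) ≤⟨
    +-mono-≤ (degrees M (G ∘ (true ∷_)) a (h ∘ (true ∷_))) (degrees M (G ∘ (false ∷_)) a (h ∘ (false ∷_))) ⟩
  a * count (G ∘ (true ∷_)) + a * count (G ∘ (false ∷_)) ≡⟨ *-distribˡ-+ a (count (G ∘ (true ∷_))) _ ⟨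
  a * count G ∎
  where open ≤-Reasoning
degrees (true ∷ M) G zero h = begin
  count (G ⁺ zero) + Σ∈ M (λ i → count (G ⁺ suc i)) ≡⟨
    cong (_+ Σ∈ M (λ i → count (G ⁺ suc i))) (count-empty λ { S e → none S (restrict⁻ G zero true S e) }) ⟩
  Σ∈ M (λ i → count (G ⁺ suc i)) ≡⟨ Σ∈-+ M _ _ ⟩
  Σ∈ M (λ i → count ((G ∘ (true ∷_)) ⁺ i)) + Σ∈ M (λ i → count ((G ∘ (false ∷_)) ⁺ i)) ≤⟨
    +-mono-≤ (degrees M (G ∘ (true ∷_)) 0 (λ S e → ⊥-elim (none (true ∷ S) (e , refl))))
      (degrees M (G ∘ (false ∷_)) 0 (h ∘ (false ∷_))) ⟩
  0 ∎
  where
  open ≤-Reasoning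
  none : ∀ S → G S ≡ true × lookup S zero ≡ true → ⊥
  none (true ∷ S) (e , _) = contradiction (h (true ∷ S) e) λ ()
degrees (true ∷ M) G (suc a) h = begin
  count (G ⁺ zero) + Σ∈ M (λ i → count (G ⁺ suc i)) ≡⟨ cong₂ _+_ head (Σ∈-+ M _ _) ⟩
  c₁ + (Σ∈ M (λ i → count ((G ∘ (true ∷_)) ⁺ i)) + Σ∈ M (λ i → count ((G ∘ (false ∷_)) ⁺ i))) ≤⟨ +-monoʳ-≤ c₁
    (+-mono-≤ (degrees M (G ∘ (true ∷_)) a (λ S e → s≤s⁻¹ (h (true ∷ S) e)))
      (degrees M (G ∘ (false ∷_)) (suc a) (h ∘ (false ∷_)))) ⟩
  c₁ + (a * c₁ + suc a * c₀) ≡⟨ collect a c₁ c₀ ⟩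
  suc a * (c₁ + c₀) ∎
  where
  open ≤-Reasoning
  c₁ c₀ : ℕ
  c₁ = count (G ∘ (true ∷_))
  c₀ = count (G ∘ (false ∷_))
  collect : ∀ a x y → x + (a * x + suc a * y) ≡ suc a * (x + y)
  collect = solve-∀
  head : count (G ⁺ zero) ≡ c₁
  head = trans (cong₂ _+_ (count-cong λ S → ∧-identityʳ (G (true ∷ S)))
    (count-empty λ S e → contradiction (proj₂ (restrict⁻ G zero true (false ∷ S) e)) λ ())) (+-identityʳ c₁)

-- A heavy triangle contradicts sturdiness

module Final {n k : ℕ} (3≤k : 3 ≤ k) (large : 36 * (k + 6) ≤ n) where

  open Setting {n} {k} 3≤k large
  open Edges {n} {k} 3≤k large
  open Triangles {n} {k} 3≤k large

  bound w N K : ℕ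
  bound = bin (n ∸ 4) k 3
  w = bin (n ∸ 4) k 4
  N = bin (n ∸ 3) k 2
  K = k ∸ 3

  n∸3≡ : n ∸ 3 ≡ suc (n ∸ 4)
  n∸3≡ = +-∸-assoc 1 {n} {4} (≤-trans (≤ᵇ⇒≤ 4 216 tt) 216≤n)

  u-split : u ≡ bound + w
  u-split = trans (cong (λ m → bin m k 3) n∸3≡) (bin-pascal (n ∸ 4) k 3)

  -- The truncation of `K ∸ 1` at k = 3 does no harm, since `w` vanishes there.
  K-absorption : K * bound + (K ∸ 1) * w ≡ (n ∸ 4) * w
  K-absorption with 3 <? k
  ... | yes 3<k = trans (cong (λ c → K * bound + c * w) (∸-+-assoc k 3 1)) (bin-absorption (n ∸ 4) k 3 3<k)
  ... | no 3≮k rewrite ≤-antisym (≮⇒≥ 3≮k) 3≤k = sym (*-zeroʳ (n ∸ 4))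

  w+[K-1]w≤Kw : w + (K ∸ 1) * w ≤ K * w
  w+[K-1]w≤Kw with 3 <? k
  ... | yes 3<k = ≤-reflexive (cong (_* w) (m+[n∸m]≡n {1} {K} (m<n⇒0<n∸m 3<k)))
  ... | no 3≮k rewrite bin-zero (n ∸ 4) {k} {4} (s≤s (≮⇒≥ 3≮k)) | *-zeroʳ (K ∸ 1) = z≤n

  -- Both sides equal (n - 3) C(n-4, k-3).
  averaging : (k ∸ 2) * N ≤ (n ∸ 3) * bound
  averaging = entail ((k ∸ 2) * N ∷ K * u ∷ (n ∸ 3) * u ∷ (n ∸ 3) * bound ∷ (n ∸ 3) * w ∷ K * bound ∷ K * w ∷
      (K ∸ 1) * w ∷ (n ∸ 4) * w ∷ w ∷ [])
    1 (# 0) (# 3)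
    ((1 ∙ # 0 ⊕ # 1 ≼ # 2 by ≤-reflexive (bin-absorption (n ∸ 3) k 2 3≤k)) ∷
     (1 ∙ # 2 ≼ # 3 ⊕ # 4 by ≤-reflexive (trans (cong ((n ∸ 3) *_) u-split) (*-distribˡ-+ (n ∸ 3) bound w))) ∷
     (1 ∙ # 5 ⊕ # 6 ≼ # 1 by ≡⇒≥ (trans (cong (K *_) u-split) (*-distribˡ-+ K bound w))) ∷
     (1 ∙ # 8 ≼ # 5 ⊕ # 7 by ≡⇒≥ K-absorption) ∷ (1 ∙ # 4 ≼ # 9 ⊕ # 8 by ≤-reflexive (cong (_* w) n∸3≡)) ∷
     (1 ∙ # 9 ⊕ # 7 ≼ # 6 by w+[K-1]w≤Kw) ∷ []) refl

  Sturdy : Fam n → Set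
  Sturdy F = ∀ i j → i ≢ j → bound < count (F ⁺ i ⁻ j)

  module _ {F : Fam n} (uniform : Uniformᶠ k F) (sturdy : Sturdy F) where

    common≤k : ∀ (M : Subset n) S → F S ≡ true → common M S ≤ k
    common≤k M S e = ≤-trans (m≤m+n (common M S) (off M S))
      (≤-reflexive (trans (sym (size-common M S)) (uniform S e)))

    -- In the sum of b_ij over all i other than j, each member avoiding j is counted k times. The 35
    -- is affordable because 35 k u = 35 k C(n-4, k-3) + 35 k w, and absorption gives 35 k w ≤ K
    -- C(n-4, k-3).
    sturdy-spread : ∀ j → 35 * u ≤ count (F ⁻ j)
    sturdy-spread j = *-cancelˡ-≤ k {{>-nonZero (≤-trans (s≤s z≤n) 3≤k)}} (begin
      k * (35 * u)                     ≡⟨ cong (λ c → k * (35 * c)) u-split ⟩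
      k * (35 * (bound + w))           ≡⟨ expand k bound w ⟩
      35 * k * bound + 35 * k * w      ≤⟨ +-monoʳ-≤ (35 * k * bound) 35kw≤Kb ⟩
      35 * k * bound + K * bound       ≡⟨ *-distribʳ-+ bound (35 * k) K ⟨
      (35 * k + K) * bound             ≤⟨ *-mono-≤ (≤-trans room′ (∸-monoʳ-≤ n (m≤m+n 1 3))) (n≤1+n bound) ⟩
      (n ∸ 1) * suc bound              ≡⟨ cong (_* suc bound) (size-mask (j ∷ []) (♯[] , tt)) ⟨
      size (mask (j ∷ [])) * suc bound ≤⟨ Σ∈-≥ (mask (j ∷ [])) (λ i mi →
                                            subst (bound <_) (count-restrict-comm F i true j false)
                                              (sturdy i j (♯-head [] (fresh mi)))) ⟩
      Σ∈ (mask (j ∷ [])) (λ i → count (F ⁻ j ⁺ i)) ≤⟨ degrees (mask (j ∷ [])) (F ⁻ j) k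
                                            (λ S e → common≤k (mask (j ∷ [])) S
                                              (proj₁ (restrict⁻ F j false S e))) ⟩
      k * count (F ⁻ j)                ∎)
      where
      open ≤-Reasoning
      expand : ∀ k x y → k * (35 * (x + y)) ≡ 35 * k * x + 35 * k * y
      expand = solve-∀
      room′ : 35 * k + K ≤ n ∸ 4
      room′ = ≤-trans (+-monoʳ-≤ (35 * k) (m∸n≤m k 3)) (m+n≤o⇒m≤o∸n (35 * k + k) (≤-trans (≤-trans
        (≤-reflexive (cong (_+ 4) (+-comm (35 * k) k))) (+-monoʳ-≤ (36 * k) (≤ᵇ⇒≤ 4 216 tt)))
        (≤-trans (≤-reflexive (sym (*-distribˡ-+ 36 k 6))) large)))
      35kw≤Kb : 35 * k * w ≤ K * bound
      35kw≤Kb = entail (35 * k * w ∷ K * bound ∷ K * w ∷ (K ∸ 1) * w ∷ (n ∸ 4) * w ∷ (35 * k + K) * w ∷ w ∷ [])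
        1 (# 0) (# 1)
        ((1 ∙ # 0 ⊕ # 2 ≼ # 5 by ≡⇒≥ (*-distribʳ-+ w (35 * k) K)) ∷ (1 ∙ # 5 ≼ # 4 by *-monoˡ-≤ w room′) ∷
         (1 ∙ # 4 ≼ # 1 ⊕ # 3 by ≡⇒≥ K-absorption) ∷ (1 ∙ # 6 ⊕ # 3 ≼ # 2 by w+[K-1]w≤Kw) ∷ []) refl

    module _ (intersecting : Cross F F) {a b c : Fin n} (a≢b : a ≢ b) (a≢c : a ≢ c) (b≢c : b ≢ c)
             (ab : Heavy F a b) (ac : Heavy F a c) (bc : Heavy F b c) where

      open Outside uniform intersecting

      V : Vec (Fin n) 3
      V = c ∷ b ∷ a ∷ []

      distinct₃ : Distinct V
      distinct₃ = ♯∷ (≢-sym b≢c) (♯∷ (≢-sym a≢c) ♯[]) , ♯∷ (≢-sym a≢b) ♯[] , ♯[] , tt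

      open Rigid (rigid a≢b a≢c b≢c ab ac bc)

      P only-a only-b only-c none : ℕ
      P = count (F ⁻ a ⁺ b ⁺ c)
      only-a = count (F ⁺ a ⁻ b ⁻ c)
      only-b = count (F ⁻ a ⁺ b ⁻ c)
      only-c = count (F ⁻ a ⁻ b ⁺ c)
      none = count (F ⁻ a ⁻ b ⁻ c)

      -- In the averaged sum a member counted by `P` contributes k - 2, while each member of three
      -- further families contributes up to k. If `q` bounds these families, the N - P missing sets
      -- outweigh all three of them.
      Deficit : ℕ → Set
      Deficit q = (k ∸ 2) * P + 3 * k * q ≤ (k ∸ 2) * N

      P≤N : P ≤ N
      P≤N = count-trace uniform V distinct₃ (true ∷ true ∷ false ∷ [])

      large₃₅ : ∀ r → r ≤ 3 + k → 35 * k + 210 ≤ n ∸ r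
      large₃₅ r r≤ = m+n≤o⇒m≤o∸n (35 * k + 210) (≤-trans (+-monoʳ-≤ (35 * k + 210) r≤) (≤-trans
        (entail (k ∷ []) 1 (35 ⊗ # 0 ⊕ lit 210 ⊕ (lit 3 ⊕ # 0)) (36 ⊗ (# 0 ⊕ lit 6)) [] refl) large))

      large₃₅′ : ∀ r → r ≤ 3 + k → 35 * k ≤ n ∸ r
      large₃₅′ r r≤ = ≤-trans (m≤m+n (35 * k) 210) (large₃₅ r r≤)

      growth : ∀ r i → suc r ≤ 3 + k → 34 * bin (n ∸ r) k i ≤ 35 * bin (n ∸ suc r) k i
      growth r i r< = entail (bin (n ∸ r) k i ∷ bin (n ∸ suc r) k i ∷ bin (n ∸ suc r) k (suc i) ∷ [])
        1 (34 ⊗ # 0) (35 ⊗ # 1)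
        ((34 ∙ # 0 ≼ # 1 ⊕ # 2 by ≤-reflexive (trans
          (cong (λ m → bin m k i) (+-∸-assoc 1 {n} {suc r}
            (<⇒≤ (≰⇒> λ n≤r → contradiction (≤-trans (large₃₅ (suc r) r<) (≤-reflexive (m≤n⇒m∸n≡0 n≤r))) (λ le →
              <⇒≱ z<s (≤-trans (m≤n+m 210 (35 * k)) le)))))) (bin-pascal (n ∸ suc r) k i))) ∷
         (1 ∙ 34 ⊗ # 2 ≼ # 1 by bin-decay 34 (n ∸ suc r) k i (large₃₅′ (suc r) r<)) ∷ []) refl

      6≤3+k : 6 ≤ 3 + k
      6≤3+k = +-monoʳ-≤ 3 3≤k

      -- Raising t by one divides the left side by at least 35 and keeps at least 34/35 of the right
      -- side, so t = 3 decides. There three steps of `growth` lead from n - 3 to n - 6, and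
      -- absorption makes the right side at least 34 k C(n-6, k-3), against 6 (35/34)³ k C(n-6,
      -- k-3).
      upper : ∀ t → 3 ≤ t → t ≤ k → 6 * k * bin (n ∸ 3) k t ≤ (k ∸ 2) * bin (n ∸ (3 + t)) k 2
      upper (suc t) 3≤t t≤k with 3 ≤? t
      ... | yes 3≤t′ = entail (6 * k * bin (n ∸ 3) k t ∷ 6 * k * bin (n ∸ 3) k (suc t) ∷
          (k ∸ 2) * bin (n ∸ (3 + t)) k 2 ∷ (k ∸ 2) * bin (n ∸ (4 + t)) k 2 ∷ [])
        1190 (# 1) (# 3)
        ((34 ∙ # 0 ≼ # 2 by upper t 3≤t′ (<⇒≤ t≤k)) ∷
         (34 ∙ 35 ⊗ # 1 ≼ # 0 by ≤-trans (≤-reflexive (commute 35 (6 * k) (bin (n ∸ 3) k (suc t))))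
           (*-monoʳ-≤ (6 * k) (bin-decay 35 (n ∸ 3) k t 36k≤n∸3))) ∷
         (1 ∙ 34 ⊗ # 2 ≼ 35 ⊗ # 3 by ≤-trans (≤-reflexive (commute 34 (k ∸ 2) _))
           (≤-trans (*-monoʳ-≤ (k ∸ 2) (growth (3 + t) 2 (+-monoʳ-≤ 3 t≤k)))
             (≤-reflexive (sym (commute 35 (k ∸ 2) (bin (n ∸ (4 + t)) k 2)))))) ∷
         []) refl
        where
        commute : ∀ a b c → a * (b * c) ≡ b * (a * c)
        commute = solve-∀
      ... | no 3≰t with ≤-antisym (s≤s⁻¹ (≰⇒> 3≰t)) (s≤s⁻¹ 3≤t)
      ...   | refl = entail (6 * k * u ∷ 6 * k * bin (n ∸ 4) k 3 ∷ 6 * k * bin (n ∸ 5) k 3 ∷ 6 * k * x ∷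
          (n ∸ 6) * x ∷ K * x ∷ (k ∸ 2) * bin (n ∸ 6) k 2 ∷ k * x ∷ [])
        -- The multipliers clear the denominators of (35/34)³: 668168 = 17 · 34³ and 728875 = 17 ·
        -- 35³.
        668168 (# 0) (# 6)
        ((19652 ∙ 34 ⊗ # 0 ≼ 35 ⊗ # 1 by scale (growth 3 3 (≤-trans (m≤m+n 4 2) 6≤3+k))) ∷
         (20230 ∙ 34 ⊗ # 1 ≼ 35 ⊗ # 2 by scale (growth 4 3 (≤-trans (m≤m+n 5 1) 6≤3+k))) ∷
         (20825 ∙ 34 ⊗ # 2 ≼ 35 ⊗ # 3 by scale (growth 5 3 6≤3+k)) ∷
         (728875 ∙ # 3 ≼ 6 ⊗ # 7 by ≤-reflexive (*-assoc 6 k x)) ∷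
         (128625 ∙ # 4 ≼ # 6 ⊕ # 5 by ≡⇒≥ (bin-absorption (n ∸ 6) k 2 3≤k)) ∷
         (128625 ∙ 35 ⊗ # 7 ≼ # 4 by ≤-trans (≤-reflexive (sym (*-assoc 35 k x)))
           (*-monoˡ-≤ x (large₃₅′ 6 6≤3+k))) ∷
         (128625 ∙ # 5 ≼ # 7 by *-monoˡ-≤ x (m∸n≤m k 3)) ∷ []) refl
        where
        x : ℕ
        x = bin (n ∸ 6) k 3
        commute : ∀ a b c → a * (b * c) ≡ b * (a * c)
        commute = solve-∀
        scale : ∀ {y z} → 34 * y ≤ 35 * z → 34 * (6 * k * y) ≤ 35 * (6 * k * z)
        scale {y} {z} le = ≤-trans (≤-reflexive (commute 34 (6 * k) y))
          (≤-trans (*-monoʳ-≤ (6 * k) le) (≤-reflexive (sym (commute 35 (6 * k) z))))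

      -- At least X - Y sets are missing from the trace counted by `P`, and Y ≤ X / 2. The half lost
      -- here is the reason why `upper` has 6 k where `Deficit` has 3 k.
      deficit-at : ∀ t {q} → 3 ≤ t → t ≤ k → q ≤ bin (n ∸ 3) k t → LateBound P (n ∸ 3) k 2 t → Deficit q
      deficit-at t {q} 3≤t t≤k q≤ late = entail ((k ∸ 2) * P ∷ (k ∸ 2) * N ∷ (k ∸ 2) * X ∷ (k ∸ 2) * Y ∷
          3 * k * q ∷ 3 * k * bin (n ∸ 3) k t ∷ 6 * k * bin (n ∸ 3) k t ∷ [])
        2 (# 0 ⊕ # 4) (# 1)
        ((2 ∙ # 0 ⊕ # 2 ≼ # 1 ⊕ # 3 by subst₂ _≤_ (*-distribˡ-+ (k ∸ 2) P X) (*-distribˡ-+ (k ∸ 2) N Y)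
          (*-monoʳ-≤ (k ∸ 2) late′)) ∷
         (1 ∙ 2 ⊗ # 3 ≼ # 2 by ≤-trans (≤-reflexive (commute 2 (k ∸ 2) Y)) (*-monoʳ-≤ (k ∸ 2) 2Y≤X)) ∷
         (1 ∙ # 6 ≼ # 2 by upper t 3≤t t≤k) ∷ (1 ∙ 2 ⊗ # 5 ≼ # 6 by ≡⇒≥ (double k (bin (n ∸ 3) k t))) ∷
         (2 ∙ # 4 ≼ # 5 by *-monoʳ-≤ (3 * k) q≤) ∷ []) refl
        where
        X Y : ℕ
        X = bin (n ∸ (3 + t)) k 2
        Y = bin (n ∸ (3 + t)) k 4
        commute : ∀ a b c → a * (b * c) ≡ b * (a * c)
        commute = solve-∀
        double : ∀ k z → 6 * k * z ≡ 2 * (3 * k * z)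
        double = solve-∀
        late′ : P + X ≤ N + Y
        late′ = subst (λ m → P + bin m k 2 ≤ N + bin m k 4) (∸-+-assoc n 3 t) late
        2Y≤X : 2 * Y ≤ X
        2Y≤X = entail (X ∷ Y ∷ bin (n ∸ (3 + t)) k 3 ∷ [])
          578 (2 ⊗ # 1) (# 0)
          ((1 ∙ 34 ⊗ # 2 ≼ # 0 by bin-decay 34 (n ∸ (3 + t)) k 2 (large₃₅′ (3 + t) (+-monoʳ-≤ 3 t≤k))) ∷
           (34 ∙ 34 ⊗ # 1 ≼ # 2 by bin-decay 34 (n ∸ (3 + t)) k 3 (large₃₅′ (3 + t) (+-monoʳ-≤ 3 t≤k))) ∷ [])
             refl

      module _ {γ : Subset 3} (apart : Apart (true ∷ true ∷ false ∷ []) γ) where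

        q : ℕ
        q = count (trace F V γ)

        -- t runs up to the largest value with q ≤ C(n-3, k-t).
        deficit : ∀ s t → 3 ≤ t → s + t ≡ suc k → q ≤ bin (n ∸ 3) k t → Deficit q
        deficit zero t 3≤t refl q≤ = subst Deficit
          (sym (n≤0⇒n≡0 (≤-trans q≤ (≤-reflexive (bin-zero (n ∸ 3) {k} ≤-refl)))))
          (≤-trans (≤-reflexive (trans (cong ((k ∸ 2) * P +_) (*-zeroʳ (3 * k))) (+-identityʳ _)))
            (*-monoʳ-≤ (k ∸ 2) P≤N))
        deficit (suc s) t 3≤t eq q≤ with late-or-hit uniform intersecting V distinct₃ t {true ∷ true ∷ false ∷
          []} {γ} apart
        ... | inj₁ late = deficit-at t 3≤t (≤-trans (m≤n+m t s) (≤-reflexive (suc-injective eq))) q≤ late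
        ... | inj₂ le = deficit s (suc t) (≤-trans 3≤t (n≤1+n t)) (trans (+-suc s t) eq)
                (≤-trans le (bin-antitone (size γ)))
          where
          bin-antitone : ∀ j → bin (n ∸ 3) k (j + suc t) ≤ bin (n ∸ 3) k (suc t)
          bin-antitone zero = ≤-refl
          bin-antitone (suc j) = ≤-trans (≤-trans (m≤n*m _ 35) (bin-decay 35 (n ∸ 3) k (j + suc t) 36k≤n∸3))
            (bin-antitone j)

      -- This is the sum of b_ia over the points i outside the triangle. Members counted by `P`
      -- spend two elements on b and c and keep k - 2 outside; for the three small families the
      -- crude k is good enough.
      sturdy-sum : (n ∸ 3) * suc bound ≤ (k ∸ 2) * P + k * (only-b + only-c + none)
      sturdy-sum = begin
        (n ∸ 3) * suc bound ≡⟨ cong (_* suc bound) (size-mask V distinct₃) ⟨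
        size M * suc bound ≤⟨ Σ∈-≥ M (λ i mi → subst (bound <_) (count-restrict-comm F i true a false)
            (sturdy i a (♯-head [] (♯-tail (a ∷ []) (♯-tail (b ∷ a ∷ []) (fresh mi)))))) ⟩
        Σ∈ M (λ i → count (F ⁻ a ⁺ i)) ≡⟨ Σ∈-cong M (λ i → count-split-inner (F ⁻ a) b c i true) ⟩
        Σ∈ M (λ i → (dP i + d₁ i) + (d₂ i + d₃ i)) ≡⟨
          trans (Σ∈-+ M (λ i → dP i + d₁ i) (λ i → d₂ i + d₃ i)) (cong₂ _+_ (Σ∈-+ M dP d₁) (Σ∈-+ M d₂ d₃)) ⟩
        (Σ∈ M dP + Σ∈ M d₁) + (Σ∈ M d₂ + Σ∈ M d₃) ≤⟨
          +-mono-≤ (+-mono-≤ (degrees M (F ⁻ a ⁺ b ⁺ c) (k ∸ 2) commonP)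
            (degrees M (F ⁻ a ⁺ b ⁻ c) k (inF (false ∷ true ∷ false ∷ [])))) (+-mono-≤
            (degrees M (F ⁻ a ⁻ b ⁺ c) k (inF (true ∷ false ∷ false ∷ [])))
              (degrees M (F ⁻ a ⁻ b ⁻ c) k (inF (false ∷ false ∷ false ∷ [])))) ⟩
        ((k ∸ 2) * P + k * only-b) + (k * only-c + k * none) ≡⟨ collect ((k ∸ 2) * P) k only-b only-c none ⟩
        (k ∸ 2) * P + k * (only-b + only-c + none) ∎
        where
        open ≤-Reasoning
        M : Subset n
        M = mask V
        dP d₁ d₂ d₃ : Fin n → ℕ
        dP i = count (F ⁻ a ⁺ b ⁺ c ⁺ i)
        d₁ i = count (F ⁻ a ⁺ b ⁻ c ⁺ i)
        d₂ i = count (F ⁻ a ⁻ b ⁺ c ⁺ i)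
        d₃ i = count (F ⁻ a ⁻ b ⁻ c ⁺ i)
        collect : ∀ p k x y z → (p + k * x) + (k * y + k * z) ≡ p + k * (x + y + z)
        collect = solve-∀
        inF : ∀ β S → trace F V β S ≡ true → common M S ≤ k
        inF β S e = common≤k M S (trace-member F V β S e)
        commonP : ∀ S → (F ⁻ a ⁺ b ⁺ c) S ≡ true → common M S ≤ k ∸ 2
        commonP S e = m+n≤o⇒m≤o∸n (common M S) (≤-reflexive (trans
          (cong (common M S +_) (sym (off-trace F V (true ∷ true ∷ false ∷ []) distinct₃ S e)))
          (trans (sym (size-common M S)) (uniform S (trace-member F V (true ∷ true ∷ false ∷ []) S e)))))

      contradiction-by : ∀ q → only-b ≤ q → only-c ≤ q → none ≤ q → Deficit q → ⊥
      contradiction-by q b≤q c≤q none≤q deficit = refute ((n ∸ 3) * suc bound ∷ (n ∸ 3) * bound ∷ n ∸ 3 ∷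
          (k ∸ 2) * P ∷ (k ∸ 2) * N ∷ k * (only-b + only-c + none) ∷ 3 * k * q ∷ [])
        ((1 ∙ # 0 ≼ # 3 ⊕ # 5 by sturdy-sum) ∷
         (1 ∙ # 5 ≼ # 6 by ≤-trans (*-monoʳ-≤ k (+-mono-≤ (+-mono-≤ b≤q c≤q) none≤q))
           (≤-reflexive (triple k q))) ∷
         (1 ∙ # 3 ⊕ # 6 ≼ # 4 by deficit) ∷ (1 ∙ # 4 ≼ # 1 by averaging) ∷
         (1 ∙ # 2 ⊕ # 1 ≼ # 0 by ≡⇒≥ (*-suc (n ∸ 3) bound)) ∷
         (1 ∙ lit 1 ≼ # 2 by ≤-trans (≤-trans (s≤s z≤n) 3≤k) (≤-trans (m≤n*m k 36) 36k≤n∸3)) ∷ []) refl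
        where
        triple : ∀ k q → k * (q + q + q) ≡ 3 * k * q
        triple = solve-∀

      -- The trace {a} is disjoint from {b, c}, but {b} and {c} are not, so `deficit` applies only
      -- to `only-a` and `none`. With `only-a` the largest of the singleton traces, the larger of
      -- these two bounds everything that has to be outweighed.
      contradiction-at : only-b ≤ only-a → only-c ≤ only-a → ⊥
      contradiction-at b≤a c≤a with ≤-total only-a none
      ... | inj₁ a≤none = contradiction-by none (≤-trans b≤a a≤none) (≤-trans c≤a a≤none) ≤-refl
              (deficit {false ∷ false ∷ false ∷ []} (refl ∷ refl ∷ refl ∷ []) (suc K) 3 ≤-refl
                (cong suc (m∸n+n≡m 3≤k)) none≤)
      ... | inj₂ none≤a = contradiction-by only-a b≤a c≤a none≤a
              (deficit {false ∷ false ∷ true ∷ []} (refl ∷ refl ∷ refl ∷ []) (suc K) 3 ≤-refl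
                (cong suc (m∸n+n≡m 3≤k))
                (≤-trans only-a≤ (≤-trans (m≤n*m v 35) 35v≤u)))

    no-triangle-at : Cross F F → ∀ {p q r} → p ≢ q → p ≢ r → q ≢ r → Heavy F p q → Heavy F p r → Heavy F q r →
      count (F ⁺ p ⁻ q ⁻ r) ≤ count (F ⁻ p ⁻ q ⁺ r) → count (F ⁻ p ⁺ q ⁻ r) ≤ count (F ⁻ p ⁻ q ⁺ r) → ⊥
    no-triangle-at intersecting {p} {q} {r} p≢q p≢r q≢r pq pr qr p≤r q≤r =
      contradiction-at intersecting (≢-sym p≢r) (≢-sym q≢r) p≢q (heavy-sym {F} pr) (heavy-sym {F} qr) pq
        (subst₂ _≤_ (count-rotate F r false p true q false) (count-rotate F r true p false q false) p≤r)
        (subst₂ _≤_ (count-rotate F r false p false q true) (count-rotate F r true p false q false) q≤r)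

    sturdy-no-triangle : Cross F F → Triangle F → ⊥
    sturdy-no-triangle intersecting (triangle {p} {q} {r} p≢q p≢r q≢r pq pr qr)
      with ≤-total (count (F ⁺ p ⁻ q ⁻ r)) (count (F ⁻ p ⁺ q ⁻ r)) | ≤-total (count (F ⁺ p ⁻ q ⁻ r))
        (count (F ⁻ p ⁻ q ⁺ r))
         | ≤-total (count (F ⁻ p ⁺ q ⁻ r)) (count (F ⁻ p ⁻ q ⁺ r))
    ... | inj₂ q≤p | inj₂ r≤p | _ = contradiction-at intersecting p≢q p≢r q≢r pq pr qr q≤p r≤p
    ... | inj₁ p≤q | _ | inj₂ r≤q = contradiction-at intersecting (≢-sym p≢q) q≢r p≢r (heavy-sym {F} pq) qr pr
            (subst₂ _≤_ (count-cong (restrict-cong (restrict-comm F p true q false) r false))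
              (count-cong (restrict-cong (restrict-comm F p false q true) r false)) p≤q)
            (subst₂ _≤_ (count-cong (restrict-cong (restrict-comm F p false q false) r true))
              (count-cong (restrict-cong (restrict-comm F p false q true) r false)) r≤q)
    ... | inj₁ p≤q | _ | inj₁ q≤r = no-triangle-at intersecting p≢q p≢r q≢r pq pr qr (≤-trans p≤q q≤r) q≤r
    ... | inj₂ q≤p | inj₁ p≤r | _ = no-triangle-at intersecting p≢q p≢r q≢r pq pr qr p≤r (≤-trans q≤p p≤r)

-- Families given as lists

isIn-lookup : ∀ {n} (i : Fin n) S → isIn i S ≡ lookup S i
isIn-lookup i S with lookup S i
... | true = refl
... | false = refl

_≟ˢ_ : ∀ {n} (S T : Subset n) → Dec (S ≡ T)
_≟ˢ_ = ≡-dec _≟ᵇ_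

_∈ᵇ_ : ∀ {n} → Subset n → List (Subset n) → Bool
S ∈ᵇ xs = does (Any.any? (S ≟ˢ_) xs)

∈ᵇ⇒∈ : ∀ {n} {S : Subset n} xs → S ∈ᵇ xs ≡ true → S ∈ₗ xs
∈ᵇ⇒∈ {S = S} xs e with Any.any? (S ≟ˢ_) xs
... | yes p = p

∈⇒∈ᵇ : ∀ {n} {S : Subset n} xs → S ∈ₗ xs → S ∈ᵇ xs ≡ true
∈⇒∈ᵇ {S = S} xs p with Any.any? (S ≟ˢ_) xs
... | yes _ = refl
... | no ¬p = contradiction p ¬p

length≤count : ∀ {n} (xs : List (Subset n)) → Unique xs → ∀ F → (∀ S → S ∈ₗ xs → F S ≡ true) →
  length xs ≤ count F
length≤count [] _ F h = z≤n
length≤count {n} (T ∷ xs) (T∉xs ∷ unique) F h = ≤-<-trans (length≤count xs unique F∖T rest)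
  (total-mono-< smaller T strict)
  where
  F∖T : Fam n
  F∖T S = F S ∧ not (does (S ≟ˢ T))
  rest : ∀ S → S ∈ₗ xs → F∖T S ≡ true
  rest S p with S ≟ˢ T
  ... | yes refl = contradiction refl (All.lookup T∉xs p)
  ... | no _ = trans (∧-identityʳ (F S)) (h S (Any.there p))
  smaller : ∀ S → bit (F∖T S) ≤ bit (F S)
  smaller S = bit-mono λ e → proj₁ (∧-true {F S} e)
  strict : bit (F∖T T) < bit (F T)
  strict with T ≟ˢ T
  ... | no T≢T = contradiction refl T≢T
  ... | yes _ rewrite ∧-zeroʳ (F T) | h T (Any.here refl) = ≤-refl

familyᵇ : ∀ {n} → Family n → Fam n
familyᵇ 𝓕 S = S ∈ᵇ members 𝓕

b≤count : ∀ {n} (𝓕 : Family n) i j → b 𝓕 i j ≤ count (familyᵇ 𝓕 ⁺ i ⁻ j)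
b≤count 𝓕 i j = length≤count (filter P? (members 𝓕)) (filter⁺ P? (distinct 𝓕)) (familyᵇ 𝓕 ⁺ i ⁻ j) λ S p →
  let (S∈ , e) = ∈-filter⁻ P? {xs = members 𝓕} p
      (ei , ej) = ∧-true {isIn i S} e
  in restrict⁺ (familyᵇ 𝓕 ⁺ i) j false S
       (restrict⁺ (familyᵇ 𝓕) i true S (∈⇒∈ᵇ (members 𝓕) S∈) (trans (sym (isIn-lookup i S)) ei))
       (not-true (trans (cong not (sym (isIn-lookup j S))) ej))
  where
  P? : ∀ S → Dec (isIn i S ∧ not (isIn j S) ≡ true)
  P? S = Data.Bool._≟_ (isIn i S ∧ not (isIn j S)) true
  not-true : ∀ {p} → not p ≡ true → p ≡ false
  not-true {false} _ = refl

minimumOr-≤ : ∀ d {x} xs → x ∈ₗ xs → minimumOr d xs ≤ x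
minimumOr-≤ d (y ∷ ys) = go ys
  where
  go : ∀ {x} zs → x ∈ₗ y ∷ zs → foldr _⊓_ y zs ≤ x
  go [] (Any.here refl) = ≤-refl
  go (z ∷ zs) (Any.here refl) = ≤-trans (m⊓n≤n z _) (go zs (Any.here refl))
  go (z ∷ zs) (Any.there (Any.here refl)) = m⊓n≤m z _
  go (z ∷ zs) (Any.there (Any.there p)) = ≤-trans (m⊓n≤n z _) (go zs (Any.there p))

β≤b : ∀ {n} (𝓕 : Family n) {i j} → i ≢ j → β 𝓕 ≤ b 𝓕 i j
β≤b {n} 𝓕 {i} {j} i≢j = minimumOr-≤ 0 _ (∈-map⁺ (λ p → b 𝓕 (proj₁ p) (proj₂ p)) (∈-concatMap⁺ _ {xs = allFin n}
  (lose (∈-allFin i) (∈-map⁺ (i ,_) (∈-filter⁺ (λ j → ¬? (i ≟ j)) (∈-allFin j) i≢j)))))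

-- The case k ≤ 2

outside-exists : ∀ {n} (S : Subset n) → size S < n → ∃[ z ] lookup S z ≡ false
outside-exists (false ∷ S) _ = zero , refl
outside-exists (true ∷ S) (s≤s lt) = let (z , e) = outside-exists S lt in suc z , e

size-insert : ∀ {n} (S : Subset n) z → lookup S z ≡ false → size (S [ z ]≔ true) ≡ suc (size S)
size-insert S z sz = trans (size-update S z) (cong (suc ∘ size)
  (trans (cong (S [ z ]≔_) (sym sz)) ([]≔-lookup S z)))

size-empty : ∀ n → size (replicate n false) ≡ 0
size-empty zero = refl
size-empty (suc n) = size-empty n

two-outside : ∀ {n} (S : Subset n) → suc (size S) < n → ∃₂ λ z z′ → z ≢ z′ × lookup S z ≡ false ×
  lookup S z′ ≡ false
two-outside {n} S lt =
  let (z , sz) = outside-exists S (<⇒≤ lt)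
      (z′ , sz′) = outside-exists (S [ z ]≔ true) (subst (_< n) (sym (size-insert S z sz)) lt)
      z≢z′ = λ z≡z′ → true≢false (lookup∘update z S true) (trans (cong (lookup (S [ z ]≔ true)) z≡z′) sz′)
  in z , z′ , z≢z′ , sz , trans (sym (lookup∘update′ (≢-sym z≢z′) S true)) sz′

three-members : ∀ {n} (S : Subset n) {x y i} → size S ≤ 2 → x ≢ y → lookup S x ≡ true → lookup S y ≡ true →
  lookup S i ≡ true → i ≢ x → i ≢ y → ⊥
three-members S {x} {y} {i} le x≢y sx sy si i≢x i≢y = <⇒≱ {2} {size S} three le
  where
  S₁ S₂ : Subset _
  S₁ = S [ x ]≔ false
  S₂ = S₁ [ y ]≔ false
  three : 3 ≤ size S
  three = ≤-trans (s≤s (s≤s (≤-trans (s≤s z≤n) (≤-reflexive (sym (size-drop S₂ i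
      (trans (lookup∘update′ i≢y S₁ false) (trans (lookup∘update′ i≢x S false) si))))))))
    (≤-reflexive (sym (trans (size-drop S x sx) (cong suc
      (size-drop S₁ y (trans (lookup∘update′ (≢-sym x≢y) S false) sy))))))

-- For z, z′ outside a member {x, y}, a member through z avoiding x is {z, y}, and a member through z′
-- avoiding y is {z′, x}; these two are disjoint.
small-not-sturdy : ∀ {n k} {F : Fam n} → 4 < n → k ≤ 2 → Uniformᶠ k F → Cross F F →
  (∀ i j → i ≢ j → 0 < count (F ⁺ i ⁻ j)) → ⊥
small-not-sturdy {n} {k} {F} 4<n k≤2 uniform intersecting sturdy =
  let (i , j , i≢j , _) = two-outside (replicate n false) (≤-trans (s≤s (s≤s (≤-reflexive (size-empty n)))) (≤-trans (s≤s (s≤s z≤n)) 4<n))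
      (S , e) = member (sturdy i j i≢j)
  in contra S (proj₁ (restrict⁻ F i true S (proj₁ (restrict⁻ (F ⁺ i) j false S e))))
  where
  size≤2 : ∀ T → F T ≡ true → size T ≤ 2
  size≤2 T eT = ≤-trans (≤-reflexive (uniform T eT)) k≤2
  with-without : ∀ {z x} → z ≢ x → ∃[ T ] F T ≡ true × lookup T z ≡ true × lookup T x ≡ false
  with-without {z} {x} z≢x = let (T , e) = member (sturdy z x z≢x)
                                 (e₁ , tx) = restrict⁻ (F ⁺ z) x false T e
                                 (e₂ , tz) = restrict⁻ F z true T e₁
                             in T , e₂ , tz , tx
  contra : ∀ S → F S ≡ true → ⊥
  contra S eS with intersecting S S eS eS | two-outside S (≤-trans (s≤s (s≤s (size≤2 S eS))) (<⇒≤ 4<n))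
  ... | at x sx _ | z , z′ , z≢z′ , sz , sz′ with with-without {z} {x} (λ { refl → true≢false sx sz })
  ...   | T , eT , tz , tx with intersecting S T eS eT
  ...     | at y sy ty with with-without {z′} {y} (λ { refl → true≢false sy sz′ })
  ...       | T′ , eT′ , tz′ , ty′ with intersecting S T′ eS eT′ | intersecting T T′ eT eT′
  ...         | at x′ sx′ tx′ | at i ti ti′ with x′ ≟ x
  ...           | no x′≢x = three-members S (size≤2 S eS) (λ { refl → true≢false ty tx }) sx sy sx′ x′≢x
        (λ { refl → true≢false tx′ ty′ })
  ...           | yes refl = three-members T (size≤2 T eT) (λ { refl → true≢false sy sz }) tz ty ti
                    (λ { refl → three-members T′ (size≤2 T′ eT′) (λ { refl → true≢false sx sz′ }) tz′ tx′ ti′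
                      z≢z′ (λ { refl → true≢false sx sz }) })
                    (λ { refl → true≢false ti′ ty′ })

-- The theorem for the two ranges of k

intersectingᵇ : ∀ {n} (𝓕 : Family n) → Intersecting 𝓕 → Cross (familyᵇ 𝓕) (familyᵇ 𝓕)
intersectingᵇ 𝓕 intersecting S T eS eT =
  let (i , p) = intersecting (∈ᵇ⇒∈ (members 𝓕) eS) (∈ᵇ⇒∈ (members 𝓕) eT)
      (iS , iT) = x∈p∩q⁻ S T p
  in at i ([]=⇒lookup iS) ([]=⇒lookup iT)

uniformᵇ : ∀ {n k} (𝓕 : Family n) → Uniform k 𝓕 → Uniformᶠ k (familyᵇ 𝓕)
uniformᵇ 𝓕 uniform S e = All.lookup uniform (∈ᵇ⇒∈ (members 𝓕) e)

theorem1p5-large : (n k : ℕ) → 3 ≤ k → 36 * (k + 6) ≤ n → (𝓕 : Family n) → Uniform k 𝓕 → Intersecting 𝓕 →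
  β 𝓕 ≤ bin (n ∸ 4) k 3
theorem1p5-large n k 3≤k large 𝓕 uniform intersecting = ≮⇒≥ λ lt →
  let sturdy : Sturdy F
      sturdy i j i≢j = <-≤-trans lt (≤-trans (β≤b 𝓕 i≢j) (b≤count 𝓕 i j))
  in sturdy-no-triangle (uniformᵇ 𝓕 uniform) sturdy (intersectingᵇ 𝓕 intersecting)
       (ample-triangle F (<-wellFounded _) (record
         { uniform = uniformᵇ 𝓕 uniform
         ; intersecting = intersectingᵇ 𝓕 intersecting
         -- The members that avoid one arbitrary point already number 35 u.
         ; many = ≤-trans (sturdy-spread (uniformᵇ 𝓕 uniform) sturdy j₀) (count-restrict F j₀ false)
         ; spread = λ j → ≤-trans (*-monoˡ-≤ u (≤ᵇ⇒≤ 9 35 tt)) (sturdy-spread (uniformᵇ 𝓕 uniform) sturdy j) }))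
  where
  open Setting {n} {k} 3≤k large
  open Triangles {n} {k} 3≤k large
  open Final {n} {k} 3≤k large
  F : Fam n
  F = familyᵇ 𝓕
  j₀ : Fin n
  j₀ = proj₁ (outside-exists (replicate n false)
    (≤-trans (s≤s (≤-reflexive (size-empty n))) (≤-trans (≤ᵇ⇒≤ 1 216 tt) 216≤n)))

theorem1p5-small : (n k : ℕ) → k ≤ 2 → 36 * (k + 6) ≤ n → (𝓕 : Family n) → Uniform k 𝓕 → Intersecting 𝓕 →
  β 𝓕 ≤ 0
theorem1p5-small n k k≤2 large 𝓕 uniform intersecting = ≮⇒≥ λ lt →
  small-not-sturdy (≤-trans (≤ᵇ⇒≤ 5 216 tt) (≤-trans (*-monoʳ-≤ 36 (m≤n+m 6 k)) large)) k≤2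
    (uniformᵇ 𝓕 uniform) (intersectingᵇ 𝓕 intersecting)
    λ i j i≢j → <-≤-trans lt (≤-trans (β≤b 𝓕 i≢j) (b≤count 𝓕 i j))

theorem1p5 : (n k : ℕ) → 36 * (k + 6) ≤ n → (𝓕 : Family n) → Uniform k 𝓕 → Intersecting 𝓕 →
    β 𝓕 ≤ binomMinus3 (n ∸ 4) k
-- `binomMinus3` unfolds only for a `k` in constructor form, to 0 or to the value of `bin` at index
-- 3.
theorem1p5 n k@0 = theorem1p5-small n k z≤n
theorem1p5 n k@1 = theorem1p5-small n k (s≤s z≤n)
theorem1p5 n k@2 = theorem1p5-small n k ≤-refl
theorem1p5 n k@(suc (suc (suc _))) = theorem1p5-large n k (s≤s (s≤s (s≤s z≤n)))
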